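{- Let $G=(V,E)$ be a finite simple strongly connected directed graph, and fix a total order on $V$. Then $$\det(\mathcal L)=\prod_{\substack{W\subseteq V\\ W\text{ strongly connected}}}\det(L_W)^{m(W)},$$ the product being over all nonempty strongly connected subsets $W\subseteq V$ (including $W=V$), where $m(W)=m(W,w)$ for any $w\in W$ (this number does not depend on the choice of $w\in W$).
   Context: Setup. $G=(V,E)$ is a finite simple directed graph (no multiple edges, no loops); $s(e),t(e)$ denote the source and target of an edge $e$. For $W\subseteq V$, $G_W$ is the induced subgraph on $W$; $W$ is strongly connected if $G_W$ is. Let $x_e$ ($e\in E$) and $y_v$ ($v\in V$) be independent indeterminates. The weighted Laplacian $Q$ is the $V\times V$ matrix with $Q_{vw}=x_e$ if $v\neq w$ and $e$ is an edge from $v$ to $w$ (and $0$ if there is no such edge), and $Q_{vv}=-\sum_{e:s(e)=v}x_e$. The Schrödinger operator is $L=Q+Y$ where $Y$ is diagonal with $Y_{vv}=y_v$. For $W\subseteq V$, $L_W$ is the submatrix of $L$ with rows and columns indexed by $W$. Spanning trees. An (oriented) spanning tree of $G$ is a subgraph containing all vertices, with no cycle, in which one vertex (the root) has outdegree $0$ and every other vertex has outdegree $1$. The tree graph $\mathcal TG$ has as vertex set the set $\mathcal TV$ of spanning trees of $G$; for a tree $\mathbf a$ with root $r$ and an edge $e\in E$ with $s(e)=r$, let $\mathbf b$ be obtained from $\mathbf a$ by adding $e$ and deleting the edge of $\mathbf a$ going out of $t(e)$ ($\mathbf b$ is a spanning tree rooted at $t(e)$); then $\mathbf a\to\mathbf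 b$ is an edge of $\mathcal TG$, with weight $x_e$. The lifted Schrödinger operator $\mathcal L$ is the $\mathcal TV\times\mathcal TV$ matrix with $\mathcal L_{\mathbf a\mathbf b}=x_e$ if $\mathbf a\to\mathbf b$ is an edge of $\mathcal TG$ constructed from $e$, $\mathcal L_{\mathbf a\mathbf c}=0$ if $\mathbf a\ne\mathbf c$ and there is no edge $\mathbf a\to\mathbf c$, and $\mathcal L_{\mathbf a\mathbf a}=-\sum_{e:s(e)=r}x_e+y_r$ where $r$ is the root of $\mathbf a$. Exploration algorithm (depends on the fixed total order of $V$). Input: a spanning tree $\mathbf a$ rooted at $v$. Running variables: a set $A$ of vertices, a first-in-first-out list $\mathbf L$ of edges, a set $F$ of edges. Initialization: $A=\{v\}$, $F=\{e\in E: s(e)\neq v\}$, $\mathbf L=$ the edges with target $v$, ordered by increasing source. Iteration: while $\mathbf L$ is nonempty, take the first edge $e$ of $\mathbf L$, with source $w$. If $e$ belongs to $\mathbf a$: add $w$ to $A$; delete from $\mathbf L$ (and from $F$) all edges with source $w$; append at the end of $\mathbf L$ all edges of $F$ with target $w$, by increasing source. Otherwise: delete from $\mathbf L$ and from $F$ all edges with source or target $w$ (one says $w$ is erased). Termination: $\phi(\mathbf a)$ is the final value of $A$, and $\psi(\mathbf a)$ is the strongly connected component of $v$ in the induced subgraph $G_{\phi(\mathbf a)}$. Multiplicities. For a strongly connected $W\subseteq V$ and $w\in W$, $m(W,w)$ is the number of spanning trees $\mathbf a$ of $G$ rooted at $w$ with $\psi(\mathbf a)=W$. -}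

module Defs where

open import Algebra.Bundles using (CommutativeRing)
open import Data.Bool.Base using (Bool; true; false; if_then_else_)
open import Data.Bool.Properties using () renaming (_≟_ to _≟ᵇ_)
open import Data.Empty using (⊥-elim)
open import Data.Fin.Base using (Fin; zero; suc; toℕ; fromℕ<; punchIn)
open import Data.Fin.Properties
  using (_≟_; any?; all?; toℕ<n; toℕ-fromℕ<; toℕ-injective)
open import Data.Fin.Subset
  using (Subset; _∈_; _∉_; _∪_; ⁅_⁆; ⊥; ⊤; ∣_∣; Nonempty)
open import Data.Fin.Subset.Properties using (_∈?_; nonempty?)
open import Data.List.Base as List
  using (List; []; _∷_; _++_; length; filter; allFin; cartesianProduct; cartesianProductWith)
open import Data.Nat.Base as ℕ using (ℕ; zero; suc; _<_; _≤_; s≤s)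
import Data.Nat.Properties as ℕ
open import Data.Product.Base using (∃; _×_; _,_; proj₁; proj₂; uncurry)
import Data.Product.Properties as Product
open import Data.Sum.Base using (_⊎_; inj₁; inj₂)
open import Data.Vec.Base as Vec using (Vec; []; _∷_; lookup; _[_]≔_; _[_]%=_)
import Data.Vec.Properties as Vec
open import Level using (0ℓ)
open import Relation.Binary.Core using (Rel)
open import Relation.Binary.Definitions using (Decidable; DecidableEquality)
open import Relation.Binary.Construct.Closure.ReflexiveTransitive
  using (Star; ε; _◅_; _◅◅_)
open import Relation.Binary.Construct.Closure.Transitive
  using (TransClosure; [_]; _∷_)
open import Relation.Binary.PropositionalEquality
  using (_≡_; _≢_; refl; sym; trans; subst)
open import Relation.Nullary
  using (Dec; does; yes; no; ¬_; ¬?; _×-dec_; _⊎-dec_; _→-dec_; map′)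
import Relation.Unary as U

private
  variable
    n : ℕ

vecs : ∀ {a} {A : Set a} → List A → (k : ℕ) → List (Vec A k)
vecs xs zero    = [] ∷ []
vecs xs (suc k) = cartesianProductWith _∷_ xs (vecs xs k)

subsets : (n : ℕ) → List (Subset n)
subsets n = vecs (true ∷ false ∷ []) n

elements : Subset n → List (Fin n)
elements W = filter (_∈? W) (allFin _)

comprehension : {P : U.Pred (Fin n) 0ℓ} → U.Decidable P → Subset n
comprehension P? = Vec.tabulate λ v → does (P? v)

------------------------------------------------------------------------
-- Decidability of reachability (Warshall's algorithm): `Via k u v` says
-- that v is reachable from u through intermediate vertices below k.

module Reachability {R : Rel (Fin n) 0ℓ} (R? : Decidable R) where

  Via : (k : ℕ) → k ≤ n → Rel (Fin n) 0ℓ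
  Via zero    _   u v = u ≡ v ⊎ R u v
  Via (suc k) k<n u v =
    Via k (ℕ.<⇒≤ k<n) u v ⊎
    (Via k (ℕ.<⇒≤ k<n) u (fromℕ< k<n) × Via k (ℕ.<⇒≤ k<n) (fromℕ< k<n) v)

  via? : ∀ k k≤n → Decidable (Via k k≤n)
  via? zero    _   u v = u ≟ v ⊎-dec R? u v
  via? (suc k) k<n u v =
    via? k _ u v ⊎-dec (via? k _ u (fromℕ< k<n) ×-dec via? k _ (fromℕ< k<n) v)

  via⇒star : ∀ k k≤n {u v} → Via k k≤n u v → Star R u v
  via⇒star zero    _ (inj₁ refl)    = ε
  via⇒star zero    _ (inj₂ r)       = r ◅ ε
  via⇒star (suc k) _ (inj₁ p)       = via⇒star k _ p
  via⇒star (suc k) _ (inj₂ (p , q)) = via⇒star k _ p ◅◅ via⇒star k _ q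

  via-edge : ∀ k k≤n {u v} → R u v → Via k k≤n u v
  via-edge zero    _ r = inj₂ r
  via-edge (suc k) _ r = inj₁ (via-edge k _ r)

  via-refl : ∀ k k≤n {u} → Via k k≤n u u
  via-refl zero    _ = inj₁ refl
  via-refl (suc k) _ = inj₁ (via-refl k _)

  via-trans : ∀ k k≤n {u v w} → toℕ v < k →
              Via k k≤n u v → Via k k≤n v w → Via k k≤n u w
  via-trans (suc k) k<n {u} {v} {w} (s≤s v≤k) p q with toℕ v ℕ.≟ k
  ... | yes v≡k = through (toPivot p) (fromPivot q)
    where
    pivot : Fin n
    pivot = fromℕ< k<n

    v≡pivot : v ≡ pivot
    v≡pivot = toℕ-injective (trans v≡k (sym (toℕ-fromℕ< k<n)))

    toPivot : Via (suc k) k<n u v → Via k _ u pivot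
    toPivot (inj₁ p)       = subst (Via k _ u) v≡pivot p
    toPivot (inj₂ (p , _)) = p

    fromPivot : Via (suc k) k<n v w → Via k _ pivot w
    fromPivot (inj₁ q)       = subst (λ z → Via k _ z w) v≡pivot q
    fromPivot (inj₂ (_ , q)) = q

    through : Via k _ u pivot → Via k _ pivot w → Via (suc k) k<n u w
    through p q = inj₂ (p , q)
  ... | no v≢k = compose p q
    where
    v<k : toℕ v < k
    v<k = ℕ.≤∧≢⇒< v≤k v≢k

    compose : Via (suc k) k<n u v → Via (suc k) k<n v w → Via (suc k) k<n u w
    compose (inj₁ p)       (inj₁ q)       = inj₁ (via-trans k _ v<k p q)
    compose (inj₁ p)       (inj₂ (q , s)) = inj₂ (via-trans k _ v<k p q , s)
    compose (inj₂ (p , s)) (inj₁ q)       = inj₂ (p , via-trans k _ v<k s q)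
    compose (inj₂ (p , _)) (inj₂ (_ , s)) = inj₂ (p , s)

  star⇒via : ∀ {u v} → Star R u v → Via n ℕ.≤-refl u v
  star⇒via ε              = via-refl n _
  star⇒via (_◅_ {j = j} r p) =
    via-trans n _ (toℕ<n j) (via-edge n _ r) (star⇒via p)

  star? : Decidable (Star R)
  star? u v = map′ (via⇒star n _) star⇒via (via? n _ u v)

  plus? : Decidable (TransClosure R)
  plus? u v = map′ to from (any? λ w → R? u w ×-dec star? w v)
    where
    cons : ∀ {u w v} → R u w → Star R w v → TransClosure R u v
    cons r ε        = [ r ]
    cons r (s ◅ ss) = r ∷ cons s ss

    to : ∃ (λ w → R u w × Star R w v) → TransClosure R u v
    to (_ , r , p) = cons r p

    star : ∀ {u v} → TransClosure R u v → Star R u v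
    star [ r ]   = r ◅ ε
    star (r ∷ p) = r ◅ star p

    from : TransClosure R u v → ∃ (λ w → R u w × Star R w v)
    from [ r ]   = _ , r , ε
    from (r ∷ p) = _ , r , star p

------------------------------------------------------------------------
-- Directed graphs on the vertex set Fin n, totally ordered by the usual
-- order of Fin n.

-- Row u is the set of targets of the edges with source u.
EdgeSet : ℕ → Set
EdgeSet n = Vec (Subset n) n

Joins : EdgeSet n → Rel (Fin n) 0ℓ
Joins T u v = v ∈ lookup T u

joins? : (T : EdgeSet n) → Decidable (Joins T)
joins? T u v = v ∈? lookup T u

edgeSets : (n : ℕ) → List (EdgeSet n)
edgeSets n = vecs (subsets n) n

record Digraph (n : ℕ) : Set where
  field
    edgeSet  : EdgeSet n
    loopless : ∀ v → ¬ Joins edgeSet v v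

module _ (G : Digraph n) where

  open Digraph G

  infix 4 _⟶_ _⟶?_

  _⟶_ : Rel (Fin n) 0ℓ
  _⟶_ = Joins edgeSet

  _⟶?_ : Decidable _⟶_
  _⟶?_ = joins? edgeSet

  Induced : Subset n → Rel (Fin n) 0ℓ
  Induced W u v = u ∈ W × v ∈ W × u ⟶ v

  induced? : ∀ W → Decidable (Induced W)
  induced? W u v = u ∈? W ×-dec v ∈? W ×-dec u ⟶? v

  StronglyConnected : Subset n → Set
  StronglyConnected W =
    Nonempty W × (∀ u v → u ∈ W → v ∈ W → Star (Induced W) u v)

  stronglyConnected? : U.Decidable StronglyConnected
  stronglyConnected? W =
    nonempty? W ×-dec
    all? λ u → all? λ v → u ∈? W →-dec v ∈? W →-dec star? u v
    where open Reachability (induced? W)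

  InComponent : Subset n → Fin n → Fin n → Set
  InComponent W v w = w ∈ W × Star (Induced W) v w × Star (Induced W) w v

  component : Subset n → Fin n → Subset n
  component W v = comprehension {P = InComponent W v} λ w →
    w ∈? W ×-dec star? v w ×-dec star? w v
    where open Reachability (induced? W)

  ----------------------------------------------------------------------
  -- Spanning trees and the tree graph

  record IsSpanningTree (root : Fin n) (T : EdgeSet n) : Set where
    constructor mkIsSpanningTree
    field
      subgraph   : ∀ u v → Joins T u v → u ⟶ v
      acyclic    : ∀ v → ¬ TransClosure (Joins T) v v
      root-out   : ∣ lookup T root ∣ ≡ 0
      others-out : ∀ v → v ≢ root → ∣ lookup T v ∣ ≡ 1

  isSpanningTree? : ∀ r T → Dec (IsSpanningTree r T)
  isSpanningTree? r T = map′
    (λ (s , a , r₀ , o) → mkIsSpanningTree s a r₀ o)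
    (λ t → let open IsSpanningTree t in subgraph , acyclic , root-out , others-out)
    ((all? λ u → all? λ v → joins? T u v →-dec u ⟶? v) ×-dec
     (all? λ v → ¬? (plus? v v)) ×-dec
     (∣ lookup T r ∣ ℕ.≟ 0) ×-dec
     (all? λ v → ¬? (v ≟ r) →-dec (∣ lookup T v ∣ ℕ.≟ 1)))
    where open Reachability (joins? T)

-- A spanning tree is handled as the pair of its root and its edge set.
-- As the edge set determines the root, no tree is listed twice.
Rooted : ℕ → Set
Rooted n = Fin n × EdgeSet n

_≟ᵗ_ : DecidableEquality (Rooted n)
_≟ᵗ_ = Product.≡-dec _≟_ (Vec.≡-dec (Vec.≡-dec _≟ᵇ_))

_≟ˢ_ : DecidableEquality (Subset n)
_≟ˢ_ = Vec.≡-dec _≟ᵇ_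

spanningTrees : Digraph n → List (Rooted n)
spanningTrees {n} G =
  filter (λ (r , T) → isSpanningTree? G r T) (cartesianProduct (allFin n) (edgeSets n))

-- Add the edge from the root r to u, delete the edge going out of u.
move : Rooted n → Fin n → Rooted n
move (r , T) u = u , (T [ r ]%= (⁅ u ⁆ ∪_)) [ u ]≔ ⊥

TreeEdge : Digraph n → Rel (Rooted n) 0ℓ
TreeEdge G a b = _⟶_ G (proj₁ a) (proj₁ b) × b ≡ move a (proj₁ b)

treeEdge? : (G : Digraph n) → Decidable (TreeEdge G)
treeEdge? G a b = _⟶?_ G (proj₁ a) (proj₁ b) ×-dec b ≟ᵗ move a (proj₁ b)

------------------------------------------------------------------------
-- The exploration algorithm

-- (u , v) is the edge with source u and target v.
Edge : ℕ → Set
Edge n = Fin n × Fin n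

-- The list is lexicographically sorted, so among edges with a common
-- target the sources increase; `filter` preserves this order.
edges : Digraph n → List (Edge n)
edges {n} G = filter (uncurry (_⟶?_ G)) (cartesianProduct (allFin n) (allFin n))

targeting : Fin n → List (Edge n) → List (Edge n)
targeting w = filter λ (_ , v) → v ≟ w

dropSource : Fin n → List (Edge n) → List (Edge n)
dropSource w = filter λ (u , _) → ¬? (u ≟ w)

dropIncident : Fin n → List (Edge n) → List (Edge n)
dropIncident w = filter λ (u , v) → ¬? (u ≟ w) ×-dec ¬? (v ≟ w)

-- `loop T k A L F` performs at most k iterations.  In every iteration the
-- edge at the head of L is removed from F as well (L stays contained in
-- F), hence k ≥ length F iterations suffice to empty L.
loop : EdgeSet n → ℕ → Subset n → List (Edge n) → List (Edge n) → Subset n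
loop T zero    A L             F = A
loop T (suc k) A []            F = A
loop T (suc k) A ((w , u) ∷ L) F =
  if does (joins? T w u)
  then (let F′ = dropSource w F in
        loop T k (A ∪ ⁅ w ⁆) (dropSource w L ++ targeting w F′) F′)
  else loop T k A (dropIncident w L) (dropIncident w F)

φ : Digraph n → Rooted n → Subset n
φ G (v , T) =
  loop T (length (edges G)) ⁅ v ⁆ (targeting v (edges G)) (dropSource v (edges G))

ψ : Digraph n → Rooted n → Subset n
ψ G a = component G (φ G a) (proj₁ a)

multiplicity : Digraph n → Subset n → Fin n → ℕ
multiplicity G W w =
  length (filter (λ a → proj₁ a ≟ w ×-dec ψ G a ≟ˢ W) (spanningTrees G))

------------------------------------------------------------------------
-- Determinants and Schrödinger operators

module _ {c ℓ} (R : CommutativeRing c ℓ) where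

  open CommutativeRing R
    using (Carrier; 0#; 1#; _+_; _*_; -_; semiring; *-rawMonoid)
  open import Algebra.Properties.Semiring.Sum semiring using (sum)
  open import Algebra.Properties.Semiring.Exp semiring using (_^_)

  -- Laplace expansion along the first row.
  det : ∀ {k} → (Fin k → Fin k → Carrier) → Carrier
  det {zero}  M = 1#
  det {suc k} M = sum λ j →
    (- 1#) ^ toℕ j * (M zero j * det λ i i′ → M (suc i) (punchIn j i′))

  -- Determinant of the matrix whose rows and columns are indexed by the
  -- entries of a list without repetitions.
  detOn : ∀ {a} {I : Set a} → List I → (I → I → Carrier) → Carrier
  detOn is M = det λ i j → M (List.lookup is i) (List.lookup is j)

  module _ (G : Digraph n)
           (x : Fin n → Fin n → Carrier)
           (y : Fin n → Carrier) where

    -- x u v stands for the variable of the edge from u to v; its value is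
    -- used only when there is such an edge.
    weight : Fin n → Fin n → Carrier
    weight u v = if does (_⟶?_ G u v) then x u v else 0#

    Laplacian : Fin n → Fin n → Carrier
    Laplacian v w = if does (v ≟ w) then - sum (weight v) else weight v w

    Potential : Fin n → Fin n → Carrier
    Potential v w = if does (v ≟ w) then y v else 0#

    Schrödinger : Fin n → Fin n → Carrier
    Schrödinger v w = Laplacian v w + Potential v w

    LiftedSchrödinger : Rooted n → Rooted n → Carrier
    LiftedSchrödinger a b =
      if does (a ≟ᵗ b) then - sum (weight (proj₁ a)) + y (proj₁ a)
      else if does (treeEdge? G a b) then x (proj₁ a) (proj₁ b)
      else 0#

    detLifted : Carrier
    detLifted = detOn (spanningTrees G) LiftedSchrödinger

    detRestricted : Subset n → Carrier
    detRestricted W = detOn (elements W) Schrödinger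

    factorisation : (Subset n → ℕ) → Carrier
    factorisation m =
      List.foldr _*_ 1#
        (List.map (λ W → detRestricted W ^ m W)
          (filter (stronglyConnected? G) (subsets n)))

{-# OPTIONS --safe #-}

-- Both sides of the identity are governed by the numbers N(S) of spanning
-- forests whose set of roots is S.
--
-- Multiplicities: fix v in a strongly connected set S.  Restricting a tree a
-- rooted at v with S ⊆ ψ(a) to the edges going out of V ∖ S is a bijection
-- onto the forests with roots S; the inverse runs the exploration and lets
-- every vertex of S be accepted by the first edge proposed for it.  Hence the
-- m(W,v) with W ⊇ S add up to N(S), and Möbius inversion shows that m(W,v)
-- does not depend on v.
--
-- Determinants: enlarge the state space from trees to pairs (v , T) of a
-- partial forest T (an acyclic set of edges with at most one edge out of each
-- vertex) and a root v of T, keeping only those with K ⊆ roots(T) ∌ v ∉ K.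
-- A move can only shrink the set of the other roots, so the determinant of
-- the extended operator is the product, over Z ⊇ K, of the determinants D(Z)
-- of its blocks, where D(∅) is the determinant in question.  On functions, in
-- the basis of the indicator functions of "contains f", the operator is
-- triangular with blocks L_W, W = roots(f) ∖ K.  Comparing, and solving for
-- D(K) by downward induction on K, gives D(∅) · Π(q) = Π(p), where Π(p)
-- denotes the product of the det(L_W)^p(W) and where p − q has the same sums
-- over W ⊇ S as m, namely N(S).  So p = q + m, and Π(q) can be cancelled after
-- the potential y has been replaced by y + t with a new variable t, because
-- this makes each det(L_W) monic in t.

module Submission where

open import Defs
open import Algebra.Bundles using (CommutativeMonoid; CommutativeRing)
open import Data.Bool.Base using (true; false; if_then_else_)
open import Data.Empty using (⊥-elim)
open import Data.Fin.Base using (Fin; zero; suc; toℕ; punchIn; cast; _↑ˡ_; _↑ʳ_)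
open import Data.Fin.Properties using (_≟_; any?; all?; punchIn-punchOut; cast-is-id)
open import Data.Fin.Subset
  using (Subset; _∈_; _∉_; _⊆_; _⊂_; _⊃_; _∪_; _─_; ⁅_⁆; ⊥; ⊤; ∣_∣)
open import Data.Fin.Subset.Induction using (⊂-wellFounded; ⊃-wellFounded)
open import Data.Fin.Subset.Properties
open import Data.List.Base as List
  using (List; []; _∷_; _++_; allFin; cartesianProduct; cartesianProductWith; filter; length)
import Data.List.Membership.Propositional as List
open import Data.List.Membership.Propositional.Properties
  using (∈-allFin; ∈-cartesianProduct⁺; ∈-cartesianProductWith⁺; ∈-filter⁺; ∈-filter⁻;
         ∈-lookup; ∈-map⁺; ∈-map⁻; ∈-++⁺ˡ; ∈-++⁺ʳ; ∈-++⁻)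
open import Data.List.Membership.Propositional.Properties.WithK using (unique∧set⇒bag)
open import Data.List.Properties
  using (filter-accept; filter-none; filter-notAll; filter-reject; filter-≐; length-filter; length-map)
open import Data.List.Relation.Binary.BagAndSetEquality using (∼bag⇒↭)
open import Data.List.Relation.Binary.Permutation.Homogeneous using (onIndices)
open import Data.List.Relation.Binary.Permutation.Propositional as ↭
  using (_↭_; prep; ↭-sym; ↭-trans; ↭⇒↭ₛ)
open import Data.List.Relation.Binary.Permutation.Propositional.Properties
  using (shift; ↭-length; ++-comm)
import Data.List.Relation.Binary.Permutation.Setoid.Properties as ↭ₛ
open import Data.List.Relation.Unary.All as All using (All; []; _∷_)
import Data.List.Relation.Unary.All.Properties as All
open import Data.List.Relation.Unary.AllPairs as AllPairs using (AllPairs; []; _∷_)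
import Data.List.Relation.Unary.AllPairs.Properties as AllPairs
open import Data.List.Relation.Unary.Any as Any using (here; there)
open import Data.List.Relation.Unary.Unique.Propositional using (Unique)
import Data.List.Relation.Unary.Unique.Propositional.Properties as Unique
open import Data.Nat.Base as ℕ using (ℕ; zero; suc; _≤_; _<_; z≤n; s≤s)
import Data.Nat.Properties as ℕ
open import Data.Nat.Solver using (module +-*-Solver)
open import Data.Product.Base using (∃; _×_; _,_; proj₁; proj₂; uncurry)
open import Data.Sum.Base as Sum using (_⊎_; inj₁; inj₂)
import Data.Unit.Polymorphic.Base as Unit
open import Data.Vec.Base as Vec using (Vec; []; _∷_; lookup; tabulate; _[_]≔_; _[_]%=_)
import Data.Vec.Functional as Functional
import Data.Vec.Functional.Properties as Functional
import Data.Vec.Properties as Vec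
open import Data.Vec.Relation.Binary.Pointwise.Inductive using (Pointwise; []; _∷_)
open import Function.Base using (_∘_; id)
open import Function.Bundles using (Inverse; mk⇔)
open import Induction.WellFounded using (Acc; acc)
open import Level using (Level; _⊔_)
open import Relation.Binary.Construct.Closure.ReflexiveTransitive as Star using (Star; ε; _◅_; _◅◅_)
open import Relation.Binary.Construct.Closure.Transitive using (TransClosure; [_]; _∷_)
open import Relation.Binary.Definitions using (DecidableEquality)
open import Relation.Binary.PropositionalEquality as ≡
  using (_≡_; _≢_; refl; sym; trans; cong; cong₂; subst; module ≡-Reasoning)
open import Relation.Nullary
  using (Dec; does; yes; no; ¬_; ¬?; contradiction; map′; _×-dec_; _⊎-dec_; _→-dec_)
open import Relation.Nullary.Decidable using (dec-true; dec-false)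
import Relation.Unary as U

-- Over trees alone, the functions "contains f" are too numerous to form a basis. With partial
-- forests as states there is one such function per state, and inclusion makes the change of basis
-- unitriangular. The price is that a single comparison only yields a product of many D(Z); letting
-- K vary turns these products into a triangular system. The ring is arbitrary and the det(L_W) may
-- be zero divisors, so this system is not solved by division. Each D(K) carries two exponent
-- functions and a multiplied-out equation, and one cancellation is made at the very end. The
-- exponents themselves are never computed, only their sums over W ⊇ S for strongly connected S. For
-- det(L_W) this sum is 1 if S ⊆ W and 0 otherwise: L_W is block triangular along the strong
-- components of G_W, and S ⊆ W lies in exactly one of them. So the side of the L_W counts the
-- forests whose roots contain K and, disjointly from it, S. Solving for D(Z) leaves the forests
-- whose roots are the disjoint union of Z and S, which gives N(S) at Z = ∅.

private
  variable
    n : ℕ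

-- Folds over lists

filter-∩ : ∀ {a p q r} {A : Set a} {P : U.Pred A p} {Q : U.Pred A q} {R : U.Pred A r}
           (P? : U.Decidable P) (Q? : U.Decidable Q) (R? : U.Decidable R) →
           (∀ {x} → P x → Q x → R x) → (∀ {x} → R x → P x) → (∀ {x} → R x → Q x) →
           ∀ xs → filter P? (filter Q? xs) ≡ filter R? xs
filter-∩ P? Q? R? PQ⇒R R⇒P R⇒Q [] = ≡.refl
filter-∩ P? Q? R? PQ⇒R R⇒P R⇒Q (x ∷ xs) with ih ← filter-∩ P? Q? R? PQ⇒R R⇒P R⇒Q xs | Q? x
... | no ¬q = ≡.trans ih (≡.sym (filter-reject R? (¬q ∘ R⇒Q)))
... | yes q with P? x
...   | yes p = ≡.trans (≡.cong (x ∷_) ih) (≡.sym (filter-accept R? (PQ⇒R p q)))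
...   | no ¬p = ≡.trans ih (≡.sym (filter-reject R? (¬p ∘ R⇒P)))

filter-partition-↭ : ∀ {a p} {A : Set a} {P : U.Pred A p} (P? : U.Decidable P) xs →
                     xs ↭ filter P? xs ++ filter (¬? ∘ P?) xs
filter-partition-↭ P? [] = ↭.refl
filter-partition-↭ P? (x ∷ xs) with does (P? x)
... | true  = prep x (filter-partition-↭ P? xs)
... | false = ↭-trans (prep x (filter-partition-↭ P? xs)) (↭-sym (shift x _ _))

module ListFold {c ℓ} (M : CommutativeMonoid c ℓ) where

  open CommutativeMonoid M renaming (ε to unit; refl to ≈-refl; sym to ≈-sym; trans to ≈-trans)
  open import Relation.Binary.Reasoning.Setoid setoid
  open import Algebra.Properties.CommutativeSemigroup commutativeSemigroup using (interchange)

  infix 6 ⨁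
  ⨁ : ∀ {a} {A : Set a} → List A → (A → Carrier) → Carrier
  ⨁ xs f = List.foldr _∙_ unit (List.map f xs)

  private
    variable
      a b : Level
      A : Set a
      B : Set b

  ⨁-cong : ∀ (xs : List A) {f g} → (∀ {x} → x List.∈ xs → f x ≈ g x) → ⨁ xs f ≈ ⨁ xs g
  ⨁-cong []       f≈g = ≈-refl
  ⨁-cong (x ∷ xs) f≈g = ∙-cong (f≈g (here ≡.refl)) (⨁-cong xs (f≈g ∘ there))

  ⨁-unit : ∀ (xs : List A) {f} → (∀ {x} → x List.∈ xs → f x ≈ unit) → ⨁ xs f ≈ unit
  ⨁-unit []       f≈unit = ≈-refl
  ⨁-unit (x ∷ xs) f≈unit = ≈-trans (∙-cong (f≈unit (here ≡.refl)) (⨁-unit xs (f≈unit ∘ there))) (identityˡ unit)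

  ⨁-∙ : ∀ (xs : List A) f g → ⨁ xs (λ x → f x ∙ g x) ≈ ⨁ xs f ∙ ⨁ xs g
  ⨁-∙ []       f g = ≈-sym (identityˡ unit)
  ⨁-∙ (x ∷ xs) f g = ≈-trans (∙-congˡ (⨁-∙ xs f g)) (interchange _ _ _ _)

  ⨁-comm : ∀ (xs : List A) (ys : List B) (f : A → B → Carrier) →
           ⨁ xs (λ x → ⨁ ys (f x)) ≈ ⨁ ys (λ y → ⨁ xs λ x → f x y)
  ⨁-comm []       ys f = ≈-sym (⨁-unit ys λ _ → ≈-refl)
  ⨁-comm (x ∷ xs) ys f = ≈-trans (∙-congˡ (⨁-comm xs ys f)) (≈-sym (⨁-∙ ys _ _))

  ⨁-single : ∀ {xs : List A} {x} {f} → Unique xs → x List.∈ xs →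
             (∀ {y} → y List.∈ xs → y ≢ x → f y ≈ unit) → ⨁ xs f ≈ f x
  ⨁-single {xs = x ∷ xs} (x∉ ∷ uniq) (here ≡.refl) f≈unit = ≈-trans
    (∙-congˡ (⨁-unit xs λ y∈ → f≈unit (there y∈) (≡.≢-sym (All.lookup x∉ y∈)))) (identityʳ _)
  ⨁-single {xs = y ∷ xs} (y∉ ∷ uniq) (there x∈) f≈unit = ≈-trans
    (∙-cong (f≈unit (here ≡.refl) (All.lookup y∉ x∈)) (⨁-single uniq x∈ (f≈unit ∘ there))) (identityˡ _)

  -- The remainder runs over the same list with the value at `x` overwritten by the unit, so the
  -- exclusion of `x` sits in the summand and nothing is deleted from the list.
  ⨁-remove : (_≟_ : DecidableEquality A) → ∀ {xs x} f → Unique xs → x List.∈ xs →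
             ⨁ xs f ≈ f x ∙ ⨁ xs (λ y → if does (y ≟ x) then unit else f y)
  ⨁-remove _≟_ {xs} {x} f uniq x∈ = begin
    ⨁ xs f                ≈⟨ ⨁-cong xs split ⟩
    ⨁ xs (λ y → g y ∙ h y) ≈⟨ ⨁-∙ xs g h ⟩
    ⨁ xs g ∙ ⨁ xs h       ≈⟨ ∙-congʳ (≈-trans (⨁-single uniq x∈ λ _ → away) at) ⟩
    f x ∙ ⨁ xs h          ∎
    where
    g h : _ → Carrier
    g y = if does (y ≟ x) then f y else unit
    h y = if does (y ≟ x) then unit else f y
    split : ∀ {y} → y List.∈ xs → f y ≈ g y ∙ h y
    split {y} _ with does (y ≟ x)
    ... | true  = ≈-sym (identityʳ _)
    ... | false = ≈-sym (identityˡ _)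
    away : ∀ {y} → y ≢ x → g y ≈ unit
    away {y} y≢x with y ≟ x
    ... | yes y≡x = contradiction y≡x y≢x
    ... | no _    = ≈-refl
    at : g x ≈ f x
    at with x ≟ x
    ... | yes _  = ≈-refl
    ... | no x≢x = contradiction ≡.refl x≢x

-- Multilinear algebra of determinants

module Determinant {c ℓ} (R : CommutativeRing c ℓ) where

  open CommutativeRing R hiding (zero) renaming (refl to ≈-refl; sym to ≈-sym; trans to ≈-trans)
  open import Algebra.Properties.Ring ring
    using (-‿distribˡ-*; -‿involutive; x+x≈x⇒x≈0; -1*x≈-x)
  open import Algebra.Properties.Group +-group using (inverseˡ-unique)
  open import Algebra.Properties.Semiring.Sum semiring
  open import Algebra.Properties.Semiring.Exp semiring using (_^_)
  open import Relation.Binary.Reasoning.Setoid setoid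
  open import Algebra.Solver.Ring.NaturalCoefficients.Default commutativeSemiring
    using (solve; _:+_; _:*_; _:=_)

  Row : ℕ → Set c
  Row n = Fin n → Carrier

  infix 4 _≋_
  _≋_ : ∀ {n} → Row n → Row n → Set ℓ
  r ≋ r′ = ∀ j → r j ≈ r′ j

  Repeated : ∀ {n} k → (Vec (Row n) (suc k) → Carrier) → Set (c ⊔ ℓ)
  Repeated zero    F = Unit.⊤
  Repeated (suc k) F = ∀ r A → F (r ∷ r ∷ A) ≈ 0#

  -- Alternating multilinear forms in k rows, one row at a time; only equal
  -- adjacent rows are required to give 0.
  data Alternating {n} : ∀ k → (Vec (Row n) k → Carrier) → Set (c ⊔ ℓ) where
    nullary : ∀ {F} → Alternating zero F
    step    : ∀ {k F} →
              (∀ {r r′} A → r ≋ r′ → F (r ∷ A) ≈ F (r′ ∷ A)) →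
              (∀ a r r′ A → F ((λ j → a * r j + r′ j) ∷ A) ≈ a * F (r ∷ A) + F (r′ ∷ A)) →
              (∀ r → Alternating k (λ A → F (r ∷ A))) →
              Repeated k F →
              Alternating (suc k) F

  form-cong : ∀ {n k F} → Alternating {n} k F →
              ∀ {A B} → Pointwise _≋_ A B → F A ≈ F B
  form-cong nullary           []       = ≈-refl
  form-cong (step cg _ rest _) (p ∷ ps) = ≈-trans (cg _ p) (form-cong (rest _) ps)

  alternating-resp : ∀ {n k F G} → (∀ A → F A ≈ G A) → Alternating {n} k F → Alternating k G
  alternating-resp F≈G nullary = nullary
  alternating-resp {k = suc k} F≈G (step cg lin rest rep) = step
    (λ A p → ≈-trans (≈-sym (F≈G _)) (≈-trans (cg A p) (F≈G _)))
    (λ a r r′ A → ≈-trans (≈-sym (F≈G _)) (≈-trans (lin a r r′ A)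
      (+-cong (*-congˡ (F≈G _)) (F≈G _))))
    (λ r → alternating-resp (λ A → F≈G (r ∷ A)) (rest r))
    (repeated k F≈G rep)
    where
    repeated : ∀ k {F G} → (∀ A → F A ≈ G A) → Repeated k F → Repeated k G
    repeated zero    _   _   = Unit.tt
    repeated (suc k) F≈G rep = λ r A → ≈-trans (≈-sym (F≈G _)) (rep r A)

  record IsLinear {m n} (h : Row m → Row n) : Set (c ⊔ ℓ) where
    field
      h-cong : ∀ {r r′} → r ≋ r′ → h r ≋ h r′
      h-lin  : ∀ a r r′ → h (λ j → a * r j + r′ j) ≋ λ j → a * h r j + h r′ j

  alternating-map : ∀ {m n k F} {h : Row m → Row n} → IsLinear h →
                    Alternating k F → Alternating k (λ A → F (Vec.map h A))
  alternating-map hl nullary = nullary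
  alternating-map {k = suc k} {h = h} hl (step cg lin rest rep) = step
    (λ A p → cg _ (h-cong p))
    (λ a r r′ A → ≈-trans (cg _ (h-lin a r r′)) (lin a _ _ _))
    (λ r → alternating-map hl (rest (h r)))
    (repeated k rep)
    where
    open IsLinear hl
    repeated : ∀ k {F} → Repeated k F → Repeated k (λ A → F (Vec.map h A))
    repeated zero    _   = Unit.tt
    repeated (suc k) rep = λ r A → rep (h r) (Vec.map h A)

  alternating-++ : ∀ {n k l F} (B : Vec (Row n) l) → Alternating (k ℕ.+ l) F →
                   Alternating k (λ A → F (A Vec.++ B))
  alternating-++ {k = zero}  B alt = nullary
  alternating-++ {k = suc k} B (step cg lin rest rep) = step
    (λ A → cg (A Vec.++ B))
    (λ a r r′ A → lin a r r′ (A Vec.++ B))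
    (λ r → alternating-++ B (rest r))
    (repeated k rep)
    where
    repeated : ∀ k {F} → Repeated (k ℕ.+ _) F → Repeated k (λ A → F (A Vec.++ B))
    repeated zero    _   = Unit.tt
    repeated (suc k) rep = λ r A → rep r (A Vec.++ B)

  sum-zero : ∀ {m} {f : Fin m → Carrier} → (∀ j → f j ≈ 0#) → sum f ≈ 0#
  sum-zero {m} f≈0 = ≈-trans (sum-cong-≋ f≈0) (sum-replicate-zero m)

  sum-linear : ∀ {m} a (f g : Fin m → Carrier) →
               sum (λ j → a * f j + g j) ≈ a * sum f + sum g
  sum-linear a f g = ≈-trans (∑-distrib-+ _ g) (+-congʳ (≈-sym (*-distribˡ-sum a f)))

  -- Serves the Laplace expansion, where `a j` collects the sign and the entry of the expanded row
  -- and `F j` is the minor.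
  alternating-sum : ∀ {m n k} (a : Fin m → Carrier) {F : Fin m → Vec (Row n) k → Carrier} →
                    (∀ j → Alternating k (F j)) →
                    Alternating k (λ A → sum λ j → a j * F j A)
  alternating-sum {k = zero}  a alt = nullary
  alternating-sum {m} {n} {suc k} a {F} alt = step
    (λ A p → sum-cong-≋ {m} λ j → *-congˡ (cg (alt j) A p))
    (λ b r r′ A → ≈-trans
      (sum-cong-≋ {m} λ j → ≈-trans (*-congˡ (ln (alt j) b r r′ A))
        (solve 4 (λ x y z w → x :* (y :* z :+ w) := y :* (x :* z) :+ x :* w) ≈-refl (a j) b _ _))
      (sum-linear {m} b _ _))
    (λ r → alternating-sum a λ j → rt (alt j) r)
    (repeated k alt)
    where
    cg : ∀ {F} → Alternating (suc k) F →
         ∀ {r r′} A → r ≋ r′ → F (r ∷ A) ≈ F (r′ ∷ A)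
    cg (step cg _ _ _) = cg
    ln : ∀ {F} → Alternating (suc k) F →
         ∀ a r r′ A → F ((λ j → a * r j + r′ j) ∷ A) ≈ a * F (r ∷ A) + F (r′ ∷ A)
    ln (step _ lin _ _) = lin
    rt : ∀ {F} → Alternating (suc k) F → ∀ r → Alternating k (λ A → F (r ∷ A))
    rt (step _ _ rest _) = rest
    rp : ∀ {k F} → Alternating {n} (suc k) F → Repeated k F
    rp (step _ _ _ rep) = rep
    repeated : ∀ k {F : Fin m → Vec (Row n) (suc k) → Carrier} →
               (∀ j → Alternating (suc k) (F j)) →
               Repeated k (λ A → sum λ j → a j * F j A)
    repeated zero    _   = Unit.tt
    repeated (suc k) alt = λ r A →
      sum-zero λ j → ≈-trans (*-congˡ (rp (alt j) r A)) (zeroʳ (a j))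

  -- Polarisation: the form vanishes when the row `r + r′` is repeated, and expanding this leaves
  -- the two mixed terms.
  swap-rows : ∀ {n k F} → Alternating {n} (suc (suc k)) F →
              ∀ r r′ A → F (r ∷ r′ ∷ A) ≈ - F (r′ ∷ r ∷ A)
  swap-rows {F = F} (step cg lin rest rep) r r′ A = inverseˡ-unique _ _ (≈-sym (begin
    0#                            ≈⟨ rep s A ⟨
    F (s ∷ s ∷ A)                 ≈⟨ lin 1# r r′ (s ∷ A) ⟩
    1# * F (r ∷ s ∷ A) + F (r′ ∷ s ∷ A)
      ≈⟨ +-cong (≈-trans (*-identityˡ _) (split r)) (split r′) ⟩
    (F (r ∷ r ∷ A) + F (r ∷ r′ ∷ A)) + (F (r′ ∷ r ∷ A) + F (r′ ∷ r′ ∷ A))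
      ≈⟨ +-cong (≈-trans (+-congʳ (rep r A)) (+-identityˡ _))
                (≈-trans (+-congˡ (rep r′ A)) (+-identityʳ _)) ⟩
    F (r ∷ r′ ∷ A) + F (r′ ∷ r ∷ A) ∎))
    where
    s : Row _
    s j = 1# * r j + r′ j
    split : ∀ q → F (q ∷ s ∷ A) ≈ F (q ∷ r ∷ A) + F (q ∷ r′ ∷ A)
    split q with rest q
    ... | step _ lin′ _ _ = ≈-trans (lin′ 1# r r′ A) (+-congʳ (*-identityˡ _))

  addMultiples : ∀ {n k} → Row n → Vec Carrier k → Vec (Row n) k → Vec (Row n) k
  addMultiples r = Vec.zipWith λ a r′ j → a * r j + r′ j

  -- Linearity frees `q` from its multiple of `r`. Then `r` is swapped behind `q`, the remaining
  -- rows are sheared with `q` held fixed, and `r` is swapped back; the two signs cancel.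
  shear : ∀ {n k F} → Alternating {n} (suc k) F →
          ∀ r as A → F (r ∷ addMultiples r as A) ≈ F (r ∷ A)
  shear alt r [] [] = ≈-refl
  shear {F = F} alt@(step _ _ rest rep) r (a ∷ as) (q ∷ A) = begin
    F (r ∷ s ∷ A′)                      ≈⟨ lin′ a r q A′ ⟩
    a * F (r ∷ r ∷ A′) + F (r ∷ q ∷ A′) ≈⟨ +-congʳ (≈-trans (*-congˡ (rep r A′)) (zeroʳ a)) ⟩
    0# + F (r ∷ q ∷ A′)                 ≈⟨ +-identityˡ _ ⟩
    F (r ∷ q ∷ A′)                      ≈⟨ swap-rows alt r q A′ ⟩
    - F (q ∷ r ∷ A′)                    ≈⟨ -‿cong (shear (rest q) r as A) ⟩
    - F (q ∷ r ∷ A)                     ≈⟨ swap-rows alt r q A ⟨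
    F (r ∷ q ∷ A)                       ∎
    where
    A′ = addMultiples r as A
    s : Row _
    s j = a * r j + q j
    lin′ : ∀ a p p′ A → F (r ∷ (λ j → a * p j + p′ j) ∷ A) ≈ a * F (r ∷ p ∷ A) + F (r ∷ p′ ∷ A)
    lin′ with rest r
    ... | step _ lin _ _ = lin

  sign : ℕ → Carrier
  sign k = (- 1#) ^ k

  -- Row `j` passes `toℕ j` rows on its way to the front, each at the cost of one sign.
  cycle-rows : ∀ {n k F} → Alternating {n} (suc k) F → ∀ (w : Fin (suc k) → Row n) j →
               F (w j ∷ tabulate (w ∘ punchIn j)) ≈ sign (toℕ j) * F (tabulate w)
  cycle-rows alt w zero = ≈-sym (*-identityˡ _)
  cycle-rows {k = suc k} {F} alt@(step _ _ rest _) w (suc j) = begin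
    F (w (suc j) ∷ w zero ∷ B)   ≈⟨ swap-rows alt _ _ B ⟩
    - F (w zero ∷ w (suc j) ∷ B) ≈⟨ -‿cong (cycle-rows (rest (w zero)) (w ∘ suc) j) ⟩
    - (sign (toℕ j) * F (tabulate w))      ≈⟨ -‿distribˡ-* _ _ ⟩
    - sign (toℕ j) * F (tabulate w)        ≈⟨ *-congʳ (-1*x≈-x _) ⟨
    (- 1# * sign (toℕ j)) * F (tabulate w) ∎
    where
    B = tabulate (w ∘ suc ∘ punchIn j)

  form-sum : ∀ {m n k F} → Alternating {n} (suc k) F → ∀ (a : Fin m → Carrier) (w : Fin m → Row n) A →
             F ((λ i → sum λ j → a j * w j i) ∷ A) ≈ sum λ j → a j * F (w j ∷ A)
  form-sum {zero} {F = F} alt@(step cg lin _ _) a w A =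
    -- Linearity is only available for `a * r + r′`, so the zero row is rewritten in this shape; its
    -- value then equals its own double.
    x+x≈x⇒x≈0 _ (≈-sym (begin
      F ((λ _ → 0#) ∷ A)                        ≈⟨ cg A (λ _ → ≈-sym (≈-trans (+-identityʳ _) (*-identityˡ 0#))) ⟩
      F ((λ _ → 1# * 0# + 0#) ∷ A)              ≈⟨ lin 1# (λ _ → 0#) (λ _ → 0#) A ⟩
      1# * F ((λ _ → 0#) ∷ A) + F ((λ _ → 0#) ∷ A) ≈⟨ +-congʳ (*-identityˡ _) ⟩
      F ((λ _ → 0#) ∷ A) + F ((λ _ → 0#) ∷ A) ∎))
  form-sum {suc m} {F = F} alt@(step cg lin _ _) a w A =
    ≈-trans (lin _ _ _ A) (+-congˡ (form-sum alt (a ∘ suc) (w ∘ suc) A))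

  -- Laplace expansion as an alternating form

  minor : ∀ {n k} → Fin (suc n) → Vec (Row (suc n)) k → Vec (Row n) k
  minor j = Vec.map (_∘ punchIn j)

  detᵛ : ∀ {k} → Vec (Row k) k → Carrier
  detᵛ []      = 1#
  detᵛ (r ∷ A) = sum λ j → sign (toℕ j) * (r j * detᵛ (minor j A))

  det-cong : ∀ {k} {M N : Fin k → Fin k → Carrier} → (∀ i j → M i j ≈ N i j) → det R M ≈ det R N
  det-cong {zero}  M≈N = ≈-refl
  det-cong {suc k} M≈N = sum-cong-≋ {suc k} λ j →
    *-congˡ {sign (toℕ j)} (*-cong (M≈N zero j) (det-cong λ i i′ → M≈N (suc i) (punchIn j i′)))

  det-rows : ∀ {k} (M : Fin k → Fin k → Carrier) → det R M ≈ detᵛ (tabulate M)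
  det-rows {zero}  M = ≈-refl
  det-rows {suc k} M = sum-cong-≋ {suc k} λ j → *-congˡ {sign (toℕ j)} (*-congˡ {M zero j} (begin
    det R (λ i i′ → M (suc i) (punchIn j i′))         ≈⟨ det-rows {k} _ ⟩
    detᵛ (tabulate (λ i i′ → M (suc i) (punchIn j i′))) ≡⟨ ≡.cong detᵛ (Vec.tabulate-∘ (_∘ punchIn j) (M ∘ suc)) ⟩
    detᵛ (Vec.map (_∘ punchIn j) (tabulate (M ∘ suc))) ∎))

  -- This is the double expansion along two equal rows `a`. The terms using column `zero` in the
  -- first row cancel those using it in the second, both being `a zero * Σ₁` up to sign. In the
  -- other terms column `zero` survives in the complementary minor, so `D` has to be an arbitrary
  -- function of the chosen columns: the recursion absorbs the surviving column into `D` by `lift`.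
  -- `D-cong` replaces function extensionality, as the two descriptions of the chosen columns agree
  -- only pointwise.
  minorExpansion-vanishes : ∀ m (a : Row (suc (suc m))) (D : (Fin m → Fin (suc (suc m))) → Carrier) →
    (∀ {c c′} → (∀ i → c i ≡ c′ i) → D c ≈ D c′) →
    sum (λ j → sign (toℕ j) * (a j * sum λ k →
      sign (toℕ k) * (a (punchIn j k) * D (punchIn j ∘ punchIn k)))) ≈ 0#
  minorExpansion-vanishes m a D D-cong = begin
    1# * (a zero * Σ₁) + sum (λ j → (- 1# * sign (toℕ j)) * (a (suc j) *
      (1# * (a zero * D (suc ∘ punchIn j)) + sum λ k → (- 1# * sign (toℕ k)) * X j k)))
      ≈⟨ +-cong (*-identityˡ _) (sum-cong-≋ {suc m} term) ⟩
    a zero * Σ₁ + sum (λ j → (- 1# * a zero) * Y j + sign (toℕ j) * (a (suc j) * Z j))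
      ≈⟨ +-congˡ (sum-linear {suc m} _ Y (λ j → sign (toℕ j) * (a (suc j) * Z j))) ⟩
    a zero * Σ₁ + ((- 1# * a zero) * Σ₁ + sum λ j → sign (toℕ j) * (a (suc j) * Z j))
      ≈⟨ +-congˡ (+-cong (≈-trans (*-assoc _ _ _) (-1*x≈-x _)) (rest m a D D-cong)) ⟩
    a zero * Σ₁ + (- (a zero * Σ₁) + 0#) ≈⟨ +-congˡ (+-identityʳ _) ⟩
    a zero * Σ₁ - a zero * Σ₁            ≈⟨ -‿inverseʳ _ ⟩
    0# ∎
    where
    Y : Row (suc m)
    Y j = sign (toℕ j) * (a (suc j) * D (suc ∘ punchIn j))
    Σ₁ = sum Y
    X : Fin (suc m) → Row m
    X j k = a (suc (punchIn j k)) * D (punchIn (suc j) ∘ punchIn (suc k))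
    Z : Row (suc m)
    Z j = sum λ k → sign (toℕ k) * X j k
    term : ∀ j → (- 1# * sign (toℕ j)) * (a (suc j) *
        (1# * (a zero * D (suc ∘ punchIn j)) + sum λ k → (- 1# * sign (toℕ k)) * X j k))
      ≈ (- 1# * a zero) * Y j + sign (toℕ j) * (a (suc j) * Z j)
    term j = begin
      (- 1# * s) * (b * (1# * (a zero * d) + sum λ k → (- 1# * sign (toℕ k)) * X j k))
        ≈⟨ *-congˡ (*-congˡ (+-cong (*-identityˡ _)
             (≈-trans (sum-cong-≋ {m} λ k → *-assoc (- 1#) _ _)
                    (≈-sym (*-distribˡ-sum (- 1#) λ k → sign (toℕ k) * X j k))))) ⟩
      (- 1# * s) * (b * (a zero * d + - 1# * Z j))
        ≈⟨ solve 6 (λ n s b a₀ d z → (n :* s) :* (b :* (a₀ :* d :+ n :* z))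
             := (n :* a₀) :* (s :* (b :* d)) :+ (n :* n) :* (s :* (b :* z)))
             ≈-refl (- 1#) s b (a zero) d (Z j) ⟩
      (- 1# * a zero) * Y j + (- 1# * - 1#) * (s * (b * Z j))
        ≈⟨ +-congˡ (≈-trans (*-congʳ (≈-trans (-1*x≈-x _) (-‿involutive 1#))) (*-identityˡ _)) ⟩
      (- 1# * a zero) * Y j + s * (b * Z j) ∎
      where
      s = sign (toℕ j)
      b = a (suc j)
      d = D (suc ∘ punchIn j)
    rest : ∀ m (a : Row (suc (suc m))) (D : (Fin m → Fin (suc (suc m))) → Carrier) → (∀ {c c′} → (∀ i → c i ≡ c′ i) → D c ≈ D c′) →
      sum (λ j → sign (toℕ j) * (a (suc j) * sum λ k → sign (toℕ k) *
        (a (suc (punchIn j k)) * D (punchIn (suc j) ∘ punchIn (suc k))))) ≈ 0#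
    rest zero    a D D-cong = sum-zero {1} λ j → ≈-trans (*-congˡ {sign (toℕ j)} (zeroʳ (a (suc j)))) (zeroʳ _)
    rest (suc m) a D D-cong = ≈-trans
      (sum-cong-≋ {suc (suc m)} λ j → *-congˡ {sign (toℕ j)} (*-congˡ {a (suc j)}
        (sum-cong-≋ {suc m} λ k → *-congˡ {sign (toℕ k)} (*-congˡ {a (suc (punchIn j k))} (D-cong (lift-punchIn j k))))))
      (minorExpansion-vanishes m (a ∘ suc) (λ c → D (lift c)) λ eq → D-cong (lift-cong eq))
      where
      lift : (Fin m → Fin (suc (suc m))) → Fin (suc m) → Fin (suc (suc (suc m)))
      lift c zero    = zero
      lift c (suc i) = suc (c i)
      lift-cong : ∀ {c c′} → (∀ i → c i ≡ c′ i) → ∀ i → lift c i ≡ lift c′ i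
      lift-cong eq zero    = ≡.refl
      lift-cong eq (suc i) = ≡.cong suc (eq i)
      lift-punchIn : ∀ j k i → punchIn (suc j) (punchIn (suc k) i) ≡ lift (punchIn j ∘ punchIn k) i
      lift-punchIn j k zero    = ≡.refl
      lift-punchIn j k (suc i) = ≡.refl

  ∘-linear : ∀ {m n} (c : Fin m → Fin n) → IsLinear (_∘ c)
  ∘-linear c = record { h-cong = λ p j → p (c j) ; h-lin = λ a r r′ j → ≈-refl }

  Pointwise-refl : ∀ {n k} {A : Vec (Row n) k} → Pointwise _≋_ A A
  Pointwise-refl {A = []}    = []
  Pointwise-refl {A = r ∷ A} = (λ j → ≈-refl) ∷ Pointwise-refl

  det-alternating : ∀ k → Alternating k (detᵛ {k})
  det-alternating zero    = nullary
  det-alternating (suc k) = step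
    (λ A p → sum-cong-≋ {suc k} λ j → *-congˡ {sign (toℕ j)} (*-congʳ {detᵛ (minor j A)} (p j)))
    (λ a r r′ A → ≈-trans
      (sum-cong-≋ {suc k} λ j →
        distribute (sign (toℕ j)) a (r j) (r′ j) (detᵛ (minor j A)))
      (sum-linear {suc k} a (λ j → sign (toℕ j) * (r j * detᵛ (minor j A)))
                            (λ j → sign (toℕ j) * (r′ j * detᵛ (minor j A)))))
    (λ r → alternating-resp (λ A → sum-cong-≋ {suc k} λ j →
        *-assoc (sign (toℕ j)) (r j) (detᵛ (minor j A)))
      (alternating-sum (λ j → sign (toℕ j) * r j) λ j →
        alternating-map (∘-linear (punchIn j)) (det-alternating k)))
    (repeated k)
    where
    distribute : ∀ s a r r′ d → s * ((a * r + r′) * d) ≈ a * (s * (r * d)) + s * (r′ * d)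
    distribute = solve 5 (λ s a r r′ d →
      s :* ((a :* r :+ r′) :* d) := a :* (s :* (r :* d)) :+ s :* (r′ :* d)) ≈-refl
    repeated : ∀ k → Repeated k (detᵛ {suc k})
    repeated zero    = Unit.tt
    repeated (suc k) r A = ≈-trans
      (sum-cong-≋ {suc (suc k)} λ j → *-congˡ {sign (toℕ j)} (*-congˡ {r j}
        (sum-cong-≋ {suc k} λ i → *-congˡ {sign (toℕ i)} (*-congˡ {r (punchIn j i)}
          -- A minor of a minor is one selection of columns, `punchIn j ∘ punchIn i`.
          (reflexive (≡.cong detᵛ (≡.sym (Vec.map-∘ (_∘ punchIn i) (_∘ punchIn j) A))))))))
      (minorExpansion-vanishes k r (λ c → detᵛ (Vec.map (_∘ c) A))
        λ eq → form-cong (det-alternating k) (map-cong eq A))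
      where
      map-cong : ∀ {l m n} {c c′ : Fin m → Fin n} → (∀ i → c i ≡ c′ i) →
                 ∀ (A : Vec (Row n) l) → Pointwise _≋_ (Vec.map (_∘ c) A) (Vec.map (_∘ c′) A)
      map-cong eq []      = []
      map-cong eq (r ∷ A) = (λ j → reflexive (≡.cong r (eq j))) ∷ map-cong eq A

  δ : ∀ {k} → Fin k → Row k
  δ i j = if does (i ≟ j) then 1# else 0#

  sum-δ : ∀ {k} (i : Fin k) (f : Row k) → sum (λ j → δ i j * f j) ≈ f i
  sum-δ {suc k} zero    f = ≈-trans (+-cong (*-identityˡ _) (sum-zero {k} λ j → zeroˡ _)) (+-identityʳ _)
  sum-δ {suc k} (suc i) f = ≈-trans (+-cong (zeroˡ _) (sum-δ i (f ∘ suc))) (+-identityˡ _)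

  det-δ : ∀ k → detᵛ (tabulate (δ {k})) ≈ 1#
  det-δ zero    = ≈-refl
  det-δ (suc k) = begin
    1# * (1# * X zero) + sum (λ j → sign (suc (toℕ j)) * (0# * X (suc j)))
      ≈⟨ +-cong (≈-trans (*-identityˡ _) (*-identityˡ _))
           (sum-zero {k} λ j → ≈-trans (*-congˡ {sign (suc (toℕ j))} (zeroˡ _)) (zeroʳ _)) ⟩
    X zero + 0# ≈⟨ +-identityʳ _ ⟩
    X zero      ≡⟨ ≡.cong (detᵛ {k}) (Vec.tabulate-∘ (_∘ suc) (δ ∘ suc)) ⟨
    detᵛ (tabulate (δ {k})) ≈⟨ det-δ k ⟩
    1# ∎
    where
    X : Row (suc k)
    X j = detᵛ (minor j (tabulate (δ ∘ suc)))

  tabulate-pw : ∀ {n k} {f g : Fin k → Row n} → (∀ i → f i ≋ g i) → Pointwise _≋_ (tabulate f) (tabulate g)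
  tabulate-pw {k = zero}  eq = []
  tabulate-pw {k = suc k} eq = eq zero ∷ tabulate-pw (eq ∘ suc)

  -- A section of taking the minor at column `j`. Being linear, it turns a form on rows of length
  -- `suc k` into one on rows of length `k`, which drives the induction for uniqueness.
  insert0 : ∀ {k} → Fin (suc k) → Row k → Row (suc k)
  insert0 j r = Functional.insertAt r j 0#

  insert0-≋ : ∀ {k} j {r : Row k} {q} → q j ≈ 0# → (∀ i → q (punchIn j i) ≈ r i) → q ≋ insert0 j r
  insert0-≋ j {r} {q} qj q≈ i with j ≟ i
  ... | yes ≡.refl = ≈-trans qj (reflexive (≡.sym (Functional.insertAt-lookup r j 0#)))
  ... | no j≢i = ≡.subst (λ i → q i ≈ insert0 j r i) (punchIn-punchOut j≢i)
                   (≈-trans (q≈ _) (reflexive (≡.sym (Functional.insertAt-punchIn r j 0# _))))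

  insert0-linear : ∀ {k} (j : Fin (suc k)) → IsLinear (insert0 j)
  insert0-linear j = record
    { h-cong = λ {r} {r′} p → insert0-≋ j
        (reflexive (Functional.insertAt-lookup r j 0#))
        (λ i → ≈-trans (reflexive (Functional.insertAt-punchIn r j 0# i)) (p i))
    ; h-lin  = λ a r r′ i → ≈-sym (insert0-≋ j {q = λ i → a * insert0 j r i + insert0 j r′ i}
        (≈-trans (+-cong (≈-trans (*-congˡ (reflexive (Functional.insertAt-lookup r j 0#))) (zeroʳ a))
                       (reflexive (Functional.insertAt-lookup r′ j 0#))) (+-identityˡ _))
        (λ i → +-cong (*-congˡ (reflexive (Functional.insertAt-punchIn r j 0# i)))
                      (reflexive (Functional.insertAt-punchIn r′ j 0# i))) i)
    }

  δ-diagonal : ∀ {k} (j : Fin k) → δ j j ≈ 1#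
  δ-diagonal zero    = ≈-refl
  δ-diagonal (suc j) = δ-diagonal j

  δ-punchIn : ∀ {k} (j : Fin (suc k)) i → δ j (punchIn j i) ≈ 0#
  δ-punchIn zero    i       = ≈-refl
  δ-punchIn (suc j) zero    = ≈-refl
  δ-punchIn (suc j) (suc i) = δ-punchIn j i

  δ-punchInˡ : ∀ {k} (j : Fin (suc k)) i → δ (punchIn j i) j ≈ 0#
  δ-punchInˡ zero    i       = ≈-refl
  δ-punchInˡ (suc j) zero    = ≈-refl
  δ-punchInˡ (suc j) (suc i) = δ-punchInˡ j i

  δ-punchIn₂ : ∀ {k} (j : Fin (suc k)) i i′ → δ (punchIn j i) (punchIn j i′) ≈ δ i i′
  δ-punchIn₂ zero    i       i′       = ≈-refl
  δ-punchIn₂ (suc j) zero    zero     = ≈-refl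
  δ-punchIn₂ (suc j) zero    (suc i′) = ≈-refl
  δ-punchIn₂ (suc j) (suc i) zero     = ≈-refl
  δ-punchIn₂ (suc j) (suc i) (suc i′) = δ-punchIn₂ j i i′

  -- Clear column j below the unit row δ j and recurse on the minor.
  alternating-unique : ∀ k {F} → Alternating {k} k F →
                       ∀ A → F A ≈ detᵛ A * F (tabulate δ)
  alternating-unique zero    alt []      = ≈-sym (*-identityˡ _)
  alternating-unique (suc k) {F} alt@(step cg _ rest _) (r ∷ A) = begin
    F (r ∷ A)
      ≈⟨ cg A (λ i → ≈-trans (sum-cong-≋ {suc k} λ j → *-comm (r j) (δ j i))
           (≈-trans (sum-cong-≋ {suc k} λ j → *-congʳ {r j} (δ-sym j i)) (sum-δ i r))) ⟨
    F ((λ i → sum λ j → r j * δ j i) ∷ A) ≈⟨ form-sum alt r δ A ⟩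
    sum (λ j → r j * F (δ j ∷ A)) ≈⟨ sum-cong-≋ {suc k} term ⟩
    sum (λ j → (sign (toℕ j) * (r j * d j)) * F (tabulate δ)) ≈⟨ *-distribʳ-sum _ (λ j → sign (toℕ j) * (r j * d j)) ⟨
    detᵛ (r ∷ A) * F (tabulate δ) ∎
    where
    δ-sym : ∀ {k} (i j : Fin k) → δ i j ≈ δ j i
    δ-sym zero    zero    = ≈-refl
    δ-sym zero    (suc j) = ≈-refl
    δ-sym (suc i) zero    = ≈-refl
    δ-sym (suc i) (suc j) = δ-sym i j
    d : Row (suc k)
    d j = detᵛ (minor j A)
    cleared : ∀ j {l} (A : Vec (Row (suc k)) l) →
      Pointwise _≋_ (addMultiples (δ j) (Vec.map (λ q → - q j) A) A)
                    (Vec.map (insert0 j) (minor j A))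
    cleared j []      = []
    cleared j (q ∷ A) = insert0-≋ j
      (≈-trans (+-congʳ (≈-trans (*-congˡ (δ-diagonal j)) (*-identityʳ _))) (-‿inverseˡ _))
      (λ i → ≈-trans (+-congʳ (≈-trans (*-congˡ (δ-punchIn j i)) (zeroʳ _))) (+-identityˡ _))
      ∷ cleared j A
    term : ∀ j → r j * F (δ j ∷ A) ≈ (sign (toℕ j) * (r j * d j)) * F (tabulate δ)
    term j = begin
      r j * F (δ j ∷ A)
        ≈⟨ *-congˡ (shear alt (δ j) (Vec.map (λ q → - q j) A) A) ⟨
      r j * F (δ j ∷ addMultiples (δ j) (Vec.map (λ q → - q j) A) A)
        ≈⟨ *-congˡ (form-cong alt ((λ _ → ≈-refl) ∷ cleared j A)) ⟩
      r j * F (δ j ∷ Vec.map (insert0 j) (minor j A))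
        ≈⟨ *-congˡ (alternating-unique k (alternating-map (insert0-linear j) (rest (δ j))) _) ⟩
      r j * (d j * F (δ j ∷ Vec.map (insert0 j) (tabulate δ)))
        -- The padded identity below `δ j` is the identity matrix with row `j` moved to the front;
        -- this produces the sign of the expansion.
        ≈⟨ *-congˡ (*-congˡ (begin
          F (δ j ∷ Vec.map (insert0 j) (tabulate δ))
            ≡⟨ ≡.cong (λ B → F (δ j ∷ B)) (Vec.tabulate-∘ (insert0 j) δ) ⟨
          F (δ j ∷ tabulate (insert0 j ∘ δ))
            ≈⟨ form-cong alt ((λ _ → ≈-refl) ∷ tabulate-pw λ i →
                 insert0-≋ j (δ-punchInˡ j i) (δ-punchIn₂ j i)) ⟨
          F (δ j ∷ tabulate (δ ∘ punchIn j)) ≈⟨ cycle-rows alt δ j ⟩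
          sign (toℕ j) * F (tabulate δ) ∎)) ⟩
      r j * (d j * (sign (toℕ j) * F (tabulate δ)))
        ≈⟨ solve 4 (λ r d s f → r :* (d :* (s :* f)) := (s :* (r :* d)) :* f) ≈-refl
             (r j) (d j) (sign (toℕ j)) _ ⟩
      (sign (toℕ j) * (r j * d j)) * F (tabulate δ) ∎

  -- Right multiplication by `B` is linear on rows, so the determinant of the product is an
  -- alternating form in the rows of `A`. By uniqueness it is `det R A` times its value at the
  -- identity.
  det-* : ∀ {k} (A B : Fin k → Fin k → Carrier) →
          det R (λ i j → sum λ l → A i l * B l j) ≈ det R A * det R B
  det-* {k} A B = begin
    det R (λ i j → sum λ l → A i l * B l j)  ≈⟨ det-rows {k} _ ⟩
    detᵛ (tabulate (mulB ∘ A))               ≡⟨ ≡.cong detᵛ (Vec.tabulate-∘ mulB A) ⟩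
    detᵛ (Vec.map mulB (tabulate A))
      ≈⟨ alternating-unique k (alternating-map mulB-linear (det-alternating k)) (tabulate A) ⟩
    detᵛ (tabulate A) * detᵛ (Vec.map mulB (tabulate δ))
      ≡⟨ ≡.cong (λ X → detᵛ (tabulate A) * detᵛ X) (Vec.tabulate-∘ mulB δ) ⟨
    detᵛ (tabulate A) * detᵛ (tabulate (mulB ∘ δ))
      ≈⟨ *-congˡ (form-cong (det-alternating k) (tabulate-pw λ i j → sum-δ i (λ l → B l j))) ⟩
    detᵛ (tabulate A) * detᵛ (tabulate B)    ≈⟨ *-cong (det-rows A) (det-rows B) ⟨
    det R A * det R B ∎
    where
    mulB : Row k → Row k
    mulB r j = sum λ l → r l * B l j
    mulB-linear : IsLinear mulB
    mulB-linear = record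
      { h-cong = λ p j → sum-cong-≋ {k} λ l → *-congʳ (p l)
      ; h-lin  = λ a r r′ j → ≈-trans
          (sum-cong-≋ {k} λ l → ≈-trans (distribʳ _ _ _) (+-congʳ (*-assoc _ _ _)))
          (sum-linear {k} a _ _)
      }

-- Determinants indexed by lists

module DeterminantOn {c ℓ} (R : CommutativeRing c ℓ) where

  open CommutativeRing R hiding (zero) renaming (refl to ≈-refl; sym to ≈-sym; trans to ≈-trans)
  open Determinant R
  open import Algebra.Properties.Semiring.Sum semiring
  open import Relation.Binary.Reasoning.Setoid setoid
  open ListFold *-commutativeMonoid public using ()
    renaming (⨁ to ∏; ⨁-cong to ∏-cong; ⨁-unit to ∏-1; ⨁-∙ to ∏-*;
              ⨁-remove to ∏-remove; ⨁-single to ∏-single)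
  open ListFold +-commutativeMonoid public using ()
    renaming (⨁ to ∑; ⨁-unit to ∑-0; ⨁-single to ∑-single)

  -- The reindexed matrix is P M Pᵗ, where P is the 0-1 matrix `δ ∘ σ`. Injectivity of `σ` gives P
  -- Pᵗ = 1, so the two outer determinants cancel and the sign of `σ` need not be introduced.
  det-reindex : ∀ {k l} → k ≡ l → (M : Fin l → Fin l → Carrier) (σ : Fin k → Fin l) →
                (∀ {i j} → σ i ≡ σ j → i ≡ j) →
                det R (λ i j → M (σ i) (σ j)) ≈ det R M
  det-reindex {k} ≡.refl M σ σ-inj = begin
    det R (λ i j → M (σ i) (σ j)) ≈⟨ det-cong (λ i j → ≈-trans (sum-cong-≋ {k} (λ l → *-comm (A i l) (δ (σ j) l)))
                                        (≈-trans (sum-δ (σ j) (A i)) (sum-δ (σ i) (λ l → M l (σ j))))) ⟨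
    det R (λ i j → sum λ l → A i l * B l j) ≈⟨ det-* A B ⟩
    det R A * det R B             ≈⟨ *-congʳ (det-* (δ ∘ σ) M) ⟩
    (det R (δ ∘ σ) * det R M) * det R B ≈⟨ ≈-trans (*-congʳ (*-comm _ _)) (*-assoc _ _ _) ⟩
    det R M * (det R (δ ∘ σ) * det R B) ≈⟨ *-congˡ (det-* (δ ∘ σ) B) ⟨
    det R M * det R (λ i j → sum λ l → δ (σ i) l * B l j)
      ≈⟨ *-congˡ (det-cong {k} λ i j → ≈-trans (sum-δ (σ i) (λ l → B l j)) (δ-injective i j)) ⟩
    det R M * det R (δ {k})       ≈⟨ *-congˡ (≈-trans (det-rows {k} δ) (det-δ k)) ⟩
    det R M * 1#                  ≈⟨ *-identityʳ _ ⟩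
    det R M ∎
    where
    A B : Fin k → Fin k → Carrier
    A i j = sum λ l → δ (σ i) l * M l j
    B i j = δ (σ j) i
    δ-injective : ∀ i j → δ (σ j) (σ i) ≈ δ i j
    δ-injective i j with σ j ≟ σ i | i ≟ j
    ... | yes _ | yes _ = ≈-refl
    ... | no _  | no _  = ≈-refl
    ... | yes p | no i≢j = contradiction (≡.sym (σ-inj p)) i≢j
    ... | no p  | yes i≡j = contradiction (≡.cong σ (≡.sym i≡j)) p

  -- With the bottom rows fixed, the determinant is an alternating form in the upper left block,
  -- which can therefore be traded for the identity at the cost of its determinant. Expansion along
  -- the unit rows then strips the first `k` columns, whatever stands in the lower left block.
  det-block : ∀ k {l} (M : Fin (k ℕ.+ l) → Fin (k ℕ.+ l) → Carrier) →
              (∀ i j → M (i ↑ˡ l) (k ↑ʳ j) ≈ 0#) →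
              det R M ≈ det R (λ i j → M (i ↑ˡ l) (j ↑ˡ l)) * det R (λ i j → M (k ↑ʳ i) (k ↑ʳ j))
  det-block k {l} M M≈0 = begin
    det R M                 ≈⟨ det-rows M ⟩
    detᵛ (tabulate M)       ≡⟨ ≡.cong detᵛ (tabulate-++ k M) ⟩
    detᵛ (tabulate (λ i → M (i ↑ˡ l)) Vec.++ bottom)
      ≈⟨ form-cong (alternating-++ bottom (det-alternating (k ℕ.+ l)))
           (tabulate-pw {f = λ i → M (i ↑ˡ l)} padded) ⟩
    detᵛ (tabulate (pad ∘ topLeft) Vec.++ bottom)
      ≡⟨ ≡.cong (λ A → detᵛ (A Vec.++ bottom)) (Vec.tabulate-∘ pad topLeft) ⟩
    detᵛ (Vec.map pad (tabulate topLeft) Vec.++ bottom)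
      ≈⟨ alternating-unique k
           (alternating-map pad-linear (alternating-++ bottom (det-alternating (k ℕ.+ l))))
           (tabulate topLeft) ⟩
    detᵛ (tabulate topLeft) * detᵛ (Vec.map pad (tabulate δ) Vec.++ bottom)
      ≈⟨ *-cong (≈-sym (det-rows topLeft)) (≈-trans (bottomRight k bottom)
           (≈-trans (reflexive (≡.cong detᵛ (≡.sym (Vec.tabulate-∘ (_∘ (k ↑ʳ_)) (M ∘ (k ↑ʳ_))))))
                  (≈-sym (det-rows {l} _)))) ⟩
    det R topLeft * det R (λ i j → M (k ↑ʳ i) (k ↑ʳ j)) ∎
    where
    topLeft : Fin k → Row k
    topLeft i j = M (i ↑ˡ l) (j ↑ˡ l)
    bottom : Vec (Row (k ℕ.+ l)) l
    bottom = tabulate (M ∘ (k ↑ʳ_))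
    pad : ∀ {k} → Row k → Row (k ℕ.+ l)
    pad {zero}  r j       = 0#
    pad {suc k} r zero    = r zero
    pad {suc k} r (suc j) = pad (r ∘ suc) j
    pad-≋ : ∀ {k} {r : Row k} {q : Row (k ℕ.+ l)} → (∀ j → q (j ↑ˡ l) ≈ r j) →
            (∀ j → q (k ↑ʳ j) ≈ 0#) → q ≋ pad r
    pad-≋ {zero}  p z j       = z j
    pad-≋ {suc k} p z zero    = p zero
    pad-≋ {suc k} p z (suc j) = pad-≋ (p ∘ suc) z j
    pad-linear : ∀ {k} → IsLinear (pad {k})
    pad-linear {zero} = record
      { h-cong = λ _ _ → ≈-refl
      ; h-lin  = λ a _ _ _ → ≈-sym (≈-trans (+-identityʳ _) (zeroʳ a)) }
    pad-linear {suc k} = record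
      { h-cong = λ { p zero → p zero ; p (suc j) → h-cong (p ∘ suc) j }
      ; h-lin  = λ { a r r′ zero → ≈-refl ; a r r′ (suc j) → h-lin a (r ∘ suc) (r′ ∘ suc) j } }
      where open IsLinear (pad-linear {k})
    padded : ∀ i → M (i ↑ˡ l) ≋ pad (topLeft i)
    padded i = pad-≋ (λ j → ≈-refl) (M≈0 i)
    tabulate-++ : ∀ k {n} (f : Fin (k ℕ.+ l) → Row n) →
                  tabulate f ≡ tabulate (λ i → f (i ↑ˡ l)) Vec.++ tabulate (f ∘ (k ↑ʳ_))
    tabulate-++ zero    f = ≡.refl
    tabulate-++ (suc k) f = ≡.cong (f zero ∷_) (tabulate-++ k (f ∘ suc))
    bottomRight : ∀ k (B : Vec (Row (k ℕ.+ l)) l) →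
      detᵛ (Vec.map pad (tabulate (δ {k})) Vec.++ B) ≈ detᵛ (Vec.map (_∘ (k ↑ʳ_)) B)
    bottomRight zero    B = reflexive (≡.cong detᵛ (≡.sym (Vec.map-id B)))
    bottomRight (suc k) B = begin
      1# * (1# * X zero) + sum (λ j → sign (suc (toℕ j)) * (pad {k} (λ _ → 0#) j * X (suc j)))
        ≈⟨ +-cong (≈-trans (*-identityˡ _) (*-identityˡ _))
             (sum-zero {k ℕ.+ l} λ j → ≈-trans (*-congˡ {sign (suc (toℕ j))}
               (≈-trans (*-congʳ {X (suc j)} (≈-sym (pad-≋ {k} (λ _ → ≈-refl) (λ _ → ≈-refl) j)))
                      (zeroˡ (X (suc j))))) (zeroʳ _)) ⟩
      X zero + 0# ≈⟨ +-identityʳ _ ⟩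
      X zero      ≡⟨ ≡.cong (detᵛ {k ℕ.+ l}) (begin≡ k B) ⟩
      detᵛ (Vec.map pad (tabulate (δ {k})) Vec.++ minor zero B) ≈⟨ bottomRight k (minor zero B) ⟩
      detᵛ (Vec.map (_∘ (k ↑ʳ_)) (minor zero B)) ≡⟨ ≡.cong detᵛ (Vec.map-∘ (_∘ (k ↑ʳ_)) (_∘ suc) B) ⟨
      detᵛ (Vec.map (_∘ (suc k ↑ʳ_)) B) ∎
      where
      X : Row (suc (k ℕ.+ l))
      X j = detᵛ (minor j (Vec.map pad (tabulate (δ ∘ suc)) Vec.++ B))
      begin≡ : ∀ k (B : Vec (Row (suc k ℕ.+ l)) l) →
        minor zero (Vec.map pad (tabulate (δ ∘ suc)) Vec.++ B) ≡
        Vec.map pad (tabulate (δ {k})) Vec.++ minor zero B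
      begin≡ k B = ≡.trans (Vec.map-++ (_∘ suc) (Vec.map pad (tabulate (δ ∘ suc))) B)
        (≡.cong (Vec._++ minor zero B) (≡.trans
          (≡.cong (minor zero) (≡.sym (Vec.tabulate-∘ pad (δ ∘ suc))))
          (≡.trans (≡.sym (Vec.tabulate-∘ (_∘ suc) (pad ∘ δ ∘ suc)))
                   (Vec.tabulate-∘ pad δ))))

  private
    variable
      a : Level
      I J : Set a

  -- Index lists are exchanged for vectors, whose lengths compute.
  detOn-toList : ∀ {k} (v : Vec I k) {is} M → is ≡ Vec.toList v →
                 detOn R is M ≈ det R (λ i j → M (lookup v i) (lookup v j))
  detOn-toList v M ≡.refl = recast (length-toList v) λ i j →
    reflexive (≡.cong₂ M (lookup-toList v _ i) (lookup-toList v _ j))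
    where
    length-toList : ∀ {k} (v : Vec I k) → length (Vec.toList v) ≡ k
    length-toList []      = ≡.refl
    length-toList (_ ∷ v) = ≡.cong suc (length-toList v)
    lookup-toList : ∀ {k} (v : Vec I k) .(eq : length (Vec.toList v) ≡ k) i →
                    List.lookup (Vec.toList v) i ≡ lookup v (cast eq i)
    lookup-toList (x ∷ v) eq zero    = ≡.refl
    lookup-toList (x ∷ v) eq (suc i) = lookup-toList v (ℕ.suc-injective eq) i
    recast : ∀ {k l} (eq : k ≡ l) {M N} → (∀ i j → M i j ≈ N (cast eq i) (cast eq j)) →
             det R M ≈ det R N
    recast ≡.refl {M} {N} M≈N = det-cong λ i j → ≈-trans (M≈N i j)
      (reflexive (≡.cong₂ N (cast-is-id ≡.refl i) (cast-is-id ≡.refl j)))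

  detOn-cong : ∀ (is : List I) {M N} → (∀ {i j} → i List.∈ is → j List.∈ is → M i j ≈ N i j) →
               detOn R is M ≈ detOn R is N
  detOn-cong is M≈N = det-cong λ i j → M≈N (∈-lookup i) (∈-lookup j)

  detOn-map : ∀ (h : J → I) is M → detOn R (List.map h is) M ≈ detOn R is (λ i j → M (h i) (h j))
  detOn-map h is M = begin
    detOn R (List.map h is) M
      ≈⟨ detOn-toList (Vec.map h v) M (≡.sym (≡.trans (Vec.toList-map h v)
           (≡.cong (List.map h) (Vec.toList∘fromList is)))) ⟩
    det R (λ i j → M (lookup (Vec.map h v) i) (lookup (Vec.map h v) j))
      ≈⟨ det-cong (λ i j → reflexive (≡.cong₂ M (Vec.lookup-map i h v) (Vec.lookup-map j h v))) ⟩
    det R (λ i j → M (h (lookup v i)) (h (lookup v j)))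
      ≈⟨ detOn-toList v (λ i j → M (h i) (h j)) (≡.sym (Vec.toList∘fromList is)) ⟨
    detOn R is (λ i j → M (h i) (h j)) ∎
    where v = Vec.fromList is

  detOn-++ : ∀ (is js : List I) M → (∀ {i j} → i List.∈ is → j List.∈ js → M i j ≈ 0#) →
             detOn R (is ++ js) M ≈ detOn R is M * detOn R js M
  detOn-++ is js M M≈0 = begin
    detOn R (is ++ js) M
      ≈⟨ detOn-toList (v Vec.++ w) M (≡.sym (≡.trans (Vec.toList-++ v w)
           (≡.cong₂ _++_ (Vec.toList∘fromList is) (Vec.toList∘fromList js)))) ⟩
    det R (λ i j → M (lookup (v Vec.++ w) i) (lookup (v Vec.++ w) j))
      ≈⟨ det-block (length is) _ (λ i j → ≈-trans
           (reflexive (≡.cong₂ M (Vec.lookup-++ˡ v w i) (Vec.lookup-++ʳ v w j)))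
           (M≈0 (fromList-∈ is i) (fromList-∈ js j))) ⟩
    _ ≈⟨ *-cong
      (det-cong {length is} λ i j → reflexive (≡.cong₂ M (Vec.lookup-++ˡ v w i) (Vec.lookup-++ˡ v w j)))
      (det-cong {length js} λ i j → reflexive (≡.cong₂ M (Vec.lookup-++ʳ v w i) (Vec.lookup-++ʳ v w j))) ⟩
    _ ≈⟨ *-cong (detOn-toList v M (≡.sym (Vec.toList∘fromList is)))
                (detOn-toList w M (≡.sym (Vec.toList∘fromList js))) ⟨
    detOn R is M * detOn R js M ∎
    where
    v = Vec.fromList is
    w = Vec.fromList js
    fromList-∈ : ∀ (is : List I) i → lookup (Vec.fromList is) i List.∈ is
    fromList-∈ (i ∷ is) zero    = here ≡.refl
    fromList-∈ (i ∷ is) (suc j) = there (fromList-∈ is j)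

  detOn-↭ : ∀ {is js : List I} M → is ↭ js → detOn R is M ≈ detOn R js M
  detOn-↭ {I = I} {is = is} {js} M is↭js = begin
    detOn R is M
      ≈⟨ det-cong (λ i j → reflexive (≡.cong₂ M
           (↭ₛ.onIndices-lookup (≡.setoid I) p i) (↭ₛ.onIndices-lookup (≡.setoid I) p j))) ⟩
    det R (λ i j → M (List.lookup js (σ i)) (List.lookup js (σ j)))
      ≈⟨ det-reindex (↭-length is↭js) _ σ σ-injective ⟩
    detOn R js M ∎
    where
    p = ↭⇒↭ₛ is↭js
    σ = Inverse.to (onIndices p)
    σ-injective : ∀ {i j} → σ i ≡ σ j → i ≡ j
    σ-injective {i} {j} eq = ≡.trans (≡.sym (Inverse.strictlyInverseʳ (onIndices p) i))
      (≡.trans (≡.cong (Inverse.from (onIndices p)) eq) (Inverse.strictlyInverseʳ (onIndices p) j))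

  sum-lookup : ∀ (is : List I) (f : I → Carrier) → sum (λ i → f (List.lookup is i)) ≡ ∑ is f
  sum-lookup []       f = ≡.refl
  sum-lookup (i ∷ is) f = ≡.cong (f i +_) (sum-lookup is f)

  -- Multiplicativity applied to both sides of MP = PN. In this form of similarity no inverse of `P`
  -- has to be exhibited.
  detOn-similar : ∀ (is : List I) (M P N : I → I → Carrier) →
    (∀ {i j} → i List.∈ is → j List.∈ is → ∑ is (λ l → M i l * P l j) ≈ ∑ is (λ l → P i l * N l j)) →
    detOn R is P ≈ 1# → detOn R is M ≈ detOn R is N
  detOn-similar is M P N MP≈PN detP = begin
    detOn R is M                ≈⟨ *-identityʳ _ ⟨
    detOn R is M * 1#           ≈⟨ *-congˡ detP ⟨
    detOn R is M * detOn R is P ≈⟨ det-* (λ i j → M (at i) (at j)) (λ i j → P (at i) (at j)) ⟨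
    det R (λ i j → sum λ l → M (at i) (at l) * P (at l) (at j))
      ≈⟨ det-cong (λ i j → ≈-trans (reflexive (sum-lookup is λ l → M (at i) l * P l (at j)))
           (≈-trans (MP≈PN (∈-lookup i) (∈-lookup j))
             (reflexive (≡.sym (sum-lookup is λ l → P (at i) l * N l (at j)))))) ⟩
    det R (λ i j → sum λ l → P (at i) (at l) * N (at l) (at j))
      ≈⟨ det-* (λ i j → P (at i) (at j)) (λ i j → N (at i) (at j)) ⟩
    detOn R is P * detOn R is N ≈⟨ *-congʳ detP ⟩
    1# * detOn R is N           ≈⟨ *-identityˡ _ ⟩
    detOn R is N ∎
    where at = List.lookup is

  lookup-injective : ∀ {is : List I} → Unique is → ∀ i j → List.lookup is i ≡ List.lookup is j → i ≡ j
  lookup-injective (i∉ ∷ uniq) zero    zero    eq = ≡.refl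
  lookup-injective (i∉ ∷ uniq) zero    (suc j) eq = contradiction eq (All.lookup i∉ (∈-lookup j))
  lookup-injective (i∉ ∷ uniq) (suc i) zero    eq = contradiction (≡.sym eq) (All.lookup i∉ (∈-lookup i))
  lookup-injective (i∉ ∷ uniq) (suc i) (suc j) eq = ≡.cong suc (lookup-injective uniq i j eq)

  detOn-identity : ∀ {is : List I} {M} → Unique is → (∀ {i} → i List.∈ is → M i i ≈ 1#) →
                   (∀ {i j} → i List.∈ is → j List.∈ is → i ≢ j → M i j ≈ 0#) → detOn R is M ≈ 1#
  detOn-identity {is = is} {M} uniq diag off = begin
    detOn R is M              ≈⟨ det-cong entry ⟩
    det R (δ {length is})     ≈⟨ det-rows {length is} δ ⟩
    detᵛ (tabulate (δ {length is})) ≈⟨ det-δ (length is) ⟩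
    1# ∎
    where
    entry : ∀ i j → M (List.lookup is i) (List.lookup is j) ≈ δ i j
    entry i j with i ≟ j
    ... | yes ≡.refl = diag (∈-lookup i)
    ... | no i≢j     = off (∈-lookup i) (∈-lookup j) (i≢j ∘ lookup-injective uniq i j)

  module _ {x} {X : Set x} (_≟ˣ_ : DecidableEquality X) (κ : I → X)
           {z} {Z : X → X → Set z} (Z-irrefl : ∀ k → ¬ Z k k) (M : I → I → Carrier) where

    -- Z k k′ is read as "the block k × k′ vanishes" or as "the block k′ × k
    -- vanishes", uniformly.
    detOn-blocks : ∀ ks → AllPairs Z ks → ∀ is → (∀ {i} → i List.∈ is → κ i List.∈ ks) →
      (∀ {i j} → i List.∈ is → j List.∈ is → Z (κ i) (κ j) → M i j ≈ 0#) ⊎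
      (∀ {i j} → i List.∈ is → j List.∈ is → Z (κ j) (κ i) → M i j ≈ 0#) →
      detOn R is M ≈ ∏ ks (λ k → detOn R (filter (λ i → κ i ≟ˣ k) is) M)
    detOn-blocks [] [] [] κ∈ van = ≈-refl
    detOn-blocks [] [] (i ∷ is) κ∈ van with () ← κ∈ (here ≡.refl)
    detOn-blocks (k ∷ ks) (zs ∷ zss) is κ∈ van = begin
      detOn R is M                ≈⟨ split van ⟩
      detOn R (filter P? is) M * detOn R rest M
        ≈⟨ *-congˡ (detOn-blocks ks zss rest κ∈′ (van′ van)) ⟩
      detOn R (filter P? is) M * ∏ ks (λ k′ → detOn R (filter (λ i → κ i ≟ˣ k′) rest) M)
        -- `Z k k′` holds for every later `k′`, so irreflexivity separates `k′` from `k`, and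
        -- removing block `k` leaves block `k′` intact.
        ≈⟨ *-congˡ (∏-cong ks λ {k′} k′∈ → reflexive (≡.cong (λ l → detOn R l M)
             (filter-∩ (λ i → κ i ≟ˣ k′) (¬? ∘ P?) (λ i → κ i ≟ˣ k′) (λ p _ → p) id
               (λ { ≡.refl κi≡k → Z-irrefl k (≡.subst (Z k) κi≡k (All.lookup zs k′∈)) }) is))) ⟩
      ∏ (k ∷ ks) (λ k′ → detOn R (filter (λ i → κ i ≟ˣ k′) is) M) ∎
      where
      P? : U.Decidable (λ i → κ i ≡ k)
      P? i = κ i ≟ˣ k
      rest = filter (¬? ∘ P?) is
      κ∈′ : ∀ {i} → i List.∈ rest → κ i List.∈ ks
      κ∈′ i∈ with ∈-filter⁻ (¬? ∘ P?) {xs = is} i∈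
      ... | i∈is , κi≢k with κ∈ i∈is
      ...   | here κi≡k = contradiction κi≡k κi≢k
      ...   | there κi∈ = κi∈
      old : ∀ {i} → i List.∈ rest → i List.∈ is
      old i∈ = proj₁ (∈-filter⁻ (¬? ∘ P?) {xs = is} i∈)
      apart : ∀ {i j} → i List.∈ filter P? is → j List.∈ rest → Z (κ i) (κ j)
      apart i∈ j∈ with ≡.refl ← proj₂ (∈-filter⁻ P? {xs = is} i∈) = All.lookup zs (κ∈′ j∈)
      van′ : _ ⊎ _ → (∀ {i j} → i List.∈ rest → j List.∈ rest → Z (κ i) (κ j) → M i j ≈ 0#) ⊎
                     (∀ {i j} → i List.∈ rest → j List.∈ rest → Z (κ j) (κ i) → M i j ≈ 0#)
      van′ (inj₁ v) = inj₁ λ i∈ j∈ → v (old i∈) (old j∈)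
      van′ (inj₂ v) = inj₂ λ i∈ j∈ → v (old i∈) (old j∈)
      split : (∀ {i j} → i List.∈ is → j List.∈ is → Z (κ i) (κ j) → M i j ≈ 0#) ⊎
              (∀ {i j} → i List.∈ is → j List.∈ is → Z (κ j) (κ i) → M i j ≈ 0#) →
              detOn R is M ≈ detOn R (filter P? is) M * detOn R rest M
      split (inj₁ v) = ≈-trans (detOn-↭ M (filter-partition-↭ P? is))
        (detOn-++ _ _ M λ i∈ j∈ → v (proj₁ (∈-filter⁻ P? {xs = is} i∈)) (old j∈) (apart i∈ j∈))
      split (inj₂ v) = ≈-trans
        (detOn-↭ M (↭-trans (filter-partition-↭ P? is) (++-comm (filter P? is) rest)))
        (≈-trans (detOn-++ _ _ M λ j∈ i∈ → v (old j∈) (proj₁ (∈-filter⁻ P? {xs = is} i∈)) (apart i∈ j∈))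
               (*-comm _ _))

-- Partial forests

∈-comprehension⁺ : ∀ {P : U.Pred (Fin n) _} (P? : U.Decidable P) {v} → P v → v ∈ comprehension P?
∈-comprehension⁺ P? {v} p = Vec.lookup⇒[]= v _ (trans (Vec.lookup∘tabulate _ v) (dec-true (P? v) p))

∈-comprehension⁻ : ∀ {P : U.Pred (Fin n) _} (P? : U.Decidable P) {v} → v ∈ comprehension P? → P v
∈-comprehension⁻ P? {v} v∈ with P? v | trans (sym (Vec.lookup∘tabulate (does ∘ P?) v)) (Vec.[]=⇒lookup v∈)
... | yes p | _ = p
... | no _  | ()

-- `Below b s t`: the vector s arises from t by resetting some entries to b.
Below : ∀ {a} {A : Set a} → A → ∀ {k} → Vec A k → Vec A k → Set a
Below b s t = ∀ i → lookup s i ≡ b ⊎ lookup s i ≡ lookup t i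

Below-refl : ∀ {a} {A : Set a} {b : A} {k} (s : Vec A k) → Below b s s
Below-refl s i = inj₂ refl

⊆⇒Below : ∀ {p q : Subset n} → p ⊆ q → Below false p q
⊆⇒Below {p = p} {q} p⊆q i with lookup p i in eq
... | false = inj₁ refl
... | true  = inj₂ (sym (Vec.[]=⇒lookup (p⊆q (Vec.lookup⇒[]= i p eq))))

-- At the first place where two vectors differ, the entry of the earlier one is neither `b` nor the
-- entry of the later one. The enumeration is thus a linear extension of the reversed order `Below`,
-- and it can serve as the order of the blocks of a triangular matrix.
vecs-ordered : ∀ {a} {A : Set a} {b : A} {xs} → AllPairs (λ x y → ¬ (x ≡ b ⊎ x ≡ y)) xs →
               ∀ k → AllPairs (λ s t → ¬ Below b s t) (vecs xs k)
vecs-ordered pairs zero = [] ∷ []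
vecs-ordered {A = A} {b} {xs} pairs (suc k) = go pairs
  where
  rest = vecs-ordered pairs k
  later : ∀ {x} xs → All (λ y → ¬ (x ≡ b ⊎ x ≡ y)) xs → ∀ s →
          All (λ t → ¬ Below b (x ∷ s) t) (cartesianProductWith _∷_ xs (vecs _ k))
  later []       []       s = []
  later (y ∷ ys) (p ∷ ps) s =
    All.++⁺ (All.map⁺ (All.universal (λ t below → p (below zero)) _)) (later ys ps s)
  go : ∀ {ys} → AllPairs (λ x y → ¬ (x ≡ b ⊎ x ≡ y)) ys →
       AllPairs (λ s t → ¬ Below b s t) (cartesianProductWith _∷_ ys (vecs xs k))
  go []                        = []
  go {ys = y ∷ ys} (ps ∷ pss) = AllPairs.++⁺
    (AllPairs.map⁺ (AllPairs.map (λ ¬below below → ¬below (below ∘ suc)) rest))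
    (go pss)
    (All.map⁺ (All.universal (λ s → later ys ps s) _))

∈-vecs : ∀ {a} {A : Set a} {xs : List A} → (∀ x → x List.∈ xs) → ∀ {k} (s : Vec A k) → s List.∈ vecs xs k
∈-vecs all []      = here refl
∈-vecs all (x ∷ s) = ∈-cartesianProductWith⁺ _∷_ (all x) (∈-vecs all s)

-- Listing `true` before `false` puts every set ahead of its proper subsets.
subsets-ordered : ∀ n → AllPairs (λ s t → ¬ Below false s t) (subsets n)
subsets-ordered = vecs-ordered (((λ { (inj₁ ()) ; (inj₂ ()) }) ∷ []) ∷ [] ∷ [])

edgeSets-ordered : ∀ n → AllPairs (λ s t → ¬ Below ⊥ s t) (edgeSets n)
edgeSets-ordered n = vecs-ordered (AllPairs.map (λ {p} ¬below → λ where
  (inj₁ refl) → ¬below λ i → inj₁ (Vec.lookup-replicate i false)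
  (inj₂ refl) → ¬below (Below-refl p)) (subsets-ordered n)) n

subsets-unique : ∀ n → Unique (subsets n)
subsets-unique n = AllPairs.map (λ { {s} ¬below refl → ¬below (Below-refl s) }) (subsets-ordered n)

edgeSets-unique : ∀ n → Unique (edgeSets n)
edgeSets-unique n = AllPairs.map (λ { {s} ¬below refl → ¬below (Below-refl s) }) (edgeSets-ordered n)

∈-subsets : ∀ (W : Subset n) → W List.∈ subsets n
∈-subsets = ∈-vecs λ { true → here refl ; false → there (here refl) }

∈-edgeSets : ∀ (T : EdgeSet n) → T List.∈ edgeSets n
∈-edgeSets = ∈-vecs ∈-subsets

rootedEdgeSets : ∀ n → List (Rooted n)
rootedEdgeSets n = cartesianProduct (allFin n) (edgeSets n)

rootedEdgeSets-unique : ∀ n → Unique (rootedEdgeSets n)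
rootedEdgeSets-unique n = Unique.cartesianProduct⁺ (Unique.allFin⁺ n) (edgeSets-unique n)

∈-rootedEdgeSets : ∀ (a : Rooted n) → a List.∈ rootedEdgeSets n
∈-rootedEdgeSets (v , T) = ∈-cartesianProduct⁺ (∈-allFin v) (∈-edgeSets T)

∣p∣≡0⇒p≡⊥ : (p : Subset n) → ∣ p ∣ ≡ 0 → p ≡ ⊥
∣p∣≡0⇒p≡⊥ []          _  = refl
∣p∣≡0⇒p≡⊥ (false ∷ p) eq = cong (false ∷_) (∣p∣≡0⇒p≡⊥ p eq)

∣p∣≡1⇒p≡⁅x⁆ : (p : Subset n) → ∣ p ∣ ≡ 1 → ∃ λ x → p ≡ ⁅ x ⁆
∣p∣≡1⇒p≡⁅x⁆ (true ∷ p)  eq = zero , cong (true ∷_) (∣p∣≡0⇒p≡⊥ p (ℕ.suc-injective eq))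
∣p∣≡1⇒p≡⁅x⁆ (false ∷ p) eq with x , refl ← ∣p∣≡1⇒p≡⁅x⁆ p eq = suc x , refl

∣p∣≤1⇒p≡⁅x⁆ : ∀ {p : Subset n} {x} → ∣ p ∣ ≤ 1 → x ∈ p → p ≡ ⁅ x ⁆
∣p∣≤1⇒p≡⁅x⁆ {p = p} {x} ∣p∣≤1 x∈p with ∣ p ∣ in eq
∣p∣≤1⇒p≡⁅x⁆ {p = p} ∣p∣≤1 x∈p | zero with refl ← ∣p∣≡0⇒p≡⊥ p eq = contradiction x∈p ∉⊥
∣p∣≤1⇒p≡⁅x⁆ {p = p} ∣p∣≤1 x∈p | suc zero with y , refl ← ∣p∣≡1⇒p≡⁅x⁆ p eq =
  cong ⁅_⁆ (sym (x∈⁅y⁆⇒x≡y y x∈p))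
∣p∣≤1⇒p≡⁅x⁆ (s≤s ()) x∈p | suc (suc _)

⁅x⁆≢⊥ : ∀ {x : Fin n} → ⁅ x ⁆ ≢ ⊥
⁅x⁆≢⊥ {x = x} eq = ∉⊥ (subst (x ∈_) eq (x∈⁅x⁆ x))

x∈p─q⇒x∉q : ∀ (p q : Subset n) {x} → x ∈ p ─ q → x ∉ q
x∈p─q⇒x∉q (_ ∷ p) (true ∷ q)  {zero}  ()         _
x∈p─q⇒x∉q (_ ∷ p) (_ ∷ q)     {suc x} (Vec.there x∈) (Vec.there x∈q) = x∈p─q⇒x∉q p q x∈ x∈q

-- Roots and acyclicity

roots : EdgeSet n → Subset n
roots T = comprehension λ w → lookup T w ≟ˢ ⊥

∈-roots⁺ : ∀ (T : EdgeSet n) {w} → lookup T w ≡ ⊥ → w ∈ roots T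
∈-roots⁺ T = ∈-comprehension⁺ λ w → lookup T w ≟ˢ ⊥

∈-roots⁻ : ∀ (T : EdgeSet n) {w} → w ∈ roots T → lookup T w ≡ ⊥
∈-roots⁻ T = ∈-comprehension⁻ λ w → lookup T w ≟ˢ ⊥

Acyclic : EdgeSet n → Set
Acyclic T = ∀ v → ¬ TransClosure (Joins T) v v

acyclic-⊆ : ∀ (S T : EdgeSet n) → (∀ u v → Joins S u v → Joins T u v) → Acyclic T → Acyclic S
acyclic-⊆ S T S⊆T acyclic v p = acyclic v (map p)
  where
  map : ∀ {u v} → TransClosure (Joins S) u v → TransClosure (Joins T) u v
  map [ e ]   = [ S⊆T _ _ e ]
  map (e ∷ p) = S⊆T _ _ e ∷ map p

-- A walk using the new edge can be cut at the first and the last use, which leaves a walk to `w`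
-- and a walk from `u` inside `T`. On a cycle these two join to a walk from `u` to `w`.
acyclic-add : ∀ (S T : EdgeSet n) {w u} →
              (∀ a b → Joins S a b → Joins T a b ⊎ (a ≡ w × b ≡ u)) →
              Acyclic T → ¬ Star (Joins T) u w → Acyclic S
acyclic-add S T {w} {u} new acyclic ¬path v p with decompose p
  where
  star : ∀ {a b} → TransClosure (Joins T) a b → Star (Joins T) a b
  star [ e ]   = e ◅ ε
  star (e ∷ p) = e ◅ star p
  decompose : ∀ {a b} → TransClosure (Joins S) a b →
              TransClosure (Joins T) a b ⊎ (Star (Joins T) a w × Star (Joins T) u b)
  decompose [ e ] with new _ _ e
  ... | inj₁ e′            = inj₁ [ e′ ]
  ... | inj₂ (refl , refl) = inj₂ (ε , ε)
  decompose (e ∷ p) with new _ _ e | decompose p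
  ... | inj₁ e′            | inj₁ q       = inj₁ (e′ ∷ q)
  ... | inj₁ e′            | inj₂ (q , s) = inj₂ (e′ ◅ q , s)
  ... | inj₂ (refl , refl) | inj₁ q       = inj₂ (ε , star q)
  ... | inj₂ (refl , refl) | inj₂ (_ , s) = inj₂ (ε , s)
... | inj₁ q       = acyclic v q
... | inj₂ (q , s) = ¬path (s ◅◅ q)

-- Forests in a graph and the moves of a root

module Forests (G : Digraph n) where

  record IsForest (T : EdgeSet n) : Set where
    constructor mkIsForest
    field
      subgraph : ∀ u v → Joins T u v → _⟶_ G u v
      acyclic  : Acyclic T
      out      : ∀ v → ∣ lookup T v ∣ ≤ 1

  open IsForest

  isForest? : U.Decidable IsForest
  isForest? T = map′ (λ (s , a , o) → mkIsForest s a o) (λ f → subgraph f , acyclic f , out f)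
    ((all? λ u → all? λ v → joins? T u v →-dec _⟶?_ G u v) ×-dec
     (all? λ v → ¬? (plus? v v)) ×-dec
     (all? λ v → ∣ lookup T v ∣ ℕ.≤? 1))
    where open Reachability (joins? T)

  below-joins : ∀ (S T : EdgeSet n) → Below ⊥ S T → ∀ u v → Joins S u v → Joins T u v
  below-joins S T below u v e with below u
  ... | inj₁ eq = contradiction (subst (v ∈_) eq e) ∉⊥
  ... | inj₂ eq = subst (v ∈_) eq e

  below-forest : ∀ (S T : EdgeSet n) → Below ⊥ S T → IsForest T → IsForest S
  below-forest S T below f = mkIsForest
    (λ u v e → subgraph f u v (below-joins S T below u v e))
    (acyclic-⊆ S T (below-joins S T below) (acyclic f))
    λ v → Sum.[ (λ eq → subst (λ p → ∣ p ∣ ≤ 1) (sym eq) (subst (_≤ 1) (sym (∣⊥∣≡0 n)) z≤n))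
              , (λ eq → subst (λ p → ∣ p ∣ ≤ 1) (sym eq) (out f v)) ] (below v)

  below-roots : ∀ (S T : EdgeSet n) → Below ⊥ S T → roots T ⊆ roots S
  below-roots S T below {w} w∈ = ∈-roots⁺ S (Sum.[ id , (λ eq → trans eq (∈-roots⁻ T w∈)) ] (below w))

  detach-below : ∀ (T : EdgeSet n) u → Below ⊥ (T [ u ]≔ ⊥) T
  detach-below T u w with w ≟ u
  ... | yes refl = inj₁ (Vec.lookup∘updateAt u T)
  ... | no w≢u   = inj₂ (Vec.lookup∘updateAt′ w u w≢u T)

  module _ (T : EdgeSet n) {r u} (r≢u : r ≢ u) (r-root : lookup T r ≡ ⊥) where

    private
      T⁺ = T [ r ]%= (⁅ u ⁆ ∪_)
      T′ = T⁺ [ u ]≔ ⊥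

    move-new : lookup T′ u ≡ ⊥
    move-new = Vec.lookup∘updateAt u T⁺

    move-old : lookup T′ r ≡ ⁅ u ⁆
    move-old = trans (Vec.lookup∘updateAt′ r u r≢u T⁺)
      (trans (Vec.lookup∘updateAt r {⁅ u ⁆ ∪_} T) (trans (cong (⁅ u ⁆ ∪_) r-root) (∪-identityʳ ⁅ u ⁆)))

    move-other : ∀ {w} → w ≢ u → w ≢ r → lookup T′ w ≡ lookup T w
    move-other {w} w≢u w≢r = trans (Vec.lookup∘updateAt′ w u w≢u T⁺) (Vec.lookup∘updateAt′ w r w≢r T)

    -- The edge out of `u` goes first and the edge from `r` comes second: in between nothing leaves
    -- `u`, so no path leads from `u` back to `r`.
    move-forest : _⟶_ G r u → IsForest T → IsForest T′
    move-forest e f = mkIsForest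
      (λ a b j → Sum.[ (λ j′ → subgraph f a b (below-joins (T [ u ]≔ ⊥) T (detach-below T u) a b j′))
                     , (λ { (refl , refl) → e }) ] (new a b j))
      (acyclic-add T′ (T [ u ]≔ ⊥) new
        (acyclic-⊆ (T [ u ]≔ ⊥) T (below-joins (T [ u ]≔ ⊥) T (detach-below T u)) (acyclic f)) noPath)
      out′
      where
      new : ∀ a b → Joins T′ a b → Joins (T [ u ]≔ ⊥) a b ⊎ (a ≡ r × b ≡ u)
      new a b j with a ≟ u
      ... | yes refl = contradiction (subst (b ∈_) move-new j) ∉⊥
      ... | no a≢u with a ≟ r
      ...   | yes refl = inj₂ (refl , x∈⁅y⁆⇒x≡y u (subst (b ∈_) move-old j))
      ...   | no a≢r   = inj₁ (subst (b ∈_) (trans (move-other a≢u a≢r)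
                                 (sym (Vec.lookup∘updateAt′ a u a≢u T))) j)
      noPath : ¬ Star (Joins (T [ u ]≔ ⊥)) u r
      noPath ε       = r≢u refl
      noPath (j ◅ _) = ∉⊥ (subst (_ ∈_) (Vec.lookup∘updateAt u T) j)
      out′ : ∀ v → ∣ lookup T′ v ∣ ≤ 1
      out′ v with v ≟ u
      ... | yes refl = subst (λ p → ∣ p ∣ ≤ 1) (sym move-new) (subst (_≤ 1) (sym (∣⊥∣≡0 n)) z≤n)
      ... | no v≢u with v ≟ r
      ...   | yes refl = subst (λ p → ∣ p ∣ ≤ 1) (sym move-old) (ℕ.≤-reflexive (∣⁅x⁆∣≡1 u))
      ...   | no v≢r   = subst (λ p → ∣ p ∣ ≤ 1) (sym (move-other v≢u v≢r)) (out f v)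

    -- With its converse `below-move⁻` this transposes a move to the functions "contains `f`": the
    -- moved tree contains `f` exactly when the row of `f` at `r` is empty or is the new edge, and
    -- the other edges of `f` were present before the move.
    below-move⁺ : ∀ f → lookup f u ≡ ⊥ → lookup f r ≡ ⊥ ⊎ lookup f r ≡ ⁅ u ⁆ →
                  Below ⊥ (f [ r ]≔ ⊥) T → Below ⊥ f T′
    below-move⁺ f fu fr below w with w ≟ u
    ... | yes refl = inj₁ fu
    ... | no w≢u with w ≟ r
    ...   | yes refl = Sum.map₂ (λ eq → trans eq (sym move-old)) fr
    ...   | no w≢r   = Sum.map (trans same) (λ eq → trans same (trans eq (sym (move-other w≢u w≢r)))) (below w)
      where same = sym (Vec.lookup∘updateAt′ w r w≢r f)

    below-move⁻ : ∀ f → lookup f u ≡ ⊥ → Below ⊥ f T′ →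
                  (lookup f r ≡ ⊥ ⊎ lookup f r ≡ ⁅ u ⁆) × Below ⊥ (f [ r ]≔ ⊥) T
    below-move⁻ f fu below = Sum.map₂ (λ eq → trans eq move-old) (below r) , below′
      where
      below′ : Below ⊥ (f [ r ]≔ ⊥) T
      below′ w with w ≟ r
      ... | yes refl = inj₁ (Vec.lookup∘updateAt r f)
      ... | no w≢r with w ≟ u
      ...   | yes refl = inj₁ (trans same fu)
        where same = Vec.lookup∘updateAt′ w r w≢r f
      ...   | no w≢u   = Sum.map (trans same) (λ eq → trans same (trans eq (move-other w≢u w≢r))) (below w)
        where same = Vec.lookup∘updateAt′ w r w≢r f

    move-stars : roots T′ ─ ⁅ u ⁆ ⊆ roots T ─ ⁅ r ⁆
    move-stars {w} w∈ = x∈p∧x≢y⇒x∈p-y w∈T w≢r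
      where
      w∈T′ : w ∈ roots T′
      w∈T′ = p─q⊆p (roots T′) ⁅ u ⁆ w∈
      w≢u : w ≢ u
      w≢u refl = x∈p─q⇒x∉q (roots T′) ⁅ u ⁆ w∈ (x∈⁅x⁆ u)
      w≢r : w ≢ r
      w≢r refl = ⁅x⁆≢⊥ (trans (sym move-old) (∈-roots⁻ T′ w∈T′))
      w∈T : w ∈ roots T
      w∈T = ∈-roots⁺ T (trans (sym (move-other w≢u w≢r)) (∈-roots⁻ T′ w∈T′))

  -- A move into `K` leaves the state space, yet the diagonal entry keeps its weight. This is why
  -- the diagonal blocks become principal submatrices of the Schrödinger operator, on the roots
  -- outside `K`.
  Valid : Subset n → U.Pred (Rooted n) _
  Valid K (v , T) = IsForest T × v ∈ roots T × v ∉ K × K ⊆ roots T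

  valid? : ∀ K → U.Decidable (Valid K)
  valid? K (v , T) = isForest? T ×-dec v ∈? roots T ×-dec ¬? (v ∈? K) ×-dec K ⊆? roots T

  stars : Rooted n → Subset n
  stars (v , T) = roots T ─ ⁅ v ⁆

  IsTree : Subset n → U.Pred (Rooted n) _
  IsTree Z (v , T) = IsForest T × v ∈ roots T × roots T ─ ⁅ v ⁆ ≡ Z

  isTree? : ∀ Z → U.Decidable (IsTree Z)
  isTree? Z (v , T) = isForest? T ×-dec v ∈? roots T ×-dec (roots T ─ ⁅ v ⁆) ≟ˢ Z

  states trees : Subset n → List (Rooted n)
  states K = filter (valid? K) (rootedEdgeSets n)
  trees Z  = filter (isTree? Z) (rootedEdgeSets n)

  spans? : ∀ K T → Dec (IsForest T × K ⊆ roots T)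
  spans? K T = isForest? T ×-dec K ⊆? roots T

-- The lifted operator in the basis of indicator functions

unique∧set⇒↭ : ∀ {a} {A : Set a} {xs ys : List A} → Unique xs → Unique ys →
               (∀ {x} → x List.∈ xs → x List.∈ ys) → (∀ {x} → x List.∈ ys → x List.∈ xs) → xs ↭ ys
unique∧set⇒↭ p q to from = ∼bag⇒↭ (unique∧set⇒bag p q (mk⇔ to from))

module Lifting {c ℓ} (R : CommutativeRing c ℓ) {n} (G : Digraph n)
               (x : Fin n → Fin n → CommutativeRing.Carrier R)
               (y : Fin n → CommutativeRing.Carrier R) where

  open CommutativeRing R hiding (zero) renaming (refl to ≈-refl; sym to ≈-sym; trans to ≈-trans)
  open DeterminantOn R
  open Forests G
  open Digraph G
  open import Algebra.Properties.Semiring.Sum semiring using (sum)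
  open import Relation.Binary.Reasoning.Setoid setoid

  private
    M : Rooted n → Rooted n → Carrier
    M = LiftedSchrödinger R G x y

    L : Fin n → Fin n → Carrier
    L = Schrödinger R G x y

    diagonal : Fin n → Carrier
    diagonal v = - sum (weight R G x y v) + y v

  L-diagonal : ∀ v → L v v ≈ diagonal v
  L-diagonal v with v ≟ v
  ... | yes _  = ≈-refl
  ... | no v≢v = contradiction ≡.refl v≢v

  L-off : ∀ {u v} → u ≢ v → L u v ≈ weight R G x y u v
  L-off {u} {v} u≢v with u ≟ v
  ... | yes u≡v = contradiction u≡v u≢v
  ... | no _    = +-identityʳ _

  indicator : ∀ {a} {A : Set a} → Dec A → Carrier
  indicator d = if does d then 1# else 0#

  indicator-yes : ∀ {a} {A : Set a} (d : Dec A) → A → indicator d ≈ 1#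
  indicator-yes (yes _) _ = ≈-refl
  indicator-yes (no ¬a) a = contradiction a ¬a

  indicator-no : ∀ {a} {A : Set a} (d : Dec A) → ¬ A → indicator d ≈ 0#
  indicator-no (yes a) ¬a = contradiction a ¬a
  indicator-no (no _)  _  = ≈-refl

  indicator-⇔ : ∀ {a b} {A : Set a} {B : Set b} (d : Dec A) (e : Dec B) →
                (A → B) → (B → A) → indicator d ≈ indicator e
  indicator-⇔ d (yes b) to from = indicator-yes d (from b)
  indicator-⇔ d (no ¬b) to from = indicator-no d (¬b ∘ to)

  split : ∀ {a b} {A : Set a} {B : Set b} → Dec A → (A → B) → (¬ A → B) → B
  split (yes a) f g = f a
  split (no ¬a) f g = g ¬a

  below? : ∀ (S T : EdgeSet n) → Dec (Below ⊥ S T)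
  below? S T = all? λ i → lookup S i ≟ˢ ⊥ ⊎-dec lookup S i ≟ˢ lookup T i

  -- The change of basis from trees to indicator functions of "contains f".
  Contains : Rooted n → Rooted n → Set
  Contains (u , g) (v , f) = u ≡ v × Below ⊥ f g

  contains? : ∀ a b → Dec (Contains a b)
  contains? (u , g) (v , f) = u ≟ v ×-dec below? f g

  P : Rooted n → Rooted n → Carrier
  P a b = indicator (contains? a b)

  -- If a move along `u ⟶ v` ends in a state containing `f`, the state before it contained `f`
  -- without its edge out of `u`; that edge, if there is one, must be the edge just added. So `M`
  -- maps one indicator function to a combination of others.
  Pullback : Rooted n → Rooted n → Set
  Pullback (u , f′) (v , f) =
    _⟶_ G u v × f′ ≡ f [ u ]≔ ⊥ × (lookup f u ≡ ⊥ ⊎ lookup f u ≡ ⁅ v ⁆)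

  pullback? : ∀ a b → Dec (Pullback a b)
  pullback? (u , f′) (v , f) = _⟶?_ G u v ×-dec
    Vec.≡-dec _≟ˢ_ f′ (f [ u ]≔ ⊥) ×-dec (lookup f u ≟ˢ ⊥ ⊎-dec lookup f u ≟ˢ ⁅ v ⁆)

  -- The operator M in the basis of these indicator functions.
  N : Rooted n → Rooted n → Carrier
  N a b = if does (a ≟ᵗ b) then diagonal (proj₁ a)
          else if does (pullback? a b) then x (proj₁ a) (proj₁ b) else 0#

  module _ {Q : Rooted n → Rooted n → Set} (Q? : ∀ a b → Dec (Q a b)) where

    private
      A : Rooted n → Rooted n → Carrier
      A a b = if does (a ≟ᵗ b) then diagonal (proj₁ a)
              else if does (Q? a b) then x (proj₁ a) (proj₁ b) else 0#

    entry-diagonal : ∀ a → A a a ≈ diagonal (proj₁ a)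
    entry-diagonal a with a ≟ᵗ a
    ... | yes _  = ≈-refl
    ... | no a≢a = contradiction ≡.refl a≢a

    entry-edge : ∀ a b → a ≢ b → Q a b → A a b ≈ x (proj₁ a) (proj₁ b)
    entry-edge a b a≢b q with a ≟ᵗ b | Q? a b
    ... | yes a≡b | _     = contradiction a≡b a≢b
    ... | no _    | yes _ = ≈-refl
    ... | no _    | no ¬q = contradiction q ¬q

    entry-zero : ∀ a b → a ≢ b → ¬ Q a b → A a b ≈ 0#
    entry-zero a b a≢b ¬q with a ≟ᵗ b | Q? a b
    ... | yes a≡b | _     = contradiction a≡b a≢b
    ... | no _    | yes q = contradiction q ¬q
    ... | no _    | no _  = ≈-refl

  detTrees : Subset n → Carrier
  detTrees Z = detOn R (trees Z) M

  module _ (K : Subset n) where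

    states-unique : Unique (states K)
    states-unique = Unique.filter⁺ (valid? K) (rootedEdgeSets-unique n)

    ∈-states⁺ : ∀ {a} → Valid K a → a List.∈ states K
    ∈-states⁺ = ∈-filter⁺ (valid? K) (∈-rootedEdgeSets _)

    ∈-states⁻ : ∀ {a} → a List.∈ states K → Valid K a
    ∈-states⁻ = proj₂ ∘ ∈-filter⁻ (valid? K) {xs = rootedEdgeSets n}

    move-valid : ∀ {r T u} → Valid K (r , T) → _⟶_ G r u → u ∉ K → Valid K (move (r , T) u)
    move-valid {r} {T} {u} (forest , r∈ , r∉K , K⊆) e u∉K =
      move-forest T r≢u (∈-roots⁻ T r∈) e forest ,
      ∈-roots⁺ T′ (move-new T r≢u (∈-roots⁻ T r∈)) , u∉K , K⊆′
      where
      T′ = proj₂ (move (r , T) u)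
      r≢u : r ≢ u
      r≢u ≡.refl = loopless r e
      K⊆′ : K ⊆ roots T′
      K⊆′ {w} w∈K = ∈-roots⁺ T′ (≡.trans
        (move-other T r≢u (∈-roots⁻ T r∈) (λ { ≡.refl → u∉K w∈K }) (λ { ≡.refl → r∉K w∈K }))
        (∈-roots⁻ T (K⊆ w∈K)))

    detach-valid : ∀ {u v g f} → Valid K (u , g) → Valid K (v , f) → Valid K (u , f [ u ]≔ ⊥)
    detach-valid {u} {v} {g} {f} (_ , _ , u∉K , _) (forest , _ , _ , K⊆) =
      below-forest (f [ u ]≔ ⊥) f (detach-below f u) forest ,
      ∈-roots⁺ (f [ u ]≔ ⊥) (Vec.lookup∘updateAt u f) , u∉K ,
      below-roots (f [ u ]≔ ⊥) f (detach-below f u) ∘ K⊆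

    -- Each sum has at most one nonzero term: on the left the state reached from `a` by moving to
    -- the root of `b`, on the right the pullback of `b` to the root of `a`. For equal roots both
    -- terms are diagonal, as the graph has no loops.
    intertwine : ∀ {a b} → a List.∈ states K → b List.∈ states K →
                 ∑ (states K) (λ s → M a s * P s b) ≈ ∑ (states K) (λ s → P a s * N s b)
    intertwine {a@(u , g)} {b@(v , f)} a∈ b∈ with u ≟ v
    ... | yes ≡.refl = begin
      ∑ (states K) (λ s → M a s * P s b) ≈⟨ ∑-single states-unique a∈ offˡ ⟩
      M a a * P a b            ≈⟨ *-congʳ (entry-diagonal (treeEdge? G) a) ⟩
      diagonal u * P a b       ≈⟨ *-comm _ _ ⟩
      P a b * diagonal u       ≈⟨ *-congˡ (entry-diagonal pullback? b) ⟨
      P a b * N b b            ≈⟨ ∑-single states-unique b∈ offʳ ⟨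
      ∑ (states K) (λ s → P a s * N s b) ∎
      where
      offˡ : ∀ {s} → s List.∈ states K → s ≢ a → M a s * P s b ≈ 0#
      offˡ {s} _ s≢a = split (proj₁ s ≟ u)
        (λ { ≡.refl → ≈-trans (*-congʳ (entry-zero (treeEdge? G) a s (≡.≢-sym s≢a)
                           λ (e , _) → loopless u e)) (zeroˡ _) })
        (λ r≢u → ≈-trans (*-congˡ (indicator-no (contains? s b) (r≢u ∘ proj₁))) (zeroʳ _))
      offʳ : ∀ {s} → s List.∈ states K → s ≢ b → P a s * N s b ≈ 0#
      offʳ {s} _ s≢b = split (u ≟ proj₁ s)
        (λ { ≡.refl → ≈-trans (*-congˡ (entry-zero pullback? s b s≢b
                           λ (e , _) → loopless u e)) (zeroʳ _) })
        (λ u≢r → ≈-trans (*-congʳ (indicator-no (contains? a s) (u≢r ∘ proj₁))) (zeroˡ _))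
    ... | no u≢v with _⟶?_ G u v
    ...   | no ¬e = ≈-trans (∑-0 (states K) zeroˡ′) (≈-sym (∑-0 (states K) zeroʳ′))
      where
      zeroˡ′ : ∀ {s} → s List.∈ states K → M a s * P s b ≈ 0#
      zeroˡ′ {s} _ = split (proj₁ s ≟ v)
        (λ { ≡.refl → ≈-trans (*-congʳ (entry-zero (treeEdge? G) a s (u≢v ∘ ≡.cong proj₁)
                           (¬e ∘ proj₁))) (zeroˡ _) })
        (λ r≢v → ≈-trans (*-congˡ (indicator-no (contains? s b) (r≢v ∘ proj₁))) (zeroʳ _))
      zeroʳ′ : ∀ {s} → s List.∈ states K → P a s * N s b ≈ 0#
      zeroʳ′ {s} _ = split (u ≟ proj₁ s)
        (λ { ≡.refl → ≈-trans (*-congˡ (entry-zero pullback? s b (u≢v ∘ ≡.cong proj₁)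
                           (¬e ∘ proj₁))) (zeroʳ _) })
        (λ u≢r → ≈-trans (*-congʳ (indicator-no (contains? a s) (u≢r ∘ proj₁))) (zeroˡ _))
    ...   | yes e = begin
      ∑ (states K) (λ s → M a s * P s b) ≈⟨ ∑-single states-unique moved∈ offˡ ⟩
      M a moved * P moved b
        ≈⟨ *-congʳ (entry-edge (treeEdge? G) a moved (u≢v ∘ ≡.cong proj₁) (e , ≡.refl)) ⟩
      x u v * P moved b                  ≈⟨ compare (lookup f u ≟ˢ ⊥ ⊎-dec lookup f u ≟ˢ ⁅ v ⁆) ⟩
      P a pulled * N pulled b            ≈⟨ ∑-single states-unique pulled∈ offʳ ⟨
      ∑ (states K) (λ s → P a s * N s b) ∎
      where
      moved pulled : Rooted n
      moved = move a v
      pulled = u , f [ u ]≔ ⊥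
      validᵃ = ∈-states⁻ a∈
      validᵇ = ∈-states⁻ b∈
      gᵤ : lookup g u ≡ ⊥
      gᵤ = ∈-roots⁻ g (proj₁ (proj₂ validᵃ))
      fᵥ : lookup f v ≡ ⊥
      fᵥ = ∈-roots⁻ f (proj₁ (proj₂ validᵇ))
      -- `v` avoids `K` because `b` is a valid state with root `v`, so this move stays among the
      -- states.
      moved∈ = ∈-states⁺ (move-valid validᵃ e (proj₁ (proj₂ (proj₂ validᵇ))))
      pulled∈ = ∈-states⁺ (detach-valid {g = g} validᵃ validᵇ)
      offˡ : ∀ {s} → s List.∈ states K → s ≢ moved → M a s * P s b ≈ 0#
      offˡ {s} _ s≢ = split (proj₁ s ≟ v)
        (λ { ≡.refl → ≈-trans (*-congʳ (entry-zero (treeEdge? G) a s (u≢v ∘ ≡.cong proj₁)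
                           (s≢ ∘ proj₂))) (zeroˡ _) })
        (λ r≢v → ≈-trans (*-congˡ (indicator-no (contains? s b) (r≢v ∘ proj₁))) (zeroʳ _))
      offʳ : ∀ {s} → s List.∈ states K → s ≢ pulled → P a s * N s b ≈ 0#
      offʳ {s} _ s≢ = split (u ≟ proj₁ s)
        (λ { ≡.refl → ≈-trans (*-congˡ (entry-zero pullback? s b (u≢v ∘ ≡.cong proj₁)
                           λ (_ , eq , _) → s≢ (≡.cong (u ,_) eq))) (zeroʳ _) })
        (λ u≢r → ≈-trans (*-congʳ (indicator-no (contains? a s) (u≢r ∘ proj₁))) (zeroˡ _))
      compare : Dec (lookup f u ≡ ⊥ ⊎ lookup f u ≡ ⁅ v ⁆) → x u v * P moved b ≈ P a pulled * N pulled b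
      compare (yes ok) = ≈-trans (*-comm _ _) (*-cong
        (indicator-⇔ (contains? moved b) (contains? a pulled)
          (λ (_ , below) → ≡.refl , proj₂ (below-move⁻ g u≢v gᵤ f fᵥ below))
          (λ (_ , below) → ≡.refl , below-move⁺ g u≢v gᵤ f fᵥ ok below))
        (≈-sym (entry-edge pullback? pulled b (u≢v ∘ ≡.cong proj₁) (e , ≡.refl , ok))))
      -- Here `f` has an edge out of `u` that does not lead to `v`. The moved state cannot contain
      -- it, and `pulled` is not a pullback of `b`, so both sides vanish.
      compare (no ¬ok) = ≈-trans
        (≈-trans (*-congˡ (indicator-no (contains? moved b)
          (¬ok ∘ proj₁ ∘ below-move⁻ g u≢v gᵤ f fᵥ ∘ proj₂))) (zeroʳ _))
        (≈-sym (≈-trans (*-congˡ (entry-zero pullback? pulled b (u≢v ∘ ≡.cong proj₁)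
          (¬ok ∘ proj₂ ∘ proj₂))) (zeroʳ _)))

    private
      _≟ᵉ_ = Vec.≡-dec {n = n} (_≟ˢ_ {n})

      irreflˢ : ∀ (Z : Subset n) → ¬ ¬ Below false Z Z
      irreflˢ Z ¬below = ¬below (Below-refl Z)

      irreflᵉ : ∀ (T : EdgeSet n) → ¬ ¬ Below ⊥ T T
      irreflᵉ T ¬below = ¬below (Below-refl T)

      fibre : EdgeSet n → List (Rooted n)
      fibre T = filter (λ a → proj₂ a ≟ᵉ T) (states K)

      fibre-unique : ∀ T → Unique (fibre T)
      fibre-unique T = Unique.filter⁺ (λ a → proj₂ a ≟ᵉ T) states-unique

      ∈-fibre⁻ : ∀ {T a} → a List.∈ fibre T → Valid K a × proj₂ a ≡ T
      ∈-fibre⁻ {T} a∈ with a∈K , eq ← ∈-filter⁻ (λ a → proj₂ a ≟ᵉ T) {xs = states K} a∈ =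
        ∈-states⁻ a∈K , eq

    -- Unitriangularity: containment respects the enumeration of the edge sets, and two states with
    -- the same edge set differ in their roots.
    det-P : detOn R (states K) P ≈ 1#
    det-P = begin
      detOn R (states K) P ≈⟨ detOn-blocks _≟ᵉ_ proj₂ irreflᵉ P (edgeSets n) (edgeSets-ordered n)
                                (states K) (λ _ → ∈-edgeSets _)
                                (inj₂ λ {i} {j} _ _ ¬below → indicator-no (contains? i j) (¬below ∘ proj₂)) ⟩
      ∏ (edgeSets n) (λ T → detOn R (fibre T) P) ≈⟨ ∏-1 (edgeSets n) (λ {T} _ →
        detOn-identity (fibre-unique T)
          (λ {i} _ → indicator-yes (contains? i i) (≡.refl , Below-refl (proj₂ i)))
          (λ {i} {j} i∈ j∈ i≢j → indicator-no (contains? i j)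
            λ (u≡v , _) → i≢j (≡.cong₂ _,_ u≡v
              (≡.trans (proj₂ (∈-fibre⁻ i∈)) (≡.sym (proj₂ (∈-fibre⁻ j∈))))))) ⟩
      1# ∎

    -- The states over `T` are the roots of `T` outside `K`. Their rows are already empty, so
    -- resetting one changes nothing: every edge of the graph between them is a pullback, and `N`
    -- restricts to `L`.
    det-N-fibre : ∀ T (d : Dec (IsForest T × K ⊆ roots T)) → detOn R (fibre T) N ≈
                  (if does d then detRestricted R G x y (roots T ─ K) else 1#)
    det-N-fibre T (no ¬spans) = reflexive (≡.cong (λ is → detOn R is N) empty)
      where
      empty : fibre T ≡ []
      empty = filter-none (λ a → proj₂ a ≟ᵉ T) {xs = states K}
        (All.tabulate λ { a∈ ≡.refl → let (forest , _ , _ , K⊆) = ∈-states⁻ a∈ in ¬spans (forest , λ {w} → K⊆ {w}) })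
    det-N-fibre T (yes (forest , K⊆)) = begin
      detOn R (fibre T) N ≈⟨ detOn-↭ N (unique∧set⇒↭ (fibre-unique T)
        (Unique.map⁺ (≡.cong proj₁) (Unique.filter⁺ (_∈? (roots T ─ K)) (Unique.allFin⁺ n))) to from) ⟩
      detOn R (List.map (_, T) (elements (roots T ─ K))) N ≈⟨ detOn-map (_, T) (elements (roots T ─ K)) N ⟩
      detOn R (elements (roots T ─ K)) (λ u v → N (u , T) (v , T))
        ≈⟨ detOn-cong (elements (roots T ─ K)) (λ {u} {v} u∈ _ → entry {u} {v} (root u∈)) ⟩
      detRestricted R G x y (roots T ─ K) ∎
      where
      root : ∀ {u} → u List.∈ elements (roots T ─ K) → lookup T u ≡ ⊥
      root u∈ = ∈-roots⁻ T (p─q⊆p (roots T) K (proj₂ (∈-filter⁻ (_∈? (roots T ─ K)) {xs = allFin n} u∈)))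
      to : ∀ {a} → a List.∈ fibre T → a List.∈ List.map (_, T) (elements (roots T ─ K))
      to a∈ with (_ , v∈ , v∉K , _) , ≡.refl ← ∈-fibre⁻ a∈ =
        ∈-map⁺ (_, T) (∈-filter⁺ (_∈? (roots T ─ K)) (∈-allFin _) (x∈p∧x∉q⇒x∈p─q v∈ v∉K))
      from : ∀ {a} → a List.∈ List.map (_, T) (elements (roots T ─ K)) → a List.∈ fibre T
      from a∈ with v , v∈ , ≡.refl ← ∈-map⁻ (_, T) a∈ =
        ∈-filter⁺ (λ a → proj₂ a ≟ᵉ T) (∈-states⁺ (forest , p─q⊆p (roots T) K v∈′ ,
          x∈p─q⇒x∉q (roots T) K v∈′ , λ {w} → K⊆ {w})) ≡.refl
        where v∈′ = proj₂ (∈-filter⁻ (_∈? (roots T ─ K)) {xs = allFin n} v∈)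
      entry : ∀ {u v} → lookup T u ≡ ⊥ → N (u , T) (v , T) ≈ L u v
      entry {u} {v} Tᵤ = split (u ≟ v)
        (λ { ≡.refl → ≈-trans (entry-diagonal pullback? (u , T)) (≈-sym (L-diagonal u)) })
        (λ u≢v → ≈-trans (off u≢v (_⟶?_ G u v)) (≈-sym (L-off u≢v)))
        where
        off : u ≢ v → ∀ (d : Dec (_⟶_ G u v)) → N (u , T) (v , T) ≈ (if does d then x u v else 0#)
        off u≢v (yes e) = entry-edge pullback? (u , T) (v , T) (u≢v ∘ ≡.cong proj₁)
          (e , ≡.sym (≡.trans (≡.cong (T [ u ]≔_) (≡.sym Tᵤ)) (Vec.[]≔-lookup T u)) , inj₁ Tᵤ)
        off u≢v (no ¬e) = entry-zero pullback? (u , T) (v , T) (u≢v ∘ ≡.cong proj₁) (¬e ∘ proj₁)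

    det-N : detOn R (states K) N ≈
            ∏ (edgeSets n) (λ T → if does (spans? K T) then detRestricted R G x y (roots T ─ K) else 1#)
    det-N = ≈-trans
      (detOn-blocks _≟ᵉ_ proj₂ irreflᵉ N (edgeSets n) (edgeSets-ordered n)
        (states K) (λ _ → ∈-edgeSets _) (inj₁ vanish))
      (∏-cong (edgeSets n) λ {T} _ → det-N-fibre T (spans? K T))
      where
      vanish : ∀ {a b} → a List.∈ states K → b List.∈ states K →
               ¬ Below ⊥ (proj₂ a) (proj₂ b) → N a b ≈ 0#
      vanish {a} {b} _ _ ¬below = entry-zero pullback? a b
        (λ { ≡.refl → ¬below (Below-refl (proj₂ a)) })
        (λ { (_ , ≡.refl , _) → ¬below (detach-below (proj₂ b) (proj₁ a)) })

    -- Once the other roots are `Z` with `K ⊆ Z`, the conditions of `Valid K` that involve `K` are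
    -- automatic. The block of `Z` is therefore the same for every such `K`, and the same unknowns
    -- occur in the identities for different `K`.
    det-M : detOn R (states K) M ≈
            ∏ (subsets n) (λ Z → if does (K ⊆? Z) then detTrees Z else 1#)
    det-M = ≈-trans
      (detOn-blocks _≟ˢ_ stars irreflˢ M (subsets n) (subsets-ordered n)
        (states K) (λ _ → ∈-subsets _) (inj₂ vanish))
      (∏-cong (subsets n) λ {Z} _ → reflexive (block Z (K ⊆? Z)))
      where
      vanish : ∀ {a b} → a List.∈ states K → b List.∈ states K →
               ¬ Below false (stars b) (stars a) → M a b ≈ 0#
      vanish {a@(u , g)} {b} a∈ _ ¬below = entry-zero (treeEdge? G) a b
        (λ { ≡.refl → ¬below (Below-refl (stars a)) })
        (λ (e , b≡) → ¬below (⊆⇒Below (≡.subst (λ b → stars b ⊆ stars a) (≡.sym b≡)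
          (move-stars g (λ { ≡.refl → loopless u e }) (∈-roots⁻ g (proj₁ (proj₂ (∈-states⁻ a∈))))))))
      block : ∀ Z (d : Dec (K ⊆ Z)) → detOn R (filter (λ a → stars a ≟ˢ Z) (states K)) M ≡
                                      (if does d then detTrees Z else 1#)
      block Z (yes K⊆Z) = ≡.cong (λ is → detOn R is M)
        (filter-∩ (λ a → stars a ≟ˢ Z) (valid? K) (isTree? Z)
          (λ eq (forest , v∈ , _) → forest , v∈ , eq) (λ (_ , _ , eq) → eq)
          (λ { {v , T} (forest , v∈ , ≡.refl) → forest , v∈ , (λ v∈K → x∈p─q⇒x∉q (roots T) ⁅ v ⁆ (K⊆Z v∈K) (x∈⁅x⁆ v)) , p─q⊆p (roots T) ⁅ v ⁆ ∘ K⊆Z })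
          (rootedEdgeSets n))
      block Z (no K⊈Z) = ≡.cong (λ is → detOn R is M)
        (filter-none (λ a → stars a ≟ˢ Z) {xs = states K} (All.tabulate λ { {v , T} a∈ ≡.refl →
          let (_ , _ , v∉K , K⊆) = ∈-states⁻ a∈
          in K⊈Z λ w∈K → x∈p∧x≢y⇒x∈p-y (K⊆ w∈K) λ { ≡.refl → v∉K w∈K } }))

    treesFactorisation :
      ∏ (subsets n) (λ Z → if does (K ⊆? Z) then detTrees Z else 1#) ≈
      ∏ (edgeSets n) (λ T → if does (spans? K T) then detRestricted R G x y (roots T ─ K) else 1#)
    treesFactorisation = ≈-trans (≈-sym det-M)
      (≈-trans (detOn-similar (states K) M P N intertwine det-P) det-N)

-- The exploration algorithm

loop-accept : ∀ (T : EdgeSet n) k A {w u} L F → Joins T w u →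
  loop T (suc k) A ((w , u) ∷ L) F ≡
  loop T k (A ∪ ⁅ w ⁆) (dropSource w L ++ targeting w (dropSource w F)) (dropSource w F)
loop-accept T k A {w} {u} L F j with joins? T w u
... | yes _ = refl
... | no ¬j = contradiction j ¬j

loop-reject : ∀ (T : EdgeSet n) k A {w u} L F → ¬ Joins T w u →
  loop T (suc k) A ((w , u) ∷ L) F ≡ loop T k A (dropIncident w L) (dropIncident w F)
loop-reject T k A {w} {u} L F ¬j with joins? T w u
... | yes j = contradiction j ¬j
... | no _  = refl

module _ {w : Fin n} where

  private
    source? : (e : Edge n) → Dec (proj₁ e ≢ w)
    source? (u , _) = ¬? (u ≟ w)

    target? : (e : Edge n) → Dec (proj₂ e ≡ w)
    target? (_ , v) = v ≟ w

    incident? : (e : Edge n) → Dec (proj₁ e ≢ w × proj₂ e ≢ w)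
    incident? (u , v) = ¬? (u ≟ w) ×-dec ¬? (v ≟ w)

  ∈-dropSource⁺ : ∀ {L e} → e List.∈ L → proj₁ e ≢ w → e List.∈ dropSource w L
  ∈-dropSource⁺ = ∈-filter⁺ source?

  ∈-dropSource⁻ : ∀ {L e} → e List.∈ dropSource w L → e List.∈ L × proj₁ e ≢ w
  ∈-dropSource⁻ {L} = ∈-filter⁻ source? {xs = L}

  ∈-targeting⁺ : ∀ {L e} → e List.∈ L → proj₂ e ≡ w → e List.∈ targeting w L
  ∈-targeting⁺ = ∈-filter⁺ target?

  ∈-targeting⁻ : ∀ {L e} → e List.∈ targeting w L → e List.∈ L × proj₂ e ≡ w
  ∈-targeting⁻ {L} = ∈-filter⁻ target? {xs = L}

  ∈-dropIncident⁺ : ∀ {L e} → e List.∈ L → proj₁ e ≢ w → proj₂ e ≢ w → e List.∈ dropIncident w L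
  ∈-dropIncident⁺ e∈ u≢w v≢w = ∈-filter⁺ incident? e∈ (u≢w , v≢w)

  ∈-dropIncident⁻ : ∀ {L e} → e List.∈ dropIncident w L → e List.∈ L × proj₁ e ≢ w
  ∈-dropIncident⁻ {L} e∈ = let e∈L , u≢w , _ = ∈-filter⁻ incident? {xs = L} e∈ in e∈L , u≢w

  length-dropSource : ∀ {F u} → (w , u) List.∈ F → length (dropSource w F) ℕ.< length F
  length-dropSource {F} e∈ = filter-notAll source? F (Any.map (λ { refl u≢w → u≢w refl }) e∈)

  length-dropIncident : ∀ {F u} → (w , u) List.∈ F → length (dropIncident w F) ℕ.< length F
  length-dropIncident {F} e∈ = filter-notAll incident? F (Any.map (λ { refl (u≢w , _) → u≢w refl }) e∈)

  ∈-accepted⁻ : ∀ {L F e} → e List.∈ dropSource w L ++ targeting w (dropSource w F) →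
                (e List.∈ L ⊎ e List.∈ F × proj₂ e ≡ w) × proj₁ e ≢ w
  ∈-accepted⁻ {L} {F} e∈ with ∈-++⁻ (dropSource w L) e∈
  ... | inj₁ e∈L = let e∈L , ≢w = ∈-dropSource⁻ {L} e∈L in inj₁ e∈L , ≢w
  ... | inj₂ e∈F = let e∈F , ≡w = ∈-targeting⁻ {dropSource w F} e∈F ; e∈F , ≢w = ∈-dropSource⁻ {F} e∈F
                   in inj₂ (e∈F , ≡w) , ≢w

-- A vertex is accepted only as the source of a queued edge, and the queue is refilled only from
-- `F`.
erased : ∀ (T : EdgeSet n) k {A L F w} → w ∉ A → (∀ {y} → (w , y) List.∉ L) →
         (∀ {y} → (w , y) List.∉ F) → w ∉ loop T k A L F
erased T zero    w∉A w∉L w∉F = w∉A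
erased T (suc k) {L = []} w∉A w∉L w∉F = w∉A
erased T (suc k) {A} {L = (x , u) ∷ L} {F} {w} w∉A w∉L w∉F with joins? T x u
... | yes _ = erased T k
  (λ w∈ → Sum.[ w∉A , (λ w∈x → w≢x (x∈⁅y⁆⇒x≡y x w∈x)) ] (x∈p∪q⁻ A ⁅ x ⁆ w∈))
  (λ e∈ → Sum.[ w∉L ∘ there , w∉F ∘ proj₁ ] (proj₁ (∈-accepted⁻ {L = L} {F} e∈)))
  (w∉F ∘ proj₁ ∘ ∈-dropSource⁻ {L = F})
  where
  w≢x : w ≢ x
  w≢x refl = w∉L (here refl)
... | no _  = erased T k w∉A (w∉L ∘ there ∘ proj₁ ∘ ∈-dropIncident⁻ {L = L})
                             (w∉F ∘ proj₁ ∘ ∈-dropIncident⁻ {L = F})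

loop-⊇ : ∀ (T : EdgeSet n) k {A L F} → A ⊆ loop T k A L F
loop-⊇ T zero    = id
loop-⊇ T (suc k) {L = []} = id
loop-⊇ T (suc k) {A} {L = (x , u) ∷ L} {F} with joins? T x u
... | yes _ = loop-⊇ T k ∘ p⊆p∪q ⁅ x ⁆
... | no _  = loop-⊇ T k

module _ {S : Subset n} {T₁ T₂ : EdgeSet n}
         (out₁ : ∀ x → ∣ lookup T₁ x ∣ ≤ 1) (out₂ : ∀ x → ∣ lookup T₂ x ∣ ≤ 1) where

  -- Two trees that agree outside S and whose explorations accept all of S
  -- make the same decisions.
  replay : ∀ k A L F → (∀ {x} → x ∉ S ⊎ x ∈ A → lookup T₁ x ≡ lookup T₂ x) →
           (∀ {x y} → (x , y) List.∈ L ⊎ (x , y) List.∈ F → x ∉ A) →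
           S ⊆ loop T₁ k A L F → S ⊆ loop T₂ k A L F → ∀ x → lookup T₁ x ≡ lookup T₂ x
  replay k A L F agree fresh S⊆₁ S⊆₂ x with x ∈? S
  ... | no x∉S = agree (inj₁ x∉S)
  -- The loop returns `A` unchanged here, so the covering hypothesis says that `x` has already been
  -- accepted.
  replay zero A L F agree fresh S⊆₁ S⊆₂ x | yes x∈S = agree (inj₂ (S⊆₁ x∈S))
  replay (suc k) A [] F agree fresh S⊆₁ S⊆₂ x | yes x∈S = agree (inj₂ (S⊆₁ x∈S))
  replay (suc k) A ((w , u) ∷ L) F agree fresh S⊆₁ S⊆₂ x | yes _ =
    go (w ∈? S) (joins? T₁ w u) (joins? T₂ w u)
    where
    w∉A : w ∉ A
    w∉A = fresh (inj₁ (here refl))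
    accepted : lookup T₁ w ≡ lookup T₂ w → Joins T₁ w u → Joins T₂ w u → lookup T₁ x ≡ lookup T₂ x
    accepted same j₁ j₂ = replay k (A ∪ ⁅ w ⁆) _ (dropSource w F)
      (λ { (inj₁ x∉S) → agree (inj₁ x∉S)
         ; (inj₂ x∈)  → Sum.[ agree ∘ inj₂ , (λ x∈w → subst (λ z → lookup T₁ z ≡ lookup T₂ z)
                                              (sym (x∈⁅y⁆⇒x≡y w x∈w)) same) ] (x∈p∪q⁻ A ⁅ w ⁆ x∈) })
      fresh′ (subst (S ⊆_) (loop-accept T₁ k A L F j₁) S⊆₁) (subst (S ⊆_) (loop-accept T₂ k A L F j₂) S⊆₂) x
      where
      old : ∀ {x y} → x ∉ A × x ≢ w → x ∉ A ∪ ⁅ w ⁆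
      old (x∉A , x≢w) x∈ = Sum.[ x∉A , x≢w ∘ x∈⁅y⁆⇒x≡y w ] (x∈p∪q⁻ A ⁅ w ⁆ x∈)
      fresh′ : ∀ {x y} → (x , y) List.∈ dropSource w L ++ targeting w (dropSource w F) ⊎
                         (x , y) List.∈ dropSource w F → x ∉ A ∪ ⁅ w ⁆
      fresh′ {x} {y} (inj₁ e∈) with ∈-accepted⁻ {L = L} {F} e∈
      ... | inj₁ e∈L , x≢w       = old {x} {y} (fresh (inj₁ (there e∈L)) , x≢w)
      ... | inj₂ (e∈F , _) , x≢w = old {x} {y} (fresh (inj₂ e∈F) , x≢w)
      fresh′ {x} {y} (inj₂ e∈) = let e∈F , x≢w = ∈-dropSource⁻ {L = F} e∈
                                 in old {x} {y} (fresh (inj₂ e∈F) , x≢w)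
    never : ∀ T → w ∈ S → ¬ Joins T w u → ¬ S ⊆ loop T (suc k) A ((w , u) ∷ L) F
    never T w∈S ¬j S⊆ = erased T k w∉A
      (λ e∈ → proj₂ (∈-dropIncident⁻ {L = L} e∈) refl)
      (λ e∈ → proj₂ (∈-dropIncident⁻ {L = F} e∈) refl)
      (subst (S ⊆_) (loop-reject T k A L F ¬j) S⊆ w∈S)
    go : Dec (w ∈ S) → Dec (Joins T₁ w u) → Dec (Joins T₂ w u) → lookup T₁ x ≡ lookup T₂ x
    -- Rejecting `w` would erase a vertex of `S` for good. Hence both trees contain the proposed
    -- edge, and a row with at most one edge is determined by it.
    go (yes w∈S) (no ¬j₁) _ = ⊥-elim (never T₁ w∈S ¬j₁ S⊆₁)
    go (yes w∈S) _ (no ¬j₂) = ⊥-elim (never T₂ w∈S ¬j₂ S⊆₂)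
    go (yes w∈S) (yes j₁) (yes j₂) =
      accepted (trans (∣p∣≤1⇒p≡⁅x⁆ (out₁ w) j₁) (sym (∣p∣≤1⇒p≡⁅x⁆ (out₂ w) j₂))) j₁ j₂
    go (no w∉S) (yes j₁) _ = accepted (agree (inj₁ w∉S)) j₁ (subst (u ∈_) (agree (inj₁ w∉S)) j₁)
    go (no w∉S) (no ¬j₁) _ = replay k A _ (dropIncident w F) agree
      (Sum.[ fresh ∘ inj₁ ∘ there ∘ proj₁ ∘ ∈-dropIncident⁻ {L = L}
           , fresh ∘ inj₂ ∘ proj₁ ∘ ∈-dropIncident⁻ {L = F} ])
      (subst (S ⊆_) (loop-reject T₁ k A L F ¬j₁) S⊆₁)
      (subst (S ⊆_) (loop-reject T₂ k A L F (¬j₁ ∘ subst (u ∈_) (sym (agree (inj₁ w∉S))))) S⊆₂) x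

-- Recovering a tree from a forest

module Exploration (G : Digraph n) where

  open Forests G
  open Digraph G

  ∈-edges⁺ : ∀ {u v} → _⟶_ G u v → (u , v) List.∈ edges G
  ∈-edges⁺ {u} {v} = ∈-filter⁺ (uncurry (_⟶?_ G)) (∈-cartesianProduct⁺ (∈-allFin u) (∈-allFin v))

  ∈-edges⁻ : ∀ {u v} → (u , v) List.∈ edges G → _⟶_ G u v
  ∈-edges⁻ = proj₂ ∘ ∈-filter⁻ (uncurry (_⟶?_ G)) {xs = List.cartesianProduct (allFin n) (allFin n)}

  module _ {S : Subset n} (sc : StronglyConnected G S) {v : Fin n} (v∈S : v ∈ S) where

    -- The state of an exploration from v in which every vertex of S is to be
    -- accepted; T is the part of the tree that is known so far.
    record Growing (k : ℕ) (A : Subset n) (L F : List (Edge n)) (T : EdgeSet n) : Set where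
      field
        forest  : IsForest T
        v∈A     : v ∈ A
        fuel    : length F ≤ k
        L⊆F     : ∀ {e} → e List.∈ L → e List.∈ F
        fresh   : ∀ {x y} → (x , y) List.∈ F → x ∉ A
        edge    : ∀ {x y} → (x , y) List.∈ F → _⟶_ G x y
        target  : ∀ {x y} → (x , y) List.∈ L → y ∈ A
        queued  : ∀ {s u} → s ∈ S → s ∉ A → u ∈ S → u ∈ A → _⟶_ G s u → (s , u) List.∈ L
        stored  : ∀ {s u} → s ∈ S → s ∉ A → u ∈ S → u ∉ A → _⟶_ G s u → (s , u) List.∈ F
        closed  : ∀ {x y} → x ∈ A → Joins T x y → y ∈ A
        v-root  : lookup T v ≡ ⊥
        open-root : ∀ {s} → s ∈ S → s ∉ A → lookup T s ≡ ⊥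
        no-root : ∀ {x} → lookup T x ≡ ⊥ → x ≡ v ⊎ (x ∈ S × x ∉ A)

    open Growing

    -- `T′` is `T` itself when `w` lies outside `S` and is accepted by its own edge, and `T` with a
    -- new row at `w` when `w` lies in `S`; both cases need the same update of the invariant.
    accept : ∀ {k A w u L F T T′} → Growing (suc k) A ((w , u) ∷ L) F T → IsForest T′ →
             (∀ {x} → x ≢ w → lookup T′ x ≡ lookup T x) →
             (∀ {y} → Joins T′ w y → y ∈ A) → lookup T′ w ≢ ⊥ →
             Growing k (A ∪ ⁅ w ⁆) (dropSource w L ++ targeting w (dropSource w F)) (dropSource w F) T′
    accept {k} {A} {w} {u} {L} {F} {T} {T′} g forest′ same to-A non-root = record
      { forest = forest′
      ; v∈A    = p⊆p∪q ⁅ w ⁆ (v∈A g)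
      ; fuel   = ℕ.≤-pred (ℕ.≤-trans (length-dropSource (L⊆F g (here refl))) (fuel g))
      ; L⊆F    = λ e∈ → let (e∈ , ≢w) = ∈-accepted⁻ {L = L} {F} e∈
                        in ∈-dropSource⁺ {L = F} (Sum.[ L⊆F g ∘ there , proj₁ ] e∈) ≢w
      ; fresh  = λ e∈ → let (e∈F , ≢w) = ∈-dropSource⁻ {L = F} e∈ in not-in (fresh g e∈F) ≢w
      ; edge   = edge g ∘ proj₁ ∘ ∈-dropSource⁻ {L = F}
      ; target = λ e∈ → Sum.[ p⊆p∪q ⁅ w ⁆ ∘ target g ∘ there , (λ { (_ , refl) → q⊆p∪q A ⁅ w ⁆ (x∈⁅x⁆ w) }) ]
                          (proj₁ (∈-accepted⁻ {L = L} {F} e∈))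
      ; queued = queued′
      ; stored = λ s∈ s∉ u∈ u∉ e → ∈-dropSource⁺
                   (stored g s∈ (s∉ ∘ p⊆p∪q ⁅ w ⁆) u∈ (u∉ ∘ p⊆p∪q ⁅ w ⁆) e) (≢w s∉)
      ; closed = closed′
      ; v-root = trans (same λ { refl → w∉A (v∈A g) }) (v-root g)
      ; open-root = λ s∈ s∉ → trans (same (≢w s∉)) (open-root g s∈ (s∉ ∘ p⊆p∪q ⁅ w ⁆))
      ; no-root = λ {x} eq → no-root′ (x ≟ w) eq
      }
      where
      w∉A : w ∉ A
      w∉A = fresh g (L⊆F g (here refl))
      not-in : ∀ {x} → x ∉ A → x ≢ w → x ∉ A ∪ ⁅ w ⁆
      not-in x∉A x≢w x∈ = Sum.[ x∉A , x≢w ∘ x∈⁅y⁆⇒x≡y w ] (x∈p∪q⁻ A ⁅ w ⁆ x∈)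
      ≢w : ∀ {x} → x ∉ A ∪ ⁅ w ⁆ → x ≢ w
      ≢w x∉ refl = x∉ (q⊆p∪q A ⁅ w ⁆ (x∈⁅x⁆ w))
      queued′ : ∀ {s u} → s ∈ S → s ∉ A ∪ ⁅ w ⁆ → u ∈ S → u ∈ A ∪ ⁅ w ⁆ → _⟶_ G s u →
                (s , u) List.∈ dropSource w L ++ targeting w (dropSource w F)
      queued′ {s} {u} s∈ s∉ u∈ u∈A e with u ∈? A
      ... | yes u∈A with queued g s∈ (s∉ ∘ p⊆p∪q ⁅ w ⁆) u∈ u∈A e
      ...   | here refl = contradiction refl (≢w s∉)
      ...   | there e∈L = ∈-++⁺ˡ (∈-dropSource⁺ e∈L (≢w s∉))
      queued′ {s} {u} s∈ s∉ u∈ u∈A e | no u∉A = ∈-++⁺ʳ (dropSource w L)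
        (∈-targeting⁺ (∈-dropSource⁺ (stored g s∈ (s∉ ∘ p⊆p∪q ⁅ w ⁆) u∈ u∉A e) (≢w s∉))
          (Sum.[ (λ u∈A → contradiction u∈A u∉A) , x∈⁅y⁆⇒x≡y w ] (x∈p∪q⁻ A ⁅ w ⁆ u∈A)))
      closed′ : ∀ {x y} → x ∈ A ∪ ⁅ w ⁆ → Joins T′ x y → y ∈ A ∪ ⁅ w ⁆
      closed′ {x} {y} x∈ j with x ≟ w
      ... | yes refl = p⊆p∪q ⁅ w ⁆ (to-A j)
      ... | no x≢w   = p⊆p∪q ⁅ w ⁆ (closed g
        (Sum.[ id , (λ x∈w → contradiction (x∈⁅y⁆⇒x≡y w x∈w) x≢w) ] (x∈p∪q⁻ A ⁅ w ⁆ x∈))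
        (subst (y ∈_) (same x≢w) j))
      no-root′ : ∀ {x} → Dec (x ≡ w) → lookup T′ x ≡ ⊥ → x ≡ v ⊎ (x ∈ S × x ∉ A ∪ ⁅ w ⁆)
      no-root′ (yes refl) eq = contradiction eq non-root
      no-root′ (no x≢w)   eq = Sum.map₂ (λ (x∈S , x∉A) → x∈S , not-in x∉A x≢w)
                                 (no-root g (trans (sym (same x≢w)) eq))

    -- Erasing a vertex outside `S` cannot remove an edge between two vertices of `S`, and `queued`
    -- and `stored` speak of such edges only.
    reject : ∀ {k A w u L F T} → Growing (suc k) A ((w , u) ∷ L) F T → w ∉ S →
             Growing k A (dropIncident w L) (dropIncident w F) T
    reject {k} {A} {w} {u} {L} {F} g w∉S = record
      { forest = forest g
      ; v∈A    = v∈A g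
      ; fuel   = ℕ.≤-pred (ℕ.≤-trans (length-dropIncident (L⊆F g (here refl))) (fuel g))
      ; L⊆F    = λ e∈ → let e∈L , p = ∈-filter⁻ incident? {xs = L} e∈ in ∈-filter⁺ incident? (L⊆F g (there e∈L)) p
      ; fresh  = fresh g ∘ proj₁ ∘ ∈-dropIncident⁻ {L = F}
      ; edge   = edge g ∘ proj₁ ∘ ∈-dropIncident⁻ {L = F}
      ; target = target g ∘ there ∘ proj₁ ∘ ∈-dropIncident⁻ {L = L}
      ; queued = queued′
      ; stored = λ s∈ s∉ u∈ u∉ e → ∈-dropIncident⁺ (stored g s∈ s∉ u∈ u∉ e) (≢w s∈) (≢w u∈)
      ; closed = closed g
      ; v-root = v-root g
      ; open-root = open-root g
      ; no-root = no-root g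
      }
      where
      incident? : (e : Edge n) → Dec (proj₁ e ≢ w × proj₂ e ≢ w)
      incident? (u , v) = ¬? (u ≟ w) ×-dec ¬? (v ≟ w)
      ≢w : ∀ {x} → x ∈ S → x ≢ w
      ≢w x∈S refl = w∉S x∈S
      queued′ : ∀ {s u} → s ∈ S → s ∉ A → u ∈ S → u ∈ A → _⟶_ G s u → (s , u) List.∈ dropIncident w L
      queued′ s∈ s∉ u∈ u∈A e with queued g s∈ s∉ u∈ u∈A e
      ... | here refl = contradiction refl (≢w s∈)
      ... | there e∈L = ∈-dropIncident⁺ e∈L (≢w s∈) (≢w u∈)

    -- An edge of `S` from outside `A` into `A` would still be queued. With an empty queue,
    -- membership in `A` thus spreads backwards from `v` along paths inside `S`.
    exhausted : ∀ {k A F T} → Growing k A [] F T → S ⊆ A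
    exhausted {A = A} g {s} s∈S = go (proj₂ sc s v s∈S v∈S)
      where
      go : ∀ {s} → Star (Induced G S) s v → s ∈ A
      go ε = v∈A g
      go {s} ((s∈ , u∈ , e) ◅ path) with s ∈? A
      ... | yes s∈A = s∈A
      ... | no s∉A with () ← queued g s∈ s∉A u∈ (go path) e

    -- `covers` runs the loop on the finished `tree`, which is known only after the recursion.
    -- `same` ensures that this run repeats the decisions taken along the way: the rows outside `S`
    -- and at accepted vertices are final.
    record Grown (k : ℕ) (A : Subset n) (L F : List (Edge n)) (T : EdgeSet n) : Set where
      field
        tree   : EdgeSet n
        same   : ∀ {x} → x ∉ S ⊎ x ∈ A → lookup tree x ≡ lookup T x
        forest : IsForest tree
        root   : lookup tree v ≡ ⊥
        only-root : ∀ {x} → lookup tree x ≡ ⊥ → x ≡ v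
        covers : S ⊆ loop tree k A L F

    -- No cycle arises: `u` lies in `A`, which is closed under the edges of `T`, whereas `w` does
    -- not.
    attach : ∀ {k A w u L F T} → Growing (suc k) A ((w , u) ∷ L) F T → w ∈ S → IsForest (T [ w ]≔ ⁅ u ⁆)
    attach {A = A} {w} {u} {T = T} g w∈S = mkIsForest
      (λ a b j → Sum.[ IsForest.subgraph (forest g) a b , (λ { (refl , refl) → edge g e∈F }) ] (new a b j))
      (acyclic-add (T [ w ]≔ ⁅ u ⁆) T new (IsForest.acyclic (forest g)) (w∉A ∘ inside (target g (here refl))))
      out′
      where
      e∈F = L⊆F g (here refl)
      w∉A = fresh g e∈F
      new : ∀ a b → Joins (T [ w ]≔ ⁅ u ⁆) a b → Joins T a b ⊎ (a ≡ w × b ≡ u)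
      new a b j with a ≟ w
      ... | yes refl = inj₂ (refl , x∈⁅y⁆⇒x≡y u (subst (b ∈_) (Vec.lookup∘updateAt w T) j))
      ... | no a≢w   = inj₁ (subst (b ∈_) (Vec.lookup∘updateAt′ a w a≢w T) j)
      inside : ∀ {x y} → x ∈ A → Star (Joins T) x y → y ∈ A
      inside x∈A ε       = x∈A
      inside x∈A (j ◅ p) = inside (closed g x∈A j) p
      out′ : ∀ x → ∣ lookup (T [ w ]≔ ⁅ u ⁆) x ∣ ≤ 1
      out′ x with x ≟ w
      ... | yes refl = subst (λ p → ∣ p ∣ ≤ 1) (sym (Vec.lookup∘updateAt w T)) (ℕ.≤-reflexive (∣⁅x⁆∣≡1 u))
      ... | no x≢w   = subst (λ p → ∣ p ∣ ≤ 1) (sym (Vec.lookup∘updateAt′ x w x≢w T)) (IsForest.out (forest g) x)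

    grow : ∀ k A L F T → Growing k A L F T → Grown k A L F T
    grow k A [] F T g = record
      { tree = T
      ; same = λ _ → refl
      ; forest = forest g
      ; root = v-root g
      ; only-root = λ eq → Sum.[ id , (λ (x∈S , x∉A) → contradiction (exhausted g x∈S) x∉A) ] (no-root g eq)
      ; covers = loop-⊇ T k ∘ exhausted g
      }
    -- A nonempty queue without fuel is impossible, since its first edge lies in `F` and `F` would
    -- have length 0.
    grow zero A (e ∷ L) F T g with F | fuel g | L⊆F g (here refl)
    ... | [] | _ | ()
    grow (suc k) A ((w , u) ∷ L) F T g = go (w ∈? S) (joins? T w u)
      where
      w∉A = fresh g (L⊆F g (here refl))
      go : Dec (w ∈ S) → Dec (Joins T w u) → Grown (suc k) A ((w , u) ∷ L) F T
      go (yes w∈S) _ = record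
        { tree = tree ih
        ; same = λ { {x} (inj₁ x∉S) → trans (same ih (inj₁ x∉S)) (T-same λ { refl → x∉S w∈S })
                   ; {x} (inj₂ x∈A) → trans (same ih (inj₂ (p⊆p∪q ⁅ w ⁆ x∈A))) (T-same λ { refl → w∉A x∈A }) }
        ; forest = Grown.forest ih
        ; root = root ih
        ; only-root = only-root ih
        ; covers = subst (S ⊆_) (sym (loop-accept (tree ih) k A L F j)) (covers ih)
        }
        where
        open Grown
        T-new : lookup (T [ w ]≔ ⁅ u ⁆) w ≡ ⁅ u ⁆
        T-new = Vec.lookup∘updateAt w T
        T-same : ∀ {x} → x ≢ w → lookup (T [ w ]≔ ⁅ u ⁆) x ≡ lookup T x
        T-same x≢w = Vec.lookup∘updateAt′ _ w x≢w T
        ih = grow k _ _ _ (T [ w ]≔ ⁅ u ⁆) (accept g (attach g w∈S) T-same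
          (λ {y} j → subst (_∈ A) (sym (x∈⁅y⁆⇒x≡y u (subst (y ∈_) T-new j))) (target g (here refl)))
          (λ eq → ⁅x⁆≢⊥ (trans (sym T-new) eq)))
        j : Joins (tree ih) w u
        j = subst (u ∈_) (sym (trans (same ih (inj₂ (q⊆p∪q A ⁅ w ⁆ (x∈⁅x⁆ w)))) T-new)) (x∈⁅x⁆ u)
      go (no w∉S) (yes j) = record
        { tree = tree ih
        ; same = Sum.[ same ih ∘ inj₁ , same ih ∘ inj₂ ∘ p⊆p∪q ⁅ w ⁆ ]
        ; forest = Grown.forest ih
        ; root = root ih
        ; only-root = only-root ih
        ; covers = subst (S ⊆_) (sym (loop-accept (tree ih) k A L F (subst (u ∈_) (sym (same ih (inj₁ w∉S))) j))) (covers ih)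
        }
        where
        open Grown
        row : lookup T w ≡ ⁅ u ⁆
        row = ∣p∣≤1⇒p≡⁅x⁆ (IsForest.out (forest g) w) j
        ih = grow k _ _ _ T (accept g (forest g) (λ _ → refl)
          (λ {y} j → subst (_∈ A) (sym (x∈⁅y⁆⇒x≡y u (subst (y ∈_) row j))) (target g (here refl)))
          (λ eq → ⁅x⁆≢⊥ (trans (sym row) eq)))
      go (no w∉S) (no ¬j) = record
        { tree = tree ih
        ; same = same ih
        ; forest = Grown.forest ih
        ; root = root ih
        ; only-root = only-root ih
        ; covers = subst (S ⊆_) (sym (loop-reject (tree ih) k A L F (¬j ∘ subst (u ∈_) (same ih (inj₁ w∉S))))) (covers ih)
        }
        where
        open Grown
        ih = grow k _ _ _ T (reject g w∉S)

    φ-grown : ∀ {T} → IsForest T → roots T ≡ S →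
              Grown (length (edges G)) ⁅ v ⁆ (targeting v (edges G)) (dropSource v (edges G)) T
    φ-grown {T} forest refl = grow _ _ _ _ T record
      { forest = forest
      ; v∈A    = x∈⁅x⁆ v
      ; fuel   = length-filter (λ (u , _) → ¬? (u ≟ v)) (edges G)
      ; L⊆F    = λ { {x , y} e∈ → let e∈E , y≡v = ∈-targeting⁻ {L = edges G} e∈ in
                     ∈-dropSource⁺ e∈E λ { refl → loopless x (subst (_⟶_ G x) y≡v (∈-edges⁻ e∈E)) } }
      ; fresh  = λ e∈ x∈ → proj₂ (∈-dropSource⁻ {L = edges G} e∈) (x∈⁅y⁆⇒x≡y v x∈)
      ; edge   = ∈-edges⁻ ∘ proj₁ ∘ ∈-dropSource⁻ {L = edges G}
      ; target = λ e∈ → subst (_∈ ⁅ v ⁆) (sym (proj₂ (∈-targeting⁻ {L = edges G} e∈))) (x∈⁅x⁆ v)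
      ; queued = λ _ _ _ u∈ e → ∈-targeting⁺ (∈-edges⁺ e) (x∈⁅y⁆⇒x≡y v u∈)
      ; stored = λ { _ s∉ _ _ e → ∈-dropSource⁺ (∈-edges⁺ e) λ { refl → s∉ (x∈⁅x⁆ v) } }
      ; closed = λ {_} {y} x∈ j → contradiction
                   (subst (y ∈_) (∈-roots⁻ T v∈S) (subst (λ x → Joins T x y) (x∈⁅y⁆⇒x≡y v x∈) j)) ∉⊥
      ; v-root = ∈-roots⁻ T v∈S
      ; open-root = λ s∈S _ → ∈-roots⁻ T s∈S
      ; no-root = λ {x} eq → no-root′ (x ≟ v) (∈-roots⁺ T eq)
      }
      where
      no-root′ : ∀ {x} → Dec (x ≡ v) → x ∈ roots T → x ≡ v ⊎ (x ∈ roots T × x ∉ ⁅ v ⁆)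
      no-root′ (yes x≡v) _  = inj₁ x≡v
      no-root′ (no x≢v)  x∈ = inj₂ (x∈ , x≢v ∘ x∈⁅y⁆⇒x≡y v)

-- Multiplicities

open ListFold ℕ.+-0-commutativeMonoid using ()
  renaming (⨁ to ∑ℕ; ⨁-cong to ∑ℕ-cong; ⨁-unit to ∑ℕ-0; ⨁-∙ to ∑ℕ-+; ⨁-comm to ∑ℕ-comm;
            ⨁-remove to ∑ℕ-remove; ⨁-single to ∑ℕ-single)

⟦_⟧ : ∀ {a} {A : Set a} → Dec A → ℕ
⟦ d ⟧ = if does d then 1 else 0

⟦⟧-yes : ∀ {a} {A : Set a} (d : Dec A) → A → ⟦ d ⟧ ≡ 1
⟦⟧-yes d a = cong (if_then 1 else 0) (dec-true d a)

⟦⟧-no : ∀ {a} {A : Set a} (d : Dec A) → ¬ A → ⟦ d ⟧ ≡ 0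
⟦⟧-no d ¬a = cong (if_then 1 else 0) (dec-false d ¬a)

⟦⟧-⇔ : ∀ {a b} {A : Set a} {B : Set b} (d : Dec A) (e : Dec B) → (A → B) → (B → A) → ⟦ d ⟧ ≡ ⟦ e ⟧
⟦⟧-⇔ d (yes b) to from = ⟦⟧-yes d (from b)
⟦⟧-⇔ d (no ¬b) to from = ⟦⟧-no d (¬b ∘ to)

length-filter-∑ : ∀ {a p} {A : Set a} {P : U.Pred A p} (P? : U.Decidable P) xs →
                  length (filter P? xs) ≡ ∑ℕ xs (λ x → ⟦ P? x ⟧)
length-filter-∑ P? []       = refl
length-filter-∑ P? (x ∷ xs) with does (P? x)
... | true  = cong suc (length-filter-∑ P? xs)
... | false = length-filter-∑ P? xs

unique-map : ∀ {a b} {A : Set a} {B : Set b} {f : A → B} {xs} →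
             (∀ {x y} → x List.∈ xs → y List.∈ xs → f x ≡ f y → x ≡ y) →
             Unique xs → Unique (List.map f xs)
unique-map inj []             = []
unique-map inj (x∉ ∷ uniq) =
  All.map⁺ (All.tabulate λ y∈ eq → All.lookup x∉ y∈ (inj (here refl) (there y∈) eq)) ∷
  unique-map (λ x∈ y∈ → inj (there x∈) (there y∈)) uniq

lookup-ext : ∀ {a} {A : Set a} {k} {s t : Vec A k} → (∀ i → lookup s i ≡ lookup t i) → s ≡ t
lookup-ext {s = s} {t} eq = trans (sym (Vec.tabulate∘lookup s))
  (trans (Vec.tabulate-cong eq) (Vec.tabulate∘lookup t))

module Multiplicities (G : Digraph n) where

  open Forests G
  open Exploration G
  open Digraph G

  stronglyConnecteds : List (Subset n)
  stronglyConnecteds = filter (stronglyConnected? G) (subsets n)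

  stronglyConnecteds-unique : Unique stronglyConnecteds
  stronglyConnecteds-unique = Unique.filter⁺ (stronglyConnected? G) (subsets-unique n)

  ∈-stronglyConnecteds⁺ : ∀ {W} → StronglyConnected G W → W List.∈ stronglyConnecteds
  ∈-stronglyConnecteds⁺ = ∈-filter⁺ (stronglyConnected? G) (∈-subsets _)

  ∈-stronglyConnecteds⁻ : ∀ {W} → W List.∈ stronglyConnecteds → StronglyConnected G W
  ∈-stronglyConnecteds⁻ = proj₂ ∘ ∈-filter⁻ (stronglyConnected? G) {xs = subsets n}

  -- The zeta transform on the poset of strongly connected sets, summed upwards.
  ζ : (Subset n → ℕ) → Subset n → ℕ
  ζ m S = ∑ℕ stronglyConnecteds (λ W → if does (S ⊆? W) then m W else 0)

  -- Möbius inversion as a downward induction: the terms of the larger sets agree and are cancelled.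
  -- The hypothesis is confined to supersets of `S` because the transform of the multiplicities at a
  -- vertex is known only on sets containing that vertex.
  ζ-injective : ∀ f g S → StronglyConnected G S →
                (∀ W → StronglyConnected G W → S ⊆ W → ζ f W ≡ ζ g W) → f S ≡ g S
  ζ-injective f g S = go S (⊃-wellFounded S)
    where
    go : ∀ S → Acc _⊃_ S → StronglyConnected G S →
         (∀ W → StronglyConnected G W → S ⊆ W → ζ f W ≡ ζ g W) → f S ≡ g S
    go S (acc larger) sc eq = ℕ.+-cancelʳ-≡ (rest f) (f S) (g S) (begin
      f S ℕ.+ rest f ≡⟨ peel f ⟨
      ζ f S        ≡⟨ eq S sc id ⟩
      ζ g S        ≡⟨ peel g ⟩
      g S ℕ.+ rest g ≡⟨ cong (g S ℕ.+_) (∑ℕ-cong stronglyConnecteds same) ⟨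
      g S ℕ.+ rest f ∎)
      where
      open ≡-Reasoning
      term rest′ : (Subset n → ℕ) → Subset n → ℕ
      term h W = if does (S ⊆? W) then h W else 0
      rest′ h W = if does (W ≟ˢ S) then 0 else term h W
      rest : (Subset n → ℕ) → ℕ
      rest h = ∑ℕ stronglyConnecteds (rest′ h)
      peel : ∀ h → ζ h S ≡ h S ℕ.+ rest h
      peel h = trans (∑ℕ-remove _≟ˢ_ (term h) stronglyConnecteds-unique (∈-stronglyConnecteds⁺ sc))
        (cong (λ b → (if b then h S else 0) ℕ.+ rest h) (dec-true (S ⊆? S) id))
      same : ∀ {W} → W List.∈ stronglyConnecteds → rest′ f W ≡ rest′ g W
      same {W} W∈ with W ≟ˢ S
      ... | yes _ = refl
      ... | no W≢S with S ⊆? W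
      ...   | no _    = refl
      ...   | yes S⊆W = go W (larger S⊂W) (∈-stronglyConnecteds⁻ W∈)
                          (λ V scV W⊆V → eq V scV (λ x∈ → W⊆V (S⊆W x∈)))
        where
        S⊂W : S ⊂ W
        S⊂W with S ⊂? W
        ... | yes p = p
        ... | no ¬p = contradiction (⊆-antisym (λ {x} x∈W → inside x x∈W) S⊆W) W≢S
          where
          inside : ∀ x → x ∈ W → x ∈ S
          inside x x∈W with x ∈? S
          ... | yes x∈S = x∈S
          ... | no x∉S  = ⊥-elim (¬p ((λ {y} → S⊆W {y}) , x , x∈W , x∉S))

  forestOn? : ∀ S → U.Decidable (λ T → IsForest T × roots T ≡ S)
  forestOn? S T = isForest? T ×-dec roots T ≟ˢ S

  forestCount : Subset n → ℕ
  forestCount S = length (filter (forestOn? S) (edgeSets n))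

  spanningTree⁻ : ∀ {v T} → IsSpanningTree G v T →
                  IsForest T × lookup T v ≡ ⊥ × (∀ {x} → lookup T x ≡ ⊥ → x ≡ v)
  spanningTree⁻ {v} {T} t = mkIsForest subgraph acyclic out , ∣p∣≡0⇒p≡⊥ _ root-out , only-root
    where
    open IsSpanningTree t
    out : ∀ x → ∣ lookup T x ∣ ≤ 1
    out x with x ≟ v
    ... | yes refl = subst (_≤ 1) (sym root-out) z≤n
    ... | no x≢v   = ℕ.≤-reflexive (others-out x x≢v)
    only-root : ∀ {x} → lookup T x ≡ ⊥ → x ≡ v
    only-root {x} eq with x ≟ v
    ... | yes x≡v = x≡v
    ... | no x≢v with () ← trans (sym (others-out x x≢v)) (trans (cong ∣_∣ eq) (∣⊥∣≡0 n))

  spanningTree⁺ : ∀ {v T} → IsForest T → lookup T v ≡ ⊥ → (∀ {x} → lookup T x ≡ ⊥ → x ≡ v) →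
                  IsSpanningTree G v T
  spanningTree⁺ {v} {T} forest root only-root = mkIsSpanningTree
    (IsForest.subgraph forest) (IsForest.acyclic forest) (trans (cong ∣_∣ root) (∣⊥∣≡0 n)) others
    where
    others : ∀ x → x ≢ v → ∣ lookup T x ∣ ≡ 1
    others x x≢v with ∣ lookup T x ∣ in eq | IsForest.out forest x
    ... | zero        | _       = contradiction (only-root (∣p∣≡0⇒p≡⊥ _ eq)) x≢v
    ... | suc zero    | _       = refl
    ... | suc (suc _) | s≤s ()

  trees-⊥ : trees ⊥ ≡ spanningTrees G
  trees-⊥ = filter-≐ (isTree? ⊥) (λ (r , T) → isSpanningTree? G r T) (to , from) (rootedEdgeSets n)
    where
    to : ∀ {a} → IsTree ⊥ a → IsSpanningTree G (proj₁ a) (proj₂ a)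
    to {v , T} (forest , v∈ , eq) = spanningTree⁺ forest (∈-roots⁻ T v∈) only
      where
      only : ∀ {x} → lookup T x ≡ ⊥ → x ≡ v
      only {x} row with x ≟ v
      ... | yes x≡v = x≡v
      ... | no x≢v  = contradiction (subst (x ∈_) eq (x∈p∧x≢y⇒x∈p-y (∈-roots⁺ T row) x≢v)) ∉⊥
    from : ∀ {a} → IsSpanningTree G (proj₁ a) (proj₂ a) → IsTree ⊥ a
    from {v , T} t with forest , root , only ← spanningTree⁻ t =
      forest , ∈-roots⁺ T root , Empty-unique (λ (x , x∈) → none x∈ (only (∈-roots⁻ T (p─q⊆p (roots T) ⁅ v ⁆ x∈))))
      where
      none : ∀ {x} → x ∈ roots T ─ ⁅ v ⁆ → x ≢ v
      none x∈ refl = x∈p─q⇒x∉q (roots T) ⁅ v ⁆ x∈ (x∈⁅x⁆ v)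

  module _ (W : Subset n) (v : Fin n) where

    open Reachability (induced? G W)

    private
      inComponent? : ∀ w → Dec (InComponent G W v w)
      inComponent? w = w ∈? W ×-dec star? v w ×-dec star? w v

    ∈-component⁺ : ∀ {w} → InComponent G W v w → w ∈ component G W v
    ∈-component⁺ = ∈-comprehension⁺ inComponent?

    ∈-component⁻ : ∀ {w} → w ∈ component G W v → InComponent G W v w
    ∈-component⁻ = ∈-comprehension⁻ inComponent?

    -- Every vertex on a path between two vertices of the component is reachable from `v` and
    -- reaches `v`, so the path stays in the component.
    component-connected : v ∈ W → StronglyConnected G (component G W v)
    component-connected v∈W = (v , ∈-component⁺ (v∈W , ε , ε)) , λ u w u∈ w∈ →
      let (_ , _ , u→v) = ∈-component⁻ u∈ ; (_ , v→w , _) = ∈-component⁻ w∈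
      in restrict u∈ w∈ (u→v ◅◅ v→w)
      where
      restrict : ∀ {u w} → u ∈ component G W v → w ∈ component G W v →
                 Star (Induced G W) u w → Star (Induced G (component G W v)) u w
      restrict u∈ w∈ ε = ε
      restrict u∈ w∈ (e@(_ , x∈W , u→x) ◅ p) = (u∈ , x∈ , u→x) ◅ restrict x∈ w∈ p
        where
        x∈ = ∈-component⁺ (x∈W , proj₁ (proj₂ (∈-component⁻ u∈)) ◅◅ (e ◅ ε) ,
                                 p ◅◅ proj₂ (proj₂ (∈-component⁻ w∈)))

  v∈φ : ∀ v T → v ∈ φ G (v , T)
  v∈φ v T = loop-⊇ T (length (edges G)) {L = targeting v (edges G)} {dropSource v (edges G)} (x∈⁅x⁆ v)

  ψ-connected : ∀ a → StronglyConnected G (ψ G a)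
  ψ-connected (v , T) = component-connected (φ G (v , T)) v (v∈φ v T)

  ψ⊆φ : ∀ a → ψ G a ⊆ φ G a
  ψ⊆φ a = proj₁ ∘ ∈-component⁻ (φ G a) (proj₁ a)

  module _ {S : Subset n} (sc : StronglyConnected G S) {v : Fin n} (v∈S : v ∈ S) where

    S⊆ψ : ∀ {T} → S ⊆ φ G (v , T) → S ⊆ ψ G (v , T)
    S⊆ψ {T} S⊆φ {w} w∈S = ∈-component⁺ (φ G (v , T)) v
      (S⊆φ w∈S , Star.map enlarge (proj₂ sc v w v∈S w∈S) , Star.map enlarge (proj₂ sc w v w∈S v∈S))
      where
      enlarge : ∀ {a b} → Induced G S a b → Induced G (φ G (v , T)) a b
      enlarge (a∈ , b∈ , e) = S⊆φ a∈ , S⊆φ b∈ , e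

    covering? : U.Decidable (λ a → proj₁ a ≡ v × S ⊆ ψ G a)
    covering? a = proj₁ a ≟ v ×-dec S ⊆? ψ G a

    private
      covering : List (Rooted n)
      covering = filter covering? (spanningTrees G)

      ∈-covering⁻ : ∀ {a} → a List.∈ covering → IsSpanningTree G (proj₁ a) (proj₂ a) × proj₁ a ≡ v × S ⊆ ψ G a
      ∈-covering⁻ a∈ with a∈trees , root , S⊆ ← ∈-filter⁻ covering? {xs = spanningTrees G} a∈ =
        proj₂ (∈-filter⁻ (λ (r , T) → isSpanningTree? G r T) {xs = rootedEdgeSets n} a∈trees) , root , S⊆

      ∈-covering⁺ : ∀ {T} → IsSpanningTree G v T → S ⊆ ψ G (v , T) → (v , T) List.∈ covering
      ∈-covering⁺ {T} t S⊆ = ∈-filter⁺ covering?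
        (∈-filter⁺ (λ (r , T) → isSpanningTree? G r T) (∈-rootedEdgeSets (v , T)) t) (refl , S⊆)

      cut : EdgeSet n → EdgeSet n
      cut T = tabulate λ w → if does (w ∈? S) then ⊥ else lookup T w

      cut-in : ∀ T {w} → w ∈ S → lookup (cut T) w ≡ ⊥
      cut-in T {w} w∈S = trans (Vec.lookup∘tabulate _ w) (cong (if_then ⊥ else lookup T w) (dec-true (w ∈? S) w∈S))

      cut-out : ∀ T {w} → w ∉ S → lookup (cut T) w ≡ lookup T w
      cut-out T {w} w∉S = trans (Vec.lookup∘tabulate _ w) (cong (if_then ⊥ else lookup T w) (dec-false (w ∈? S) w∉S))

      cut-below : ∀ T → Below ⊥ (cut T) T
      cut-below T w with w ∈? S
      ... | yes w∈S = inj₁ (cut-in T w∈S)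
      ... | no w∉S  = inj₂ (cut-out T w∉S)

      h : Rooted n → EdgeSet n
      h a = cut (proj₂ a)

      h-injective : ∀ {a b} → a List.∈ covering → b List.∈ covering → h a ≡ h b → a ≡ b
      h-injective {_ , T₁} {_ , T₂} a∈ b∈ eq with ∈-covering⁻ a∈ | ∈-covering⁻ b∈
      ... | t₁ , refl , S⊆₁ | t₂ , refl , S⊆₂ = cong (v ,_) (lookup-ext (replay
        (IsForest.out (proj₁ (spanningTree⁻ t₁))) (IsForest.out (proj₁ f₂))
        (length (edges G)) ⁅ v ⁆ (targeting v (edges G)) (dropSource v (edges G))
        (λ { {x} (inj₁ x∉S) → trans (sym (cut-out T₁ x∉S)) (trans (cong (λ T → lookup T x) eq) (cut-out T₂ x∉S))
           ; {x} (inj₂ x∈v) → subst (λ x → lookup T₁ x ≡ lookup T₂ x) (sym (x∈⁅y⁆⇒x≡y v x∈v))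
               (trans (proj₁ (proj₂ (spanningTree⁻ t₁))) (sym (proj₁ (proj₂ f₂)))) })
        fresh (λ x∈ → ψ⊆φ (v , T₁) (S⊆₁ x∈)) (λ x∈ → ψ⊆φ (v , T₂) (S⊆₂ x∈))))
        where
        f₂ = spanningTree⁻ t₂
        fresh : ∀ {x y} → (x , y) List.∈ targeting v (edges G) ⊎ (x , y) List.∈ dropSource v (edges G) → x ∉ ⁅ v ⁆
        fresh {x} (inj₁ e∈) x∈v with e∈E , refl ← ∈-targeting⁻ {L = edges G} e∈ =
          loopless v (subst (λ z → _⟶_ G z v) (x∈⁅y⁆⇒x≡y v x∈v) (∈-edges⁻ e∈E))
        fresh (inj₂ e∈) x∈v = proj₂ (∈-dropSource⁻ {L = edges G} e∈) (x∈⁅y⁆⇒x≡y v x∈v)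

      to : ∀ {T} → T List.∈ List.map h covering → T List.∈ filter (forestOn? S) (edgeSets n)
      to T∈ with (_ , T) , a∈ , refl ← ∈-map⁻ h T∈
               with t , refl , _ ← ∈-covering⁻ a∈
               with forest , _ , only ← spanningTree⁻ t =
        ∈-filter⁺ (forestOn? S) (∈-edgeSets (cut T)) (below-forest (cut T) T (cut-below T) forest ,
          ⊆-antisym roots⊆S (λ w∈S → ∈-roots⁺ (cut T) (cut-in T w∈S)))
        where
        roots⊆S : roots (cut T) ⊆ S
        roots⊆S {w} w∈ with w ∈? S
        ... | yes w∈S = w∈S
        -- A vertex outside `S` keeps its row, so an empty row makes it the root `v` of the tree,
        -- which lies in `S`.
        ... | no w∉S  = subst (_∈ S) (sym (only (trans (sym (cut-out T w∉S)) (∈-roots⁻ (cut T) w∈)))) v∈S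

      from : ∀ {T} → T List.∈ filter (forestOn? S) (edgeSets n) → T List.∈ List.map h covering
      from {T} T∈ with _ , forest , eq ← ∈-filter⁻ (forestOn? S) {xs = edgeSets n} T∈ =
        subst (List._∈ List.map h covering) (lookup-ext rows)
          (∈-map⁺ h (∈-covering⁺ (spanningTree⁺ (G⁺.forest) G⁺.root G⁺.only-root) (S⊆ψ G⁺.covers)))
        where
        module G⁺ = Grown (φ-grown sc v∈S forest eq)
        rows : ∀ w → lookup (cut G⁺.tree) w ≡ lookup T w
        rows w with w ∈? S
        ... | yes w∈S = trans (cut-in G⁺.tree w∈S) (sym (∈-roots⁻ T (subst (w ∈_) (sym eq) w∈S)))
        ... | no w∉S  = trans (cut-out G⁺.tree w∉S) (G⁺.same (inj₁ w∉S))

    -- `cut` is injective by `replay` and surjective by `φ-grown`.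
    covering-count : length covering ≡ forestCount S
    covering-count = trans (sym (length-map h covering)) (↭-length (unique∧set⇒↭
      (unique-map h-injective (Unique.filter⁺ covering?
        (Unique.filter⁺ (λ (r , T) → isSpanningTree? G r T) (rootedEdgeSets-unique n))))
      (Unique.filter⁺ (forestOn? S) (edgeSets-unique n)) to from))

    -- After exchanging the sums, each tree rooted at `v` contributes for the single set `ψ G a`,
    -- which is strongly connected and so occurs in the sum; the contribution survives exactly when
    -- `S ⊆ ψ G a`.
    ζ-multiplicity : ζ (λ W → multiplicity G W v) S ≡ forestCount S
    ζ-multiplicity = begin
      ∑ℕ stronglyConnecteds (λ W → if does (S ⊆? W) then multiplicity G W v else 0)
        ≡⟨ ∑ℕ-cong stronglyConnecteds (λ {W} _ → expand W (S ⊆? W)) ⟩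
      ∑ℕ stronglyConnecteds (λ W → ∑ℕ (spanningTrees G) (λ a → ⟦ term? W a ⟧))
        ≡⟨ ∑ℕ-comm stronglyConnecteds (spanningTrees G) _ ⟩
      ∑ℕ (spanningTrees G) (λ a → ∑ℕ stronglyConnecteds (λ W → ⟦ term? W a ⟧))
        ≡⟨ ∑ℕ-cong (spanningTrees G) (λ {a} _ → trans
             (∑ℕ-single stronglyConnecteds-unique (∈-stronglyConnecteds⁺ (ψ-connected a))
               (λ {W} _ W≢ → ⟦⟧-no (term? W a) (λ (_ , _ , eq) → W≢ (sym eq))))
             (⟦⟧-⇔ (term? (ψ G a) a) (covering? a) (λ (S⊆ , root , _) → root , λ {x} → S⊆ {x})
                                                   (λ (root , S⊆) → (λ {x} → S⊆ {x}) , root , refl))) ⟩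
      ∑ℕ (spanningTrees G) (λ a → ⟦ covering? a ⟧) ≡⟨ length-filter-∑ covering? (spanningTrees G) ⟨
      length covering ≡⟨ covering-count ⟩
      forestCount S ∎
      where
      open ≡-Reasoning
      has? : ∀ W a → Dec (proj₁ a ≡ v × ψ G a ≡ W)
      has? W a = proj₁ a ≟ v ×-dec ψ G a ≟ˢ W
      term? : ∀ W a → Dec (S ⊆ W × proj₁ a ≡ v × ψ G a ≡ W)
      term? W a = S ⊆? W ×-dec has? W a
      expand : ∀ W (d : Dec (S ⊆ W)) → (if does d then multiplicity G W v else 0) ≡
               ∑ℕ (spanningTrees G) (λ a → ⟦ d ×-dec has? W a ⟧)
      expand W (yes _) = length-filter-∑ (has? W) (spanningTrees G)
      expand W (no _)  = sym (∑ℕ-0 (spanningTrees G) λ _ → refl)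

  -- The value 0 is a default for the empty set, which is not strongly connected.
  multiplicityOf : Subset n → ℕ
  multiplicityOf W with nonempty? W
  ... | yes (w , _) = multiplicity G W w
  ... | no _        = 0

  multiplicity-const : ∀ W → StronglyConnected G W → ∀ w → w ∈ W → multiplicity G W w ≡ multiplicityOf W
  multiplicity-const W sc w w∈ with nonempty? W
  ... | no empty = contradiction (w , w∈) empty
  ... | yes (u , u∈) = ζ-injective (λ W → multiplicity G W w) (λ W → multiplicity G W u) W sc
    λ V scV W⊆V → trans (ζ-multiplicity scV (W⊆V w∈)) (sym (ζ-multiplicity scV (W⊆V u∈)))

  ζ-multiplicityOf : ∀ {S} → StronglyConnected G S → ζ multiplicityOf S ≡ forestCount S
  ζ-multiplicityOf {S} sc@((v , v∈S) , _) = trans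
    (∑ℕ-cong stronglyConnecteds λ {W} W∈ → same W (∈-stronglyConnecteds⁻ W∈) (S ⊆? W))
    (ζ-multiplicity sc v∈S)
    where
    same : ∀ W → StronglyConnected G W → (d : Dec (S ⊆ W)) →
           (if does d then multiplicityOf W else 0) ≡ (if does d then multiplicity G W v else 0)
    same W scW (yes S⊆W) = sym (multiplicity-const W scW v (S⊆W v∈S))
    same W scW (no _)    = refl

  -- Forests whose roots fall into two parts

  SplitRoots : Subset n → Subset n → EdgeSet n → Set
  SplitRoots Z S T = IsForest T × S ⊆ roots T × roots T ─ S ≡ Z

  splitRoots? : ∀ Z S T → Dec (SplitRoots Z S T)
  splitRoots? Z S T = isForest? T ×-dec S ⊆? roots T ×-dec (roots T ─ S) ≟ˢ Z

  -- This will be the exponent sum over W ⊇ `S` in `detTrees Z`: the forests whose roots are the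
  -- disjoint union of `Z` and `S`.
  splitCount : Subset n → Subset n → ℕ
  splitCount Z S = ∑ℕ (edgeSets n) (λ T → ⟦ splitRoots? Z S T ⟧)

  -- Group the forests on the right by `Z = roots T ─ S`. This is the exponent count of
  -- `treesFactorisation`, with the same range of `Z`, so both can be solved for the term `Z = K` in
  -- parallel.
  splitCount-sum : ∀ K S →
    ∑ℕ (subsets n) (λ Z → if does (K ⊆? Z) then splitCount Z S else 0) ≡
    ∑ℕ (edgeSets n) (λ T → if does (spans? K T) then ⟦ S ⊆? roots T ─ K ⟧ else 0)
  splitCount-sum K S = begin
    ∑ℕ (subsets n) (λ Z → if does (K ⊆? Z) then splitCount Z S else 0)
      ≡⟨ ∑ℕ-cong (subsets n) (λ {Z} _ → expand Z (K ⊆? Z)) ⟩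
    ∑ℕ (subsets n) (λ Z → ∑ℕ (edgeSets n) (λ T → ⟦ term? Z T ⟧))
      ≡⟨ ∑ℕ-comm (subsets n) (edgeSets n) (λ Z T → ⟦ term? Z T ⟧) ⟩
    ∑ℕ (edgeSets n) (λ T → ∑ℕ (subsets n) (λ Z → ⟦ term? Z T ⟧))
      ≡⟨ ∑ℕ-cong (edgeSets n) (λ {T} _ → trans
           (∑ℕ-single (subsets-unique n) (∈-subsets (roots T ─ S))
             (λ {Z} _ Z≢ → ⟦⟧-no (term? Z T) (λ (_ , _ , _ , eq) → Z≢ (sym eq))))
           (trans (⟦⟧-⇔ (term? (roots T ─ S) T) (spans? K T ×-dec S ⊆? roots T ─ K) to from)
                    (collapse (spans? K T) (S ⊆? roots T ─ K)))) ⟩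
    ∑ℕ (edgeSets n) (λ T → if does (spans? K T) then ⟦ S ⊆? roots T ─ K ⟧ else 0) ∎
    where
    open ≡-Reasoning
    term? : ∀ Z T → Dec (K ⊆ Z × SplitRoots Z S T)
    term? Z T = K ⊆? Z ×-dec splitRoots? Z S T
    expand : ∀ Z (d : Dec (K ⊆ Z)) → (if does d then splitCount Z S else 0) ≡
             ∑ℕ (edgeSets n) (λ T → ⟦ d ×-dec splitRoots? Z S T ⟧)
    expand Z (yes _) = refl
    expand Z (no _)  = sym (∑ℕ-0 (edgeSets n) λ _ → refl)
    collapse : ∀ {A B : Set} (d : Dec A) (e : Dec B) → ⟦ d ×-dec e ⟧ ≡ (if does d then ⟦ e ⟧ else 0)
    collapse (yes _) _ = refl
    collapse (no _)  _ = refl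
    to : ∀ {T} → K ⊆ roots T ─ S × SplitRoots (roots T ─ S) S T →
         (IsForest T × K ⊆ roots T) × S ⊆ roots T ─ K
    to {T} (K⊆ , forest , S⊆ , _) = (forest , p─q⊆p (roots T) S ∘ K⊆) ,
      λ s∈ → x∈p∧x∉q⇒x∈p─q (S⊆ s∈) λ s∈K → x∈p─q⇒x∉q (roots T) S (K⊆ s∈K) s∈
    from : ∀ {T} → (IsForest T × K ⊆ roots T) × S ⊆ roots T ─ K →
           K ⊆ roots T ─ S × SplitRoots (roots T ─ S) S T
    from {T} ((forest , K⊆) , S⊆) =
      (λ k∈ → x∈p∧x∉q⇒x∈p─q (K⊆ k∈) λ k∈S → x∈p─q⇒x∉q (roots T) K (S⊆ k∈S) k∈) ,
      forest , p─q⊆p (roots T) K ∘ S⊆ , refl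

  splitCount-⊥ : ∀ S → splitCount ⊥ S ≡ forestCount S
  splitCount-⊥ S = trans (∑ℕ-cong (edgeSets n) λ {T} _ →
      ⟦⟧-⇔ (splitRoots? ⊥ S T) (forestOn? S T) (to T) (from T))
    (sym (length-filter-∑ (forestOn? S) (edgeSets n)))
    where
    to : ∀ T → SplitRoots ⊥ S T → IsForest T × roots T ≡ S
    to T (forest , S⊆ , eq) = forest , ⊆-antisym (λ {w} → inside w) S⊆
      where
      inside : ∀ w → w ∈ roots T → w ∈ S
      inside w w∈ with w ∈? S
      ... | yes w∈S = w∈S
      ... | no w∉S  = contradiction (subst (w ∈_) eq (x∈p∧x∉q⇒x∈p─q w∈ w∉S)) ∉⊥
    from : ∀ T → IsForest T × roots T ≡ S → SplitRoots ⊥ S T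
    from T (forest , refl) = forest , id ,
      Empty-unique λ (w , w∈) → x∈p─q⇒x∉q (roots T) (roots T) w∈ (p─q⊆p (roots T) (roots T) w∈)

-- Determinants as products over strongly connected sets

module Factorising {c ℓ} (R : CommutativeRing c ℓ) {n} (G : Digraph n)
                   (x : Fin n → Fin n → CommutativeRing.Carrier R)
                   (y : Fin n → CommutativeRing.Carrier R) where

  open CommutativeRing R hiding (zero) renaming (refl to ≈-refl; sym to ≈-sym; trans to ≈-trans)
  open DeterminantOn R
  open Lifting R G x y
  open Forests G
  open Multiplicities G
  open import Algebra.Properties.Semiring.Exp semiring using (_^_; ^-homo-*)
  open import Algebra.Properties.CommutativeSemigroup *-commutativeSemigroup using (interchange)
  open import Algebra.Solver.Ring.NaturalCoefficients.Default commutativeSemiring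
    using (solve; _:*_; _:=_)
  open import Relation.Binary.Reasoning.Setoid setoid

  private
    L : Fin n → Fin n → Carrier
    L = Schrödinger R G x y

    D : Subset n → Carrier
    D = detRestricted R G x y

    Π : (Subset n → ℕ) → Carrier
    Π = factorisation R G x y

  Π-0 : Π (λ _ → 0) ≈ 1#
  Π-0 = ∏-1 stronglyConnecteds λ _ → ≈-refl

  Π-+ : ∀ p q → Π (λ W → p W ℕ.+ q W) ≈ Π p * Π q
  Π-+ p q = ≈-trans (∏-cong stronglyConnecteds λ {W} _ → ^-homo-* (D W) (p W) (q W))
                  (∏-* stronglyConnecteds _ _)

  Π-cong : ∀ p q → (∀ W → StronglyConnected G W → p W ≡ q W) → Π p ≈ Π q
  Π-cong p q p≡q = ∏-cong stronglyConnecteds λ {W} W∈ →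
    reflexive (≡.cong (D W ^_) (p≡q W (∈-stronglyConnecteds⁻ W∈)))

  ζ-+ : ∀ p q S → ζ (λ W → p W ℕ.+ q W) S ≡ ζ p S ℕ.+ ζ q S
  ζ-+ p q S = ≡.trans (∑ℕ-cong stronglyConnecteds λ {W} _ → split-if (does (S ⊆? W)))
                      (∑ℕ-+ stronglyConnecteds _ _)
    where
    split-if : ∀ b {i j} → (if b then i ℕ.+ j else 0) ≡ (if b then i else 0) ℕ.+ (if b then j else 0)
    split-if true  = ≡.refl
    split-if false = ≡.refl

  -- d is a quotient of two products of determinants det(L_W); the exponents
  -- of W ⊇ S in this quotient add up to `count S`.
  record Represents (d : Carrier) (count : Subset n → ℕ) : Set ℓ where
    field
      numerator denominator : Subset n → ℕ
      equation : d * Π denominator ≈ Π numerator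
      counts   : ∀ S → StronglyConnected G S → ζ numerator S ≡ ζ denominator S ℕ.+ count S

  open Represents

  represents-resp : ∀ {d d′ k k′} → d ≈ d′ → (∀ S → StronglyConnected G S → k S ≡ k′ S) →
                    Represents d k → Represents d′ k′
  represents-resp d≈d′ k≡k′ r = record
    { numerator   = numerator r
    ; denominator = denominator r
    ; equation    = ≈-trans (*-congʳ (≈-sym d≈d′)) (equation r)
    ; counts      = λ S sc → ≡.trans (counts r S sc) (≡.cong (ζ (denominator r) S ℕ.+_) (k≡k′ S sc))
    }

  represents-1 : Represents 1# (λ _ → 0)
  represents-1 = record
    { numerator   = λ _ → 0
    ; denominator = λ _ → 0
    ; equation    = *-identityˡ _
    ; counts      = λ _ _ → ≡.sym (ℕ.+-identityʳ _)
    }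

  represents-* : ∀ {d d′ k k′} → Represents d k → Represents d′ k′ →
                 Represents (d * d′) (λ S → k S ℕ.+ k′ S)
  represents-* {k = k} {k′} r r′ = record
    { numerator   = λ W → numerator r W ℕ.+ numerator r′ W
    ; denominator = λ W → denominator r W ℕ.+ denominator r′ W
    ; equation    = ≈-trans (*-congˡ (Π-+ (denominator r) (denominator r′))) (≈-trans (interchange _ _ _ _)
                      (≈-trans (*-cong (equation r) (equation r′))
                             (≈-sym (Π-+ (numerator r) (numerator r′)))))
    ; counts      = λ S sc → ≡.trans (ζ-+ (numerator r) (numerator r′) S) (≡.trans (≡.cong₂ ℕ._+_ (counts r S sc) (counts r′ S sc))
        (≡.trans (+-interchange (ζ (denominator r) S) (k S) (ζ (denominator r′) S) (k′ S))
                 (≡.cong (ℕ._+ (k S ℕ.+ k′ S)) (≡.sym (ζ-+ (denominator r) (denominator r′) S)))))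
    }
    where
    +-interchange : ∀ a b c d → (a ℕ.+ b) ℕ.+ (c ℕ.+ d) ≡ (a ℕ.+ c) ℕ.+ (b ℕ.+ d)
    +-interchange = +-*-Solver.solve 4 (λ a b c d →
      (a :+ b) :+ (c :+ d) +-*-Solver.:= (a :+ c) :+ (b :+ d)) ≡.refl
      where open +-*-Solver using (_:+_)

  -- Nothing is divided: the two exponent functions of `d′` change places and the equation is
  -- multiplied by the denominator of `d′`. So `d′` may be a zero divisor.
  represents-/ : ∀ {d d′ k k′} → Represents (d * d′) (λ S → k S ℕ.+ k′ S) → Represents d′ k′ →
                 Represents d k
  represents-/ {d} {d′} {k} {k′} r r′ = record
    { numerator   = λ W → numerator r W ℕ.+ denominator r′ W
    ; denominator = λ W → denominator r W ℕ.+ numerator r′ W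
    ; equation    = begin
        d * Π (λ W → denominator r W ℕ.+ numerator r′ W)
          ≈⟨ *-congˡ (≈-trans (Π-+ (denominator r) (numerator r′)) (*-congˡ (≈-sym (equation r′)))) ⟩
        d * (Π (denominator r) * (d′ * Π (denominator r′)))
          ≈⟨ solve 4 (λ d q d′ q′ → d :* (q :* (d′ :* q′)) := ((d :* d′) :* q) :* q′) ≈-refl d (Π (denominator r)) d′ (Π (denominator r′)) ⟩
        ((d * d′) * Π (denominator r)) * Π (denominator r′) ≈⟨ *-congʳ (equation r) ⟩
        Π (numerator r) * Π (denominator r′) ≈⟨ Π-+ (numerator r) (denominator r′) ⟨
        Π (λ W → numerator r W ℕ.+ denominator r′ W) ∎
    ; counts      = λ S sc → ≡.trans (ζ-+ (numerator r) (denominator r′) S)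
        (≡.trans (≡.cong (ℕ._+ ζ (denominator r′) S) (counts r S sc))
        (≡.trans (shuffle (ζ (denominator r) S) (k S) (k′ S) (ζ (denominator r′) S))
        (≡.cong (ℕ._+ k S) (≡.trans (≡.cong (ζ (denominator r) S ℕ.+_) (≡.sym (counts r′ S sc)))
                                    (≡.sym (ζ-+ (denominator r) (numerator r′) S))))))
    }
    where
    shuffle : ∀ q k k′ q′ → (q ℕ.+ (k ℕ.+ k′)) ℕ.+ q′ ≡ (q ℕ.+ (q′ ℕ.+ k′)) ℕ.+ k
    shuffle = +-*-Solver.solve 4 (λ q k k′ q′ →
      (q :+ (k :+ k′)) :+ q′ +-*-Solver.:= (q :+ (q′ :+ k′)) :+ k) ≡.refl
      where open +-*-Solver using (_:+_)

  represents-∏ : ∀ {a} {A : Set a} (xs : List A) {d : A → Carrier} {k : A → Subset n → ℕ} →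
                 (∀ x → Represents (d x) (k x)) → Represents (∏ xs d) (λ S → ∑ℕ xs (λ x → k x S))
  represents-∏ []       r = represents-1
  represents-∏ (x ∷ xs) r = represents-* (r x) (represents-∏ xs r)

  represents-if : ∀ {a} {A : Set a} (t : Dec A) {d k} → (A → Represents d k) →
                  Represents (if does t then d else 1#) (λ S → if does t then k S else 0)
  represents-if (yes p) r = r p
  represents-if (no _)  r = represents-1

  detRestricted-connected : ∀ {W} → StronglyConnected G W → Represents (D W) (λ S → ⟦ S ⊆? W ⟧)
  detRestricted-connected {W} sc = record
    { numerator   = one
    ; denominator = λ _ → 0
    ; equation    = begin
        D W * Π (λ _ → 0) ≈⟨ ≈-trans (*-congˡ Π-0) (*-identityʳ _) ⟩
        D W               ≈⟨ ≈-trans (*-identityʳ _) ≈-refl ⟨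
        D W ^ 1           ≡⟨ ≡.cong (D W ^_) (⟦⟧-yes (W ≟ˢ W) ≡.refl) ⟨
        D W ^ one W       ≈⟨ ∏-single stronglyConnecteds-unique (∈-stronglyConnecteds⁺ sc)
                               (λ {V} _ V≢W → reflexive (≡.cong (D V ^_) (⟦⟧-no (V ≟ˢ W) V≢W))) ⟨
        Π one ∎
    ; counts      = λ S _ → ≡.trans
        (∑ℕ-single stronglyConnecteds-unique (∈-stronglyConnecteds⁺ sc) (λ {V} _ V≢W → off V≢W (does (S ⊆? V))))
        (≡.trans (≡.cong (if does (S ⊆? W) then_else 0) (⟦⟧-yes (W ≟ˢ W) ≡.refl))
          (≡.cong (ℕ._+ ⟦ S ⊆? W ⟧) (≡.sym (∑ℕ-0 stronglyConnecteds λ {V} _ → zero′ (does (S ⊆? V))))))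
    }
    where
    one : Subset n → ℕ
    one V = ⟦ V ≟ˢ W ⟧
    zero′ : ∀ b → (if b then 0 else 0) ≡ 0
    zero′ true  = ≡.refl
    zero′ false = ≡.refl
    off : ∀ {V} → V ≢ W → ∀ b → (if b then one V else 0) ≡ 0
    off {V} V≢W true  = ⟦⟧-no (V ≟ˢ W) V≢W
    off     V≢W false = ≡.refl

  ∈-elements⁺ : ∀ {W : Subset n} {v} → v ∈ W → v List.∈ elements W
  ∈-elements⁺ {W} {v} = ∈-filter⁺ (_∈? W) (∈-allFin v)

  ∈-elements⁻ : ∀ {W : Subset n} {v} → v List.∈ elements W → v ∈ W
  ∈-elements⁻ {W} = proj₂ ∘ ∈-filter⁻ (_∈? W) {xs = allFin n}

  elements-unique : ∀ (W : Subset n) → Unique (elements W)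
  elements-unique W = Unique.filter⁺ (_∈? W) (Unique.allFin⁺ n)

  -- No edge leads from `U` to `W ─ U`, so the matrix is block triangular.
  detRestricted-split : ∀ {U W} → U ⊆ W → (∀ {u v} → u ∈ U → v ∈ W → _⟶_ G u v → v ∈ U) →
                        D W ≈ D U * D (W ─ U)
  detRestricted-split {U} {W} U⊆W closed = ≈-trans
    (detOn-↭ L (unique∧set⇒↭ (elements-unique W)
      (Unique.++⁺ (elements-unique U) (elements-unique (W ─ U))
        (λ (u∈ , v∈) → x∈p─q⇒x∉q W U (∈-elements⁻ v∈) (∈-elements⁻ u∈)))
      to from))
    (detOn-++ (elements U) (elements (W ─ U)) L λ u∈ v∈ →
      vanish (∈-elements⁻ u∈) (∈-elements⁻ v∈))
    where
    to : ∀ {v} → v List.∈ elements W → v List.∈ elements U ++ elements (W ─ U)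
    to {v} v∈ with v ∈? U
    ... | yes v∈U = ∈-++⁺ˡ (∈-elements⁺ v∈U)
    ... | no v∉U  = ∈-++⁺ʳ (elements U) (∈-elements⁺ (x∈p∧x∉q⇒x∈p─q (∈-elements⁻ v∈) v∉U))
    from : ∀ {v} → v List.∈ elements U ++ elements (W ─ U) → v List.∈ elements W
    from v∈ = ∈-elements⁺ (Sum.[ U⊆W ∘ ∈-elements⁻ , p─q⊆p W U ∘ ∈-elements⁻ ] (∈-++⁻ (elements U) v∈))
    vanish : ∀ {u v} → u ∈ U → v ∈ W ─ U → L u v ≈ 0#
    vanish {u} {v} u∈U v∈ = ≈-trans (L-off (λ { ≡.refl → v∉U u∈U })) (zero-weight (_⟶?_ G u v))
      where
      v∉U = x∈p─q⇒x∉q W U v∈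
      zero-weight : ∀ (d : Dec (_⟶_ G u v)) → (if does d then x u v else 0#) ≈ 0#
      zero-weight (yes e) = contradiction (closed u∈U (p─q⊆p W U v∈) e) v∉U
      zero-weight (no _)  = ≈-refl

  -- If some `v` in `W` cannot be reached from `u` inside `W`, the set `U` of vertices reachable
  -- from `u` is closed, and both `U` and `W ─ U` are smaller than `W`. A strongly connected set
  -- inside `W` that meets `U` lies in `U`, so the counts of the two parts add up.
  detRestricted-represents : ∀ W → Represents (D W) (λ S → ⟦ S ⊆? W ⟧)
  detRestricted-represents W = go W (⊂-wellFounded W)
    where
    go : ∀ W → Acc _⊂_ W → Represents (D W) (λ S → ⟦ S ⊆? W ⟧)
    go W (acc smaller) with nonempty? W
    -- The empty determinant is 1, and strongly connected sets are nonempty, so none is contained in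
    -- `W`.
    ... | no empty = represents-resp (reflexive (≡.cong (λ is → detOn R is L) (≡.sym no-elements)))
      (λ S ((s , s∈) , _) → ≡.sym (⟦⟧-no (S ⊆? W) λ S⊆W → empty (s , S⊆W s∈))) represents-1
      where
      no-elements : elements W ≡ []
      no-elements = filter-none (_∈? W) {xs = allFin n} (All.universal (λ v v∈ → empty (v , v∈)) (allFin n))
    ... | yes W≢∅ with any? (λ u → any? λ v → u ∈? W ×-dec v ∈? W ×-dec ¬? (star? u v))
      where open Reachability (induced? G W)
    ...   | no none = detRestricted-connected (W≢∅ , connected)
      where
      open Reachability (induced? G W)
      connected : ∀ u v → u ∈ W → v ∈ W → Star (Induced G W) u v
      connected u v u∈ v∈ with star? u v
      ... | yes p = p
      ... | no ¬p = ⊥-elim (none (u , v , u∈ , v∈ , ¬p))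
    ...   | yes (u , v , u∈W , v∈W , ¬path) = represents-resp (≈-sym (detRestricted-split U⊆W closed)) count
      (represents-* (go U (smaller (U⊆W , v , v∈W , λ v∈U → ¬path (proj₂ (∈U⁻ v∈U)))))
                    (go (W ─ U) (smaller (p─q⊆p W U , u , u∈W , λ u∈ → x∈p─q⇒x∉q W U u∈ (∈U⁺ u∈W ε)))))
      where
      open Reachability (induced? G W)
      inU? : ∀ w → Dec (w ∈ W × Star (Induced G W) u w)
      inU? w = w ∈? W ×-dec star? u w
      U : Subset n
      U = comprehension inU?
      ∈U⁺ : ∀ {w} → w ∈ W → Star (Induced G W) u w → w ∈ U
      ∈U⁺ w∈ p = ∈-comprehension⁺ inU? (w∈ , p)
      ∈U⁻ : ∀ {w} → w ∈ U → w ∈ W × Star (Induced G W) u w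
      ∈U⁻ = ∈-comprehension⁻ inU?
      U⊆W : U ⊆ W
      U⊆W = proj₁ ∘ ∈U⁻
      follow : ∀ {a b} → a ∈ U → b ∈ W → Star (Induced G W) a b → b ∈ U
      follow a∈ b∈ p = ∈U⁺ b∈ (proj₂ (∈U⁻ a∈) ◅◅ p)
      closed : ∀ {a b} → a ∈ U → b ∈ W → _⟶_ G a b → b ∈ U
      closed a∈ b∈ e = follow a∈ b∈ ((U⊆W a∈ , b∈ , e) ◅ ε)
      count : ∀ S → StronglyConnected G S → ⟦ S ⊆? U ⟧ ℕ.+ ⟦ S ⊆? W ─ U ⟧ ≡ ⟦ S ⊆? W ⟧
      count S ((s , s∈) , conn) with S ⊆? W
      ... | no S⊈W = ≡.cong₂ ℕ._+_ (⟦⟧-no (S ⊆? U) λ S⊆U → S⊈W λ w∈ → U⊆W (S⊆U w∈))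
                                   (⟦⟧-no (S ⊆? W ─ U) λ S⊆ → S⊈W λ w∈ → p─q⊆p W U (S⊆ w∈))
      ... | yes S⊆W with s ∈? U
      ...   | yes s∈U = ≡.cong₂ ℕ._+_ (⟦⟧-yes (S ⊆? U) λ {t} t∈ → follow s∈U (S⊆W t∈) (path s∈ t∈))
                                      (⟦⟧-no (S ⊆? W ─ U) λ S⊆ → x∈p─q⇒x∉q W U (S⊆ s∈) s∈U)
        where
        path : ∀ {a b} → a ∈ S → b ∈ S → Star (Induced G W) a b
        path a∈ b∈ = Star.map (λ (i , j , e) → S⊆W i , S⊆W j , e) (conn _ _ a∈ b∈)
      ...   | no s∉U = ≡.cong₂ ℕ._+_ (⟦⟧-no (S ⊆? U) λ S⊆U → s∉U (S⊆U s∈))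
                                     (⟦⟧-yes (S ⊆? W ─ U) λ {t} t∈ → x∈p∧x∉q⇒x∈p─q (S⊆W t∈)
                                       λ t∈U → s∉U (follow t∈U (S⊆W s∈) (path t∈ s∈)))
        where
        path : ∀ {a b} → a ∈ S → b ∈ S → Star (Induced G W) a b
        path a∈ b∈ = Star.map (λ (i , j , e) → S⊆W i , S⊆W j , e) (conn _ _ a∈ b∈)

  -- The identity `treesFactorisation K` contains `detTrees K` once and otherwise only `detTrees Z`
  -- for strictly larger `Z`, which the induction has already represented.
  detTrees-represents : ∀ K → Represents (detTrees K) (splitCount K)
  detTrees-represents K = go K (⊃-wellFounded K)
    where
    go : ∀ K → Acc _⊃_ K → Represents (detTrees K) (splitCount K)
    go K (acc larger) = represents-/
      (represents-resp equality (λ S _ → ≡.trans (≡.sym (splitCount-sum K S)) (peel S))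
        (represents-∏ (edgeSets n) λ T →
          represents-if (spans? K T) λ _ → detRestricted-represents (roots T ─ K)))
      (represents-∏ (subsets n) others)
      where
      factor other : Subset n → Carrier
      factor Z = if does (K ⊆? Z) then detTrees Z else 1#
      other Z = if does (Z ≟ˢ K) then 1# else factor Z
      term otherTerm : Subset n → Subset n → ℕ
      term Z S = if does (K ⊆? Z) then splitCount Z S else 0
      otherTerm Z S = if does (Z ≟ˢ K) then 0 else term Z S
      equality : ∏ (edgeSets n) (λ T → if does (spans? K T) then D (roots T ─ K) else 1#) ≈
                 detTrees K * ∏ (subsets n) other
      equality = ≈-trans (≈-sym (treesFactorisation K))
        (≈-trans (∏-remove _≟ˢ_ factor (subsets-unique n) (∈-subsets K))
          (reflexive (≡.cong (λ b → (if b then detTrees K else 1#) * ∏ (subsets n) other)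
                             (dec-true (K ⊆? K) id))))
      peel : ∀ S → ∑ℕ (subsets n) (λ Z → term Z S) ≡
                   splitCount K S ℕ.+ ∑ℕ (subsets n) (λ Z → otherTerm Z S)
      peel S = ≡.trans (∑ℕ-remove _≟ˢ_ (λ Z → term Z S) (subsets-unique n) (∈-subsets K))
        (≡.cong (λ b → (if b then splitCount K S else 0) ℕ.+ ∑ℕ (subsets n) (λ Z → otherTerm Z S))
                (dec-true (K ⊆? K) id))
      others : ∀ Z → Represents (other Z) (otherTerm Z)
      others Z = cases (Z ≟ˢ K) (K ⊆? Z)
        where
        cases : (d : Dec (Z ≡ K)) (e : Dec (K ⊆ Z)) →
          Represents (if does d then 1# else (if does e then detTrees Z else 1#))
                     (λ S → if does d then 0 else (if does e then splitCount Z S else 0))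
        cases (yes _)  e         = represents-1
        cases (no _)   (no _)    = represents-1
        cases (no Z≢K) (yes K⊆Z) = go Z (larger K⊂Z)
          where
          K⊂Z : K ⊂ Z
          K⊂Z with K ⊂? Z
          ... | yes p = p
          ... | no ¬p = contradiction (⊆-antisym (λ {x} → inside x) K⊆Z) Z≢K
            where
            inside : ∀ x → x ∈ Z → x ∈ K
            inside x x∈Z with x ∈? K
            ... | yes x∈K = x∈K
            ... | no x∉K  = ⊥-elim (¬p ((λ {y} → K⊆Z {y}) , x , x∈Z , x∉K))

  -- Equal zeta transforms identify the numerator with `m + q`. The factor of `q` remains on both
  -- sides because over a general ring it may be a zero divisor.
  detLifted-factorisation : ∀ m → (∀ {S} → StronglyConnected G S → ζ m S ≡ forestCount S) →
    ∃ λ q → detLifted R G x y * Π q ≈ Π m * Π q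
  detLifted-factorisation m ζm = q , (begin
    detLifted R G x y * Π q ≡⟨ ≡.cong (λ is → detOn R is (LiftedSchrödinger R G x y) * Π q) trees-⊥ ⟨
    detTrees ⊥ * Π q        ≈⟨ equation r ⟩
    Π (numerator r)         ≈⟨ Π-cong (numerator r) (λ W → m W ℕ.+ q W) (λ W sc → ζ-injective (numerator r) (λ W → m W ℕ.+ q W) W sc same) ⟩
    Π (λ W → m W ℕ.+ q W)   ≈⟨ Π-+ m q ⟩
    Π m * Π q ∎)
    where
    r = detTrees-represents ⊥
    q = denominator r
    same : ∀ {S} V → StronglyConnected G V → S ⊆ V → ζ (numerator r) V ≡ ζ (λ W → m W ℕ.+ q W) V
    same V sc _ = ≡.trans (counts r V sc)
      (≡.trans (≡.cong (ζ q V ℕ.+_) (≡.trans (splitCount-⊥ V) (≡.sym (ζm sc))))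
      (≡.trans (ℕ.+-comm (ζ q V) (ζ m V)) (≡.sym (ζ-+ m q V))))

-- Cancellation over R[t]

module PowerSeries {c ℓ} (R : CommutativeRing c ℓ) where

  open CommutativeRing R hiding (zero) renaming (refl to ≈-refl; sym to ≈-sym; trans to ≈-trans)
  open import Algebra.Properties.Ring ring using (-0#≈0#; x[y-z]≈xy-xz)
  open import Algebra.Properties.Group +-group using (x∙y⁻¹≈ε⇒x≈y)
  open import Algebra.Properties.CommutativeSemigroup +-commutativeSemigroup using (interchange)
  open import Algebra.Properties.Semiring.Sum semiring using (sum)
  open import Algebra.Properties.Semiring.Exp semiring using (_^_)
  open import Relation.Binary.Reasoning.Setoid setoid

  -- Admitting all coefficient sequences keeps degrees out of the ring laws; polynomials return as
  -- the predicate `Polynomial`, where cancellation needs them.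
  Series : Set c
  Series = ℕ → Carrier

  infix 4 _≋_
  _≋_ : Series → Series → Set ℓ
  f ≋ g = ∀ k → f k ≈ g k

  constant : Carrier → Series
  constant a zero    = a
  constant a (suc k) = 0#

  infixl 7 _⊛_
  _⊛_ : Series → Series → Series
  (f ⊛ g) zero    = f zero * g zero
  (f ⊛ g) (suc k) = f zero * g (suc k) + (f ∘ suc ⊛ g) k

  ⊛-cong : ∀ {f f′ g g′} → f ≋ f′ → g ≋ g′ → f ⊛ g ≋ f′ ⊛ g′
  ⊛-cong p q zero    = *-cong (p zero) (q zero)
  ⊛-cong p q (suc k) = +-cong (*-cong (p zero) (q (suc k))) (⊛-cong (p ∘ suc) q k)

  ⊛-suc : ∀ f g k → (f ⊛ g) (suc k) ≈ (f ⊛ g ∘ suc) k + f (suc k) * g zero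
  ⊛-suc f g zero    = ≈-refl
  ⊛-suc f g (suc k) = ≈-trans (+-congˡ (⊛-suc (f ∘ suc) g k)) (≈-sym (+-assoc _ _ _))

  ⊛-comm : ∀ f g → f ⊛ g ≋ g ⊛ f
  ⊛-comm f g zero    = *-comm _ _
  ⊛-comm f g (suc k) = ≈-trans (+-cong (*-comm _ _) (⊛-comm (f ∘ suc) g k))
    (≈-trans (+-comm _ _) (≈-sym (⊛-suc g f k)))

  ⊛-zeroˡ : ∀ {f} g → (∀ k → f k ≈ 0#) → ∀ k → (f ⊛ g) k ≈ 0#
  ⊛-zeroˡ g f≈0 zero    = ≈-trans (*-congʳ (f≈0 zero)) (zeroˡ _)
  ⊛-zeroˡ g f≈0 (suc k) = ≈-trans
    (+-cong (≈-trans (*-congʳ (f≈0 zero)) (zeroˡ _)) (⊛-zeroˡ g (f≈0 ∘ suc) k)) (+-identityˡ 0#)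

  ⊛-constantˡ : ∀ f g → (∀ k → f (suc k) ≈ 0#) → ∀ k → (f ⊛ g) k ≈ f zero * g k
  ⊛-constantˡ f g f≈0 zero    = ≈-refl
  ⊛-constantˡ f g f≈0 (suc k) = ≈-trans (+-congˡ (⊛-zeroˡ g f≈0 k)) (+-identityʳ _)

  ⊛-identityˡ : ∀ f → constant 1# ⊛ f ≋ f
  ⊛-identityˡ f k = ≈-trans (⊛-constantˡ (constant 1#) f (λ _ → ≈-refl) k) (*-identityˡ _)

  ⊛-distribʳ : ∀ h f g → (λ k → f k + g k) ⊛ h ≋ λ k → (f ⊛ h) k + (g ⊛ h) k
  ⊛-distribʳ h f g zero    = distribʳ _ _ _
  ⊛-distribʳ h f g (suc k) = ≈-trans
    (+-cong (distribʳ _ _ _) (⊛-distribʳ h (f ∘ suc) (g ∘ suc) k)) (interchange _ _ _ _)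

  ⊛-scale : ∀ a f g k → ((λ i → a * f i) ⊛ g) k ≈ a * (f ⊛ g) k
  ⊛-scale a f g zero    = *-assoc _ _ _
  ⊛-scale a f g (suc k) = ≈-trans
    (+-cong (*-assoc _ _ _) (⊛-scale a (f ∘ suc) g k)) (≈-sym (distribˡ _ _ _))

  ⊛-assoc : ∀ f g h → (f ⊛ g) ⊛ h ≋ f ⊛ (g ⊛ h)
  ⊛-assoc f g h zero    = *-assoc _ _ _
  ⊛-assoc f g h (suc k) = begin
    (f zero * g zero) * h (suc k) + ((λ i → f zero * g (suc i) + (f ∘ suc ⊛ g) i) ⊛ h) k
      ≈⟨ +-cong (*-assoc _ _ _) (≈-trans (⊛-distribʳ h (λ i → f zero * g (suc i)) (f ∘ suc ⊛ g) k)
           (+-cong (⊛-scale (f zero) (g ∘ suc) h k) (⊛-assoc (f ∘ suc) g h k))) ⟩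
    f zero * (g zero * h (suc k)) + (f zero * (g ∘ suc ⊛ h) k + (f ∘ suc ⊛ (g ⊛ h)) k)
      ≈⟨ +-assoc _ _ _ ⟨
    (f zero * (g zero * h (suc k)) + f zero * (g ∘ suc ⊛ h) k) + (f ∘ suc ⊛ (g ⊛ h)) k
      ≈⟨ +-congʳ (distribˡ _ _ _) ⟨
    (f ⊛ (g ⊛ h)) (suc k) ∎

  powerSeries : CommutativeRing c ℓ
  powerSeries = record
    { Carrier = Series
    ; _≈_ = _≋_
    ; _+_ = λ f g k → f k + g k
    ; _*_ = _⊛_
    ; -_  = λ f k → - f k
    ; 0#  = λ _ → 0#
    ; 1#  = constant 1#
    ; isCommutativeRing = record
      { isRing = record
        { +-isAbelianGroup = record
          { isGroup = record
            { isMonoid = record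
              { isSemigroup = record
                { isMagma = record
                  { isEquivalence = record
                    { refl  = λ _ → ≈-refl
                    ; sym   = λ p k → ≈-sym (p k)
                    ; trans = λ p q k → ≈-trans (p k) (q k)
                    }
                  ; ∙-cong = λ p q k → +-cong (p k) (q k)
                  }
                ; assoc = λ f g h k → +-assoc _ _ _
                }
              ; identity = (λ f k → +-identityˡ _) , (λ f k → +-identityʳ _)
              }
            ; inverse = (λ f k → -‿inverseˡ _) , (λ f k → -‿inverseʳ _)
            ; ⁻¹-cong = λ p k → -‿cong (p k)
            }
          ; comm = λ f g k → +-comm _ _
          }
        ; *-cong = ⊛-cong
        ; *-assoc = ⊛-assoc
        ; *-identity = ⊛-identityˡ , λ f k → ≈-trans (⊛-comm f (constant 1#) k) (⊛-identityˡ f k)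
        ; distrib = (λ f g h k → ≈-trans (⊛-comm f _ k) (≈-trans (⊛-distribʳ f g h k)
                                   (+-cong (⊛-comm g f k) (⊛-comm h f k))))
                  , ⊛-distribʳ
        }
      ; *-comm = ⊛-comm
      }
    }

  private
    module S = CommutativeRing powerSeries
  open import Algebra.Properties.Semiring.Sum S.semiring using () renaming (sum to sumˢ)
  open import Algebra.Properties.Semiring.Exp S.semiring using () renaming (_^_ to _^ˢ_)

  -- A formal degree: `f` has degree at most `k`, and `a` may be 0. Formal degrees add under `⊛`
  -- over every ring, zero divisors or not.
  record Leading (k : ℕ) (a : Carrier) (f : Series) : Set ℓ where
    field
      coefficient : f k ≈ a
      above       : ∀ {j} → k < j → f j ≈ 0#

  open Leading

  leading-constant : ∀ {a f} → f zero ≈ a → (∀ k → f (suc k) ≈ 0#) → Leading 0 a f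
  leading-constant f₀ f≈0 = record { coefficient = f₀ ; above = λ { (s≤s _) → f≈0 _ } }

  leading-* : ∀ {k l a b f g} → Leading k a f → Leading l b g → Leading (k ℕ.+ l) (a * b) (f ⊛ g)
  leading-* {zero} {f = f} {g} p q = record
    { coefficient = ≈-trans (const _) (*-cong (coefficient p) (coefficient q))
    ; above       = λ l<j → ≈-trans (const _) (≈-trans (*-congˡ (above q l<j)) (zeroʳ _))
    }
    where
    const : ∀ k → (f ⊛ g) k ≈ f zero * g k
    const = ⊛-constantˡ f g λ k → above p (s≤s z≤n)
  leading-* {suc k} {l} {a} {b} {f} {g} p q = record
    { coefficient = ≈-trans (+-congʳ (low (s≤s (ℕ.m≤n+m l k)))) (≈-trans (+-identityˡ _) (coefficient pq))
    ; above       = λ { (s≤s k+l<j) → ≈-trans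
        (+-cong (low (ℕ.m≤n⇒m≤1+n (ℕ.≤-trans (s≤s (ℕ.m≤n+m l k)) k+l<j))) (above pq k+l<j)) (+-identityˡ 0#) }
    }
    where
    pq : Leading (k ℕ.+ l) (a * b) (f ∘ suc ⊛ g)
    pq = leading-* {k} (record { coefficient = coefficient p ; above = above p ∘ s≤s }) q
    low : ∀ {j} → l < j → f zero * g j ≈ 0#
    low l<j = ≈-trans (*-congˡ (above q l<j)) (zeroʳ _)

  leading-sum : ∀ {m k} {a : Fin m → Carrier} {f : Fin m → Series} →
                (∀ i → Leading k (a i) (f i)) → Leading k (sum a) (sumˢ f)
  leading-sum {zero}  p = record { coefficient = ≈-refl ; above = λ _ → ≈-refl }
  leading-sum {suc m} p = record
    { coefficient = +-cong (coefficient (p zero)) (coefficient (leading-sum (p ∘ suc)))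
    ; above       = λ k<j → ≈-trans (+-cong (above (p zero) k<j) (above (leading-sum (p ∘ suc)) k<j)) (+-identityˡ 0#)
    }

  leading-1 : Leading 0 1# S.1#
  leading-1 = leading-constant ≈-refl λ _ → ≈-refl

  leading-sign : ∀ j → Leading 0 ((- 1#) ^ j) ((S.- S.1#) ^ˢ j)
  leading-sign zero    = leading-1
  leading-sign (suc j) = leading-* (leading-constant ≈-refl λ _ → -0#≈0#) (leading-sign j)

  -- The entries are affine in t, so the coefficient at `k` of each product of `k` entries takes the
  -- linear coefficient of every factor.
  leading-det : ∀ k {A : Fin k → Fin k → Carrier} {B : Fin k → Fin k → Series} →
                (∀ i j → Leading 1 (A i j) (B i j)) → Leading k (det R A) (det powerSeries B)
  leading-det zero    p = leading-1
  leading-det (suc k) p = leading-sum {suc k} λ j → leading-* (leading-sign (toℕ j))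
    (leading-* (p zero j) (leading-det k λ i i′ → p (suc i) (punchIn j i′)))

  Monic : Series → Set ℓ
  Monic f = ∃ λ k → Leading k 1# f

  monic-1 : Monic S.1#
  monic-1 = 0 , leading-1

  monic-* : ∀ {f g} → Monic f → Monic g → Monic (f ⊛ g)
  monic-* (k , p) (l , q) with pq ← leading-* p q = k ℕ.+ l , record
    { coefficient = ≈-trans (coefficient pq) (*-identityˡ 1#) ; above = above pq }

  monic-^ : ∀ {f} → Monic f → ∀ m → Monic (f ^ˢ m)
  monic-^ p zero    = monic-1
  monic-^ p (suc m) = monic-* p (monic-^ p m)

  Polynomial : Series → Set ℓ
  Polynomial f = ∃ λ k → ∀ {j} → k ≤ j → f j ≈ 0#

  leading-polynomial : ∀ {k a f} → Leading k a f → Polynomial f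
  leading-polynomial {k} p = suc k , above p

  -- If `g - h` vanishes beyond index `l`, the coefficient of its product with `f` at `k + l` is its
  -- own coefficient at `l`. This descent needs a top to start from, which is why `g` and `h` are
  -- polynomials: among series a monic `f` can be a zero divisor.
  monic-regular : ∀ {f g h} → Monic f → Polynomial g → Polynomial h → f ⊛ g ≋ f ⊛ h → g ≋ h
  monic-regular {f} {g} {h} (k , monic) (l , g≈0) (m , h≈0) fg≈fh j =
    x∙y⁻¹≈ε⇒x≈y (g j) (h j) (descend (l ℕ.+ m) vanish j)
    where
    d : Series
    d j = g j - h j
    vanish : ∀ {j} → l ℕ.+ m ≤ j → d j ≈ 0#
    vanish l+m≤j = ≈-trans (+-cong (g≈0 (ℕ.≤-trans (ℕ.m≤m+n l m) l+m≤j))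
      (-‿cong (h≈0 (ℕ.≤-trans (ℕ.m≤n+m m l) l+m≤j)))) (-‿inverseʳ 0#)
    fd≈0 : ∀ j → (f ⊛ d) j ≈ 0#
    fd≈0 j = ≈-trans (x[y-z]≈xy-xzˢ f g h j) (≈-trans (+-congʳ (fg≈fh j)) (-‿inverseʳ _))
      where open import Algebra.Properties.Ring S.ring using () renaming (x[y-z]≈xy-xz to x[y-z]≈xy-xzˢ)
    descend : ∀ l → (∀ {j} → l ≤ j → d j ≈ 0#) → ∀ j → d j ≈ 0#
    descend zero    d≈0 j = d≈0 z≤n
    descend (suc l) d≈0   = descend l λ l≤j → Sum.[ d≈0 , (λ { ≡.refl → d-l }) ] (ℕ.m≤n⇒m<n∨m≡n l≤j)
      where
      d-l : d l ≈ 0#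
      d-l = ≈-trans (≈-sym (*-identityˡ _)) (≈-trans
        (≈-sym (coefficient (leading-* monic (record { coefficient = ≈-refl ; above = d≈0 })))) (fd≈0 (k ℕ.+ l)))

  -- Specialisation of the variable to 0

  sum-₀ : ∀ {m} (f : Fin m → Series) {a} → (∀ i → f i 0 ≈ a i) → sumˢ f 0 ≈ sum a
  sum-₀ {zero}  f p = ≈-refl
  sum-₀ {suc m} f p = +-cong (p zero) (sum-₀ (f ∘ suc) (p ∘ suc))

  ^-₀ : ∀ f {a} → f 0 ≈ a → ∀ m → (f ^ˢ m) 0 ≈ a ^ m
  ^-₀ f p zero    = ≈-refl
  ^-₀ f p (suc m) = *-cong p (^-₀ f p m)

  det-₀ : ∀ k (B : Fin k → Fin k → Series) {A} → (∀ i j → B i j 0 ≈ A i j) →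
          det powerSeries B 0 ≈ det R A
  det-₀ zero    B p = ≈-refl
  det-₀ (suc k) B p = sum-₀ {suc k}
    (λ j → (S.- S.1#) ^ˢ toℕ j ⊛ (B zero j ⊛ det powerSeries (λ i i′ → B (suc i) (punchIn j i′))))
    λ j → *-cong (^-₀ (S.- S.1#) ≈-refl (toℕ j))
      (*-cong (p zero j) (det-₀ k (λ i i′ → B (suc i) (punchIn j i′)) λ i i′ → p (suc i) (punchIn j i′)))

  module _ {n} (G : Digraph n) (x : Fin n → Fin n → Carrier) (y : Fin n → Carrier) where

    open Multiplicities G
    private
      module Factors = Factorising powerSeries G

    -- Over R[t], the potential y + t makes every det(L_W) monic in t.
    xˢ : Fin n → Fin n → Series
    xˢ u v = constant (x u v)

    yˢ : Fin n → Series
    yˢ v zero          = y v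
    yˢ v (suc zero)    = 1#
    yˢ v (suc (suc k)) = 0#

    private
      D  = detRestricted R G x y
      Dˢ = detRestricted powerSeries G xˢ yˢ

    weight-₀ : ∀ u v → weight powerSeries G xˢ yˢ u v 0 ≈ weight R G x y u v
    weight-₀ u v with does (_⟶?_ G u v)
    ... | true  = ≈-refl
    ... | false = ≈-refl

    weight-suc : ∀ u v k → weight powerSeries G xˢ yˢ u v (suc k) ≈ 0#
    weight-suc u v k with does (_⟶?_ G u v)
    ... | true  = ≈-refl
    ... | false = ≈-refl

    out-₀ : ∀ u → sumˢ (weight powerSeries G xˢ yˢ u) 0 ≈ sum (weight R G x y u)
    out-₀ u = sum-₀ (weight powerSeries G xˢ yˢ u) (weight-₀ u)

    out-suc : ∀ u k → sumˢ (weight powerSeries G xˢ yˢ u) (suc k) ≈ 0#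
    out-suc u k = above (leading-sum {n} λ v → leading-constant (weight-₀ u v) (weight-suc u v)) (s≤s z≤n)

    schrödinger-₀ : ∀ u v → Schrödinger powerSeries G xˢ yˢ u v 0 ≈ Schrödinger R G x y u v
    schrödinger-₀ u v with does (u ≟ v)
    ... | true  = +-congʳ (-‿cong (out-₀ u))
    ... | false = +-congʳ (weight-₀ u v)

    schrödinger-leading : ∀ u v → Leading 1 (if does (u ≟ v) then 1# else 0#) (Schrödinger powerSeries G xˢ yˢ u v)
    schrödinger-leading u v with does (u ≟ v)
    ... | true  = record
      { coefficient = ≈-trans (+-congʳ (≈-trans (-‿cong (out-suc u 0)) -0#≈0#)) (+-identityˡ _)
      ; above = λ { (s≤s (s≤s _)) → ≈-trans (+-congʳ (≈-trans (-‿cong (out-suc u _)) -0#≈0#)) (+-identityˡ _) } }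
    ... | false = record
      { coefficient = ≈-trans (+-congʳ (weight-suc u v 0)) (+-identityˡ _)
      ; above = λ { (s≤s (s≤s _)) → ≈-trans (+-congʳ (weight-suc u v _)) (+-identityˡ _) } }

    private
      Mˢ = LiftedSchrödinger powerSeries G xˢ yˢ
      M  = LiftedSchrödinger R G x y

    lifted-₀ : ∀ a b → Mˢ a b 0 ≈ M a b
    lifted-₀ a b = go (does (a ≟ᵗ b)) (does (treeEdge? G a b))
      where
      u = proj₁ a
      v = proj₁ b
      go : ∀ same edge →
        (if same then (S.- sumˢ (weight powerSeries G xˢ yˢ u)) S.+ yˢ u else if edge then xˢ u v else S.0#) 0 ≈
        (if same then - sum (weight R G x y u) + y u else if edge then x u v else 0#)
      go true  _     = +-congʳ (-‿cong (out-₀ u))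
      go false true  = ≈-refl
      go false false = ≈-refl

    -- Only a bound on the degree is wanted, so the linear coefficient is left unevaluated.
    lifted-leading : ∀ a b → Leading 1 (Mˢ a b 1) (Mˢ a b)
    lifted-leading a b = record { coefficient = ≈-refl ; above = go (does (a ≟ᵗ b)) (does (treeEdge? G a b)) }
      where
      u = proj₁ a
      v = proj₁ b
      go : ∀ same edge {j} → 1 < j →
        (if same then (S.- sumˢ (weight powerSeries G xˢ yˢ u)) S.+ yˢ u else if edge then xˢ u v else S.0#) j ≈ 0#
      go true  _     (s≤s (s≤s _)) = ≈-trans (+-congʳ (≈-trans (-‿cong (out-suc u _)) -0#≈0#)) (+-identityˡ _)
      go false true  (s≤s (s≤s _)) = ≈-refl
      go false false _             = ≈-refl

    -- The variable enters on the diagonal only, with coefficient 1, so the linear coefficients form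
    -- an identity matrix.
    restricted-monic : ∀ W → Monic (Dˢ W)
    restricted-monic W = _ , record
      { coefficient = ≈-trans (coefficient leading) (DeterminantOn.detOn-identity R (Factors.elements-unique xˢ yˢ W)
          (λ {i} _ → reflexive (≡.cong (if_then 1# else 0#) (dec-true (i ≟ i) ≡.refl)))
          (λ {i} {j} _ _ i≢j → reflexive (≡.cong (if_then 1# else 0#) (dec-false (i ≟ j) i≢j))))
      ; above = above leading
      }
      where
      leading = leading-det _ λ i j → schrödinger-leading (List.lookup (elements W) i) (List.lookup (elements W) j)

    factorisation-monic : ∀ q → Monic (factorisation powerSeries G xˢ yˢ q)
    factorisation-monic q = go stronglyConnecteds
      where
      go : ∀ Ws → Monic (List.foldr _⊛_ S.1# (List.map (λ W → Dˢ W ^ˢ q W) Ws))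
      go []       = monic-1
      go (W ∷ Ws) = monic-* (monic-^ (restricted-monic W) (q W)) (go Ws)

    restricted-₀ : ∀ W → Dˢ W 0 ≈ D W
    restricted-₀ W = det-₀ (List.length (elements W))
      (λ i j → Schrödinger powerSeries G xˢ yˢ (List.lookup (elements W) i) (List.lookup (elements W) j))
      λ i j → schrödinger-₀ (List.lookup (elements W) i) (List.lookup (elements W) j)

    factorisation-₀ : ∀ q → factorisation powerSeries G xˢ yˢ q 0 ≈ factorisation R G x y q
    factorisation-₀ q = go stronglyConnecteds
      where
      go : ∀ Ws → List.foldr _⊛_ S.1# (List.map (λ W → Dˢ W ^ˢ q W) Ws) 0 ≈
                  List.foldr _*_ 1# (List.map (λ W → D W ^ q W) Ws)
      go []       = ≈-refl
      go (W ∷ Ws) = *-cong (^-₀ (Dˢ W) (restricted-₀ W) (q W)) (go Ws)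

    detOn-₀ : ∀ is → detOn powerSeries is Mˢ 0 ≈ detOn R is M
    detOn-₀ is = det-₀ (List.length is) (λ i j → Mˢ (List.lookup is i) (List.lookup is j))
      λ i j → lifted-₀ (List.lookup is i) (List.lookup is j)

    detOn-polynomial : ∀ is → Polynomial (detOn powerSeries is Mˢ)
    detOn-polynomial is = leading-polynomial (leading-det (List.length is) λ i j →
      lifted-leading (List.lookup is i) (List.lookup is j))

    lifted-factorisation : ∀ m → (∀ {S} → StronglyConnected G S → ζ m S ≡ forestCount S) →
                           detLifted R G x y ≈ factorisation R G x y m
    lifted-factorisation m ζm = begin
      detLifted R G x y                       ≈⟨ detOn-₀ (spanningTrees G) ⟨
      detLifted powerSeries G xˢ yˢ 0         ≈⟨ cancelled 0 ⟩
      factorisation powerSeries G xˢ yˢ m 0   ≈⟨ factorisation-₀ m ⟩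
      factorisation R G x y m ∎
      where
      q,eq = Factors.detLifted-factorisation xˢ yˢ m ζm
      Qˢ Πˢ Λˢ : Series
      Qˢ = factorisation powerSeries G xˢ yˢ (proj₁ q,eq)
      Πˢ = factorisation powerSeries G xˢ yˢ m
      Λˢ = detLifted powerSeries G xˢ yˢ
      cancelled : Λˢ ≋ Πˢ
      cancelled = monic-regular {Qˢ} {Λˢ} {Πˢ} (factorisation-monic (proj₁ q,eq))
        (detOn-polynomial (spanningTrees G)) (leading-polynomial (proj₂ (factorisation-monic m)))
        (λ k → ≈-trans (⊛-comm Qˢ Λˢ k) (≈-trans (proj₂ q,eq k) (⊛-comm Πˢ Qˢ k)))

mainTheorem1 : ∀ {c ℓ} {n : ℕ} (G : Digraph n) → StronglyConnected G ⊤ →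
    ∃ λ (m : Subset n → ℕ) →
    (∀ W → StronglyConnected G W → ∀ w → w ∈ W → multiplicity G W w ≡ m W) ×
    (∀ (R : CommutativeRing c ℓ) → let open CommutativeRing R in
    ∀ (x : Fin n → Fin n → Carrier) (y : Fin n → Carrier) →
    detLifted R G x y ≈ factorisation R G x y m)
mainTheorem1 G _ =
  multiplicityOf , multiplicity-const , λ R x y →
    PowerSeries.lifted-factorisation R G x y multiplicityOf ζ-multiplicityOf
  where open Multiplicities G
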